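{- Let $p$ be an odd prime, $\alpha$ an indeterminate over $\mathbb F_p$, and for $\gamma\in\mathbb F_p(\alpha)$ let \[ G^{(\gamma)}(X)=-\sum_{k=1}^{p-1}\frac{1}{k}\,\frac{X^{k}}{\prod_{s=1}^{k-1}b_{1,s}(\gamma)} \] (empty product equal to $1$). Then for every integer $h$ with $0<h<p$, \[ G^{(h\alpha)}\!\left(\frac{X^h}{\prod_{s=1}^{h-1}b_{1,s}(\alpha)}\right)\equiv h\,G^{(\alpha)}(X)\pmod{X^p-L_{p-1}^{(\alpha^p)}(\alpha^p-\alpha)} \] in the polynomial ring $\mathbb F_p(\alpha)[X]$, where $L_{p-1}^{(\alpha^p)}(\alpha^p-\alpha)$ is obtained from $L_{p-1}^{(\alpha)}(X)$ by substituting $\alpha^p$ for $\alpha$ and $\alpha^p-\alpha$ for $X$.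
   Context: $\mathbb F_p$ is the field of $p$ elements, $\binom{x}{m}=x(x-1)\cdots(x-m+1)/m!$. $L_{p-1}^{(\alpha)}(X)=\sum_{k=0}^{p-1}\binom{\alpha-1}{p-1-k}\frac{(-X)^k}{k!}\in\mathbb F_p[\alpha,X]$. For integers $0<r,s<p$ (interpreted as elements of $\mathbb F_p$), $b_{r,s}(\alpha)=\sum_{k=0}^{p-1}(-r/s)^k\binom{r\alpha-1}{p-1-k}\binom{s\alpha-1}{k}\in\mathbb F_p[\alpha]$, and $b_{1,s}(h\alpha)$ denotes substitution of $h\alpha$ for $\alpha$. -}

module Defs where

open import Algebra.Bundles using (CommutativeRing)
open import Algebra.Structures using (IsCommutativeRing)
import Algebra.Properties.Group as GroupProperties
import Algebra.Properties.Ring as RingProperties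
import Algebra.Properties.Semiring.Divisibility as SemiringDivisibility
import Algebra.Properties.Semiring.Exp as SemiringExp
import Algebra.Properties.Semiring.Mult as SemiringMult
import Algebra.Properties.Semiring.Sum as SemiringSum
import Algebra.Properties.CommutativeMonoid.Sum as MonoidSum
import Algebra.Solver.Ring.NaturalCoefficients.Default as NatSolver
open import Data.Empty using (⊥-elim)
open import Data.Fin.Base using (toℕ)
import Data.Integer.Base as ℤ
open ℤ using (ℤ; +_; -[1+_])
import Data.Integer.Properties as ℤₚ
import Data.Integer.Divisibility.Signed as ℤ∣
import Data.Integer.Tactic.RingSolver as ℤSolver
open import Data.List.Base using (List; []; _∷_; map)
open import Data.Nat.Base as ℕ using (ℕ; zero; suc; _∸_; _!)
import Data.Nat.Coprimality as Coprimality
import Data.Nat.Divisibility as ℕ∣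
open import Data.Nat.GCD using (module Bézout)
open import Data.Nat.Primality using (Prime; prime⇒irreducible; ¬prime[1])
open import Data.Product.Base using (∃; _,_; proj₁; proj₂)
open import Data.Sum.Base using (_⊎_; inj₁; inj₂)
open import Level using (0ℓ)
import Relation.Binary.Reasoning.Setoid as SetoidReasoning
open import Relation.Binary.Definitions using (Decidable)
import Relation.Binary.PropositionalEquality.Core as ≡
open ≡ using (_≡_)
open import Relation.Nullary.Decidable.Core using (Dec; yes; no; map′)
open import Relation.Nullary.Negation.Core using (¬_)

CRing : Set₁
CRing = CommutativeRing 0ℓ 0ℓ

record DiscreteDomain : Set₁ where
  field
    commutativeRing : CRing
  open CommutativeRing commutativeRing public
  field
    _≟_             : Decidable _≈_
    1≉0             : ¬ (1# ≈ 0#)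
    noZeroDivisors  : ∀ x y → x * y ≈ 0# → x ≈ 0# ⊎ y ≈ 0#

record DiscreteField : Set₁ where
  field
    commutativeRing : CRing
  open CommutativeRing commutativeRing public
  field
    _≟_             : Decidable _≈_
    1≉0             : ¬ (1# ≈ 0#)
    invertible      : ∀ x → ¬ (x ≈ 0#) → ∃ λ y → x * y ≈ 1#

  infix 9 _⁻¹

  -- Totalised by 0 ⁻¹ = 0.
  _⁻¹ : Carrier → Carrier
  x ⁻¹ with x ≟ 0#
  ... | yes _   = 0#
  ... | no  x≉0 = proj₁ (invertible x x≉0)

  ⁻¹-inverseʳ : ∀ x → ¬ (x ≈ 0#) → x * x ⁻¹ ≈ 1#
  ⁻¹-inverseʳ x x≉0 with x ≟ 0#
  ... | yes x≈0  = ⊥-elim (x≉0 x≈0)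
  ... | no  x≉0′ = proj₂ (invertible x x≉0′)

  private
    open SetoidReasoning setoid

    *≈0⇒≈0 : ∀ x y → ¬ (x ≈ 0#) → x * y ≈ 0# → y ≈ 0#
    *≈0⇒≈0 x y x≉0 xy≈0 = begin
      y                 ≈⟨ *-identityˡ y ⟨
      1# * y            ≈⟨ *-congʳ (⁻¹-inverseʳ x x≉0) ⟨
      (x * x ⁻¹) * y    ≈⟨ *-congʳ (*-comm x (x ⁻¹)) ⟩
      (x ⁻¹ * x) * y    ≈⟨ *-assoc (x ⁻¹) x y ⟩
      x ⁻¹ * (x * y)    ≈⟨ *-congˡ xy≈0 ⟩
      x ⁻¹ * 0#         ≈⟨ zeroʳ (x ⁻¹) ⟩
      0#                ∎

  discreteDomain : DiscreteDomain
  discreteDomain = record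
    { commutativeRing = commutativeRing
    ; _≟_             = _≟_
    ; 1≉0             = 1≉0
    ; noZeroDivisors  = λ x y xy≈0 → split x y xy≈0 (x ≟ 0#)
    }
    where
    split : ∀ x y → x * y ≈ 0# → Dec (x ≈ 0#) → x ≈ 0# ⊎ y ≈ 0#
    split x y xy≈0 (yes x≈0) = inj₁ x≈0
    split x y xy≈0 (no x≉0)  = inj₂ (*≈0⇒≈0 x y x≉0 xy≈0)

module RingNotation (R : CRing) where
  open CommutativeRing R public
  open SemiringExp semiring public using (_^_)
  open SemiringDivisibility semiring public using (_∣_)

  ⌜_⌝ : ℕ → Carrier
  ⌜ n ⌝ = n × 1#
    where open SemiringMult semiring using (_×_)

  -- Half-open ranges m ≤ k < n.
  ∑ : ℕ → ℕ → (ℕ → Carrier) → Carrier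
  ∑ m n f = SemiringSum.sum semiring {n ∸ m} λ i → f (m ℕ.+ toℕ i)

  ∏ : ℕ → ℕ → (ℕ → Carrier) → Carrier
  ∏ m n f = MonoidSum.sum *-commutativeMonoid {n ∸ m} λ i → f (m ℕ.+ toℕ i)

  infix 6 ∑ ∏
  syntax ∑ m n (λ k → e) = ∑[ m ≤ k < n ] e
  syntax ∏ m n (λ k → e) = ∏[ m ≤ k < n ] e

  infix 4 _≡_[mod_]
  _≡_[mod_] : Carrier → Carrier → Carrier → Set
  f ≡ g [mod m ] = m ∣ f - g

-- Polynomials as coefficient lists, constant term first.  Trailing zeros
-- are allowed, so equality compares coefficients.
module PolynomialBase (R : CRing) where
  open CommutativeRing R
  open RingProperties ring using (-0#≈0#)
  private module R = SetoidReasoning setoid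
  private module Solver = NatSolver commutativeSemiring

  Poly : Set
  Poly = List Carrier

  coeff : Poly → ℕ → Carrier
  coeff []      n       = 0#
  coeff (a ∷ f) zero    = a
  coeff (a ∷ f) (suc n) = coeff f n

  infix  4 _≈ᴾ_
  infixl 6 _+ᴾ_
  infixl 7 _*ᴾ_ _·_

  record _≈ᴾ_ (f g : Poly) : Set where
    constructor coeffwise
    field coeff≈ : ∀ n → coeff f n ≈ coeff g n
  open _≈ᴾ_ public

  _+ᴾ_ : Poly → Poly → Poly
  []      +ᴾ g       = g
  (a ∷ f) +ᴾ []      = a ∷ f
  (a ∷ f) +ᴾ (b ∷ g) = (a + b) ∷ (f +ᴾ g)

  -ᴾ_ : Poly → Poly
  -ᴾ_ = map (-_)

  _·_ : Carrier → Poly → Poly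
  a · f = map (a *_) f

  _*ᴾ_ : Poly → Poly → Poly
  []      *ᴾ g = []
  (a ∷ f) *ᴾ g = a · g +ᴾ (0# ∷ (f *ᴾ g))

  C : Carrier → Poly
  C a = a ∷ []

  X : Poly
  X = 0# ∷ 1# ∷ []

  0ᴾ 1ᴾ : Poly
  0ᴾ = []
  1ᴾ = C 1#

  private
    ≈ᴾ-refl : ∀ {f} → f ≈ᴾ f
    ≈ᴾ-refl = coeffwise λ n → refl

    ≈ᴾ-sym : ∀ {f g} → f ≈ᴾ g → g ≈ᴾ f
    ≈ᴾ-sym p = coeffwise λ n → sym (coeff≈ p n)

    ≈ᴾ-trans : ∀ {f g h} → f ≈ᴾ g → g ≈ᴾ h → f ≈ᴾ h
    ≈ᴾ-trans p q = coeffwise λ n → trans (coeff≈ p n) (coeff≈ q n)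

  ∷-cong : ∀ {a b f g} → a ≈ b → f ≈ᴾ g → a ∷ f ≈ᴾ b ∷ g
  ∷-cong a≈b f≈g = coeffwise λ where
    zero    → a≈b
    (suc n) → coeff≈ f≈g n

  coeff-+ : ∀ f g n → coeff (f +ᴾ g) n ≈ coeff f n + coeff g n
  coeff-+ []      g       n       = sym (+-identityˡ _)
  coeff-+ (a ∷ f) []      n       = sym (+-identityʳ _)
  coeff-+ (a ∷ f) (b ∷ g) zero    = refl
  coeff-+ (a ∷ f) (b ∷ g) (suc n) = coeff-+ f g n

  coeff-neg : ∀ f n → coeff (-ᴾ f) n ≈ - coeff f n
  coeff-neg []      n       = sym -0#≈0#
  coeff-neg (a ∷ f) zero    = refl
  coeff-neg (a ∷ f) (suc n) = coeff-neg f n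

  coeff-· : ∀ a f n → coeff (a · f) n ≈ a * coeff f n
  coeff-· a []      n       = sym (zeroʳ a)
  coeff-· a (b ∷ f) zero    = refl
  coeff-· a (b ∷ f) (suc n) = coeff-· a f n

  private
    +-cong′ : ∀ {f f′ g g′} → f ≈ᴾ f′ → g ≈ᴾ g′ → f +ᴾ g ≈ᴾ f′ +ᴾ g′
    +-cong′ {f} {f′} {g} {g′} p q = coeffwise λ n →
      trans (coeff-+ f g n)
        (trans (+-cong (coeff≈ p n) (coeff≈ q n)) (sym (coeff-+ f′ g′ n)))

    +-assoc′ : ∀ f g h → (f +ᴾ g) +ᴾ h ≈ᴾ f +ᴾ (g +ᴾ h)
    +-assoc′ f g h = coeffwise λ n → R.begin
      coeff ((f +ᴾ g) +ᴾ h) n                R.≈⟨ coeff-+ (f +ᴾ g) h n ⟩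
      coeff (f +ᴾ g) n + coeff h n           R.≈⟨ +-congʳ (coeff-+ f g n) ⟩
      (coeff f n + coeff g n) + coeff h n    R.≈⟨ +-assoc _ _ _ ⟩
      coeff f n + (coeff g n + coeff h n)    R.≈⟨ +-congˡ (coeff-+ g h n) ⟨
      coeff f n + coeff (g +ᴾ h) n           R.≈⟨ coeff-+ f (g +ᴾ h) n ⟨
      coeff (f +ᴾ (g +ᴾ h)) n                R.∎

    +-comm′ : ∀ f g → f +ᴾ g ≈ᴾ g +ᴾ f
    +-comm′ f g = coeffwise λ n →
      trans (coeff-+ f g n) (trans (+-comm _ _) (sym (coeff-+ g f n)))

    +-identityʳ′ : ∀ f → f +ᴾ [] ≈ᴾ f
    +-identityʳ′ f = +-comm′ f []

    neg-cong′ : ∀ {f g} → f ≈ᴾ g → -ᴾ f ≈ᴾ -ᴾ g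
    neg-cong′ {f} {g} p = coeffwise λ n →
      trans (coeff-neg f n) (trans (-‿cong (coeff≈ p n)) (sym (coeff-neg g n)))

    neg-inverseˡ : ∀ f → (-ᴾ f) +ᴾ f ≈ᴾ []
    neg-inverseˡ f = coeffwise λ n →
      trans (coeff-+ (-ᴾ f) f n)
        (trans (+-congʳ (coeff-neg f n)) (-‿inverseˡ _))

    +-interchange : ∀ f g h k → (f +ᴾ g) +ᴾ (h +ᴾ k) ≈ᴾ (f +ᴾ h) +ᴾ (g +ᴾ k)
    +-interchange f g h k = coeffwise λ n → R.begin
      coeff ((f +ᴾ g) +ᴾ (h +ᴾ k)) n                         R.≈⟨ four f g h k n ⟩
      (coeff f n + coeff g n) + (coeff h n + coeff k n)      R.≈⟨ swap _ _ _ _ ⟩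
      (coeff f n + coeff h n) + (coeff g n + coeff k n)      R.≈⟨ four f h g k n ⟨
      coeff ((f +ᴾ h) +ᴾ (g +ᴾ k)) n                         R.∎
      where
      four : ∀ f g h k n → coeff ((f +ᴾ g) +ᴾ (h +ᴾ k)) n ≈
             (coeff f n + coeff g n) + (coeff h n + coeff k n)
      four f g h k n = trans (coeff-+ (f +ᴾ g) (h +ᴾ k) n)
                             (+-cong (coeff-+ f g n) (coeff-+ h k n))
      swap : ∀ a b c d → (a + b) + (c + d) ≈ (a + c) + (b + d)
      swap = Solver.solve 4 (λ a b c d → (a Solver.:+ b) Solver.:+ (c Solver.:+ d)
                              Solver.:= (a Solver.:+ c) Solver.:+ (b Solver.:+ d)) refl

    ·-cong : ∀ {a b f g} → a ≈ b → f ≈ᴾ g → a · f ≈ᴾ b · g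
    ·-cong {a} {b} {f} {g} a≈b p = coeffwise λ n →
      trans (coeff-· a f n) (trans (*-cong a≈b (coeff≈ p n)) (sym (coeff-· b g n)))

    ·-zeroˡ : ∀ f → 0# · f ≈ᴾ []
    ·-zeroˡ f = coeffwise λ n → trans (coeff-· 0# f n) (zeroˡ _)

    ·-identityˡ : ∀ f → 1# · f ≈ᴾ f
    ·-identityˡ f = coeffwise λ n → trans (coeff-· 1# f n) (*-identityˡ _)

    ·-assoc : ∀ a b f → (a * b) · f ≈ᴾ a · (b · f)
    ·-assoc a b f = coeffwise λ n → R.begin
      coeff ((a * b) · f) n      R.≈⟨ coeff-· (a * b) f n ⟩
      (a * b) * coeff f n        R.≈⟨ *-assoc _ _ _ ⟩
      a * (b * coeff f n)        R.≈⟨ *-congˡ (coeff-· b f n) ⟨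
      a * coeff (b · f) n        R.≈⟨ coeff-· a (b · f) n ⟨
      coeff (a · (b · f)) n      R.∎

    ·-distribˡ : ∀ a f g → a · (f +ᴾ g) ≈ᴾ a · f +ᴾ a · g
    ·-distribˡ a f g = coeffwise λ n → R.begin
      coeff (a · (f +ᴾ g)) n                  R.≈⟨ coeff-· a (f +ᴾ g) n ⟩
      a * coeff (f +ᴾ g) n                    R.≈⟨ *-congˡ (coeff-+ f g n) ⟩
      a * (coeff f n + coeff g n)             R.≈⟨ distribˡ _ _ _ ⟩
      a * coeff f n + a * coeff g n           R.≈⟨ +-cong (coeff-· a f n) (coeff-· a g n) ⟨
      coeff (a · f) n + coeff (a · g) n       R.≈⟨ coeff-+ (a · f) (a · g) n ⟨
      coeff (a · f +ᴾ a · g) n                R.∎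

    ·-distribʳ : ∀ a b f → (a + b) · f ≈ᴾ a · f +ᴾ b · f
    ·-distribʳ a b f = coeffwise λ n → R.begin
      coeff ((a + b) · f) n                   R.≈⟨ coeff-· (a + b) f n ⟩
      (a + b) * coeff f n                     R.≈⟨ distribʳ _ _ _ ⟩
      a * coeff f n + b * coeff f n           R.≈⟨ +-cong (coeff-· a f n) (coeff-· b f n) ⟨
      coeff (a · f) n + coeff (b · f) n       R.≈⟨ coeff-+ (a · f) (b · f) n ⟨
      coeff (a · f +ᴾ b · f) n                R.∎

    0∷-+ : ∀ f g → 0# ∷ (f +ᴾ g) ≈ᴾ (0# ∷ f) +ᴾ (0# ∷ g)
    0∷-+ f g = ∷-cong (sym (+-identityˡ 0#)) ≈ᴾ-refl

    ·-0∷ : ∀ a f → a · (0# ∷ f) ≈ᴾ 0# ∷ (a · f)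
    ·-0∷ a f = ∷-cong (zeroʳ a) ≈ᴾ-refl

    0∷[] : 0# ∷ [] ≈ᴾ []
    0∷[] = coeffwise λ where
      zero    → refl
      (suc n) → refl

    *-congʳ′ : ∀ f {g h} → g ≈ᴾ h → f *ᴾ g ≈ᴾ f *ᴾ h
    *-congʳ′ []      p = ≈ᴾ-refl
    *-congʳ′ (a ∷ f) p = +-cong′ (·-cong refl p) (∷-cong refl (*-congʳ′ f p))

    *-zeroʳ′ : ∀ f → f *ᴾ [] ≈ᴾ []
    *-zeroʳ′ []      = ≈ᴾ-refl
    *-zeroʳ′ (a ∷ f) = ≈ᴾ-trans (∷-cong refl (*-zeroʳ′ f)) 0∷[]

    *-distribʳ′ : ∀ h f g → (f +ᴾ g) *ᴾ h ≈ᴾ f *ᴾ h +ᴾ g *ᴾ h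
    *-distribʳ′ h []      g       = ≈ᴾ-refl
    *-distribʳ′ h (a ∷ f) []      = ≈ᴾ-sym (+-identityʳ′ _)
    *-distribʳ′ h (a ∷ f) (b ∷ g) =
      ≈ᴾ-trans
        (+-cong′ (·-distribʳ a b h)
          (≈ᴾ-trans (∷-cong refl (*-distribʳ′ h f g)) (0∷-+ (f *ᴾ h) (g *ᴾ h))))
        (+-interchange (a · h) (b · h) (0# ∷ (f *ᴾ h)) (0# ∷ (g *ᴾ h)))

    *-∷ʳ : ∀ g a f → g *ᴾ (a ∷ f) ≈ᴾ a · g +ᴾ (0# ∷ (g *ᴾ f))
    *-∷ʳ []      a f = ≈ᴾ-sym 0∷[]
    *-∷ʳ (b ∷ g) a f =
      ∷-cong (+-congʳ (*-comm b a))
        (≈ᴾ-trans (+-cong′ {b · f} ≈ᴾ-refl (*-∷ʳ g a f))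
          (≈ᴾ-trans (≈ᴾ-sym (+-assoc′ (b · f) (a · g) (0# ∷ (g *ᴾ f))))
            (≈ᴾ-trans (+-cong′ {b · f +ᴾ a · g} (+-comm′ (b · f) (a · g)) ≈ᴾ-refl)
              (+-assoc′ (a · g) (b · f) (0# ∷ (g *ᴾ f))))))

    *-comm′ : ∀ f g → f *ᴾ g ≈ᴾ g *ᴾ f
    *-comm′ []      g = ≈ᴾ-sym (*-zeroʳ′ g)
    *-comm′ (a ∷ f) g =
      ≈ᴾ-trans (+-cong′ {a · g} ≈ᴾ-refl (∷-cong refl (*-comm′ f g)))
               (≈ᴾ-sym (*-∷ʳ g a f))

    *-cong′ : ∀ {f f′ g g′} → f ≈ᴾ f′ → g ≈ᴾ g′ → f *ᴾ g ≈ᴾ f′ *ᴾ g′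
    *-cong′ {f} {f′} {g} {g′} p q =
      ≈ᴾ-trans (*-congʳ′ f q)
        (≈ᴾ-trans (*-comm′ f g′)
          (≈ᴾ-trans (*-congʳ′ g′ p) (*-comm′ g′ f′)))

    *-distribˡ′ : ∀ f g h → f *ᴾ (g +ᴾ h) ≈ᴾ f *ᴾ g +ᴾ f *ᴾ h
    *-distribˡ′ f g h =
      ≈ᴾ-trans (*-comm′ f (g +ᴾ h))
        (≈ᴾ-trans (*-distribʳ′ f g h) (+-cong′ (*-comm′ g f) (*-comm′ h f)))

    ·-*-assoc : ∀ a f g → (a · f) *ᴾ g ≈ᴾ a · (f *ᴾ g)
    ·-*-assoc a []      g = ≈ᴾ-refl
    ·-*-assoc a (b ∷ f) g = ≈ᴾ-sym
      (≈ᴾ-trans (·-distribˡ a (b · g) (0# ∷ (f *ᴾ g)))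
        (+-cong′ (≈ᴾ-sym (·-assoc a b g))
          (≈ᴾ-trans (·-0∷ a (f *ᴾ g)) (∷-cong refl (≈ᴾ-sym (·-*-assoc a f g))))))

    0∷-* : ∀ f g → (0# ∷ f) *ᴾ g ≈ᴾ 0# ∷ (f *ᴾ g)
    0∷-* f g = +-cong′ {0# · g} (·-zeroˡ g) ≈ᴾ-refl

    *-assoc′ : ∀ f g h → (f *ᴾ g) *ᴾ h ≈ᴾ f *ᴾ (g *ᴾ h)
    *-assoc′ []      g h = ≈ᴾ-refl
    *-assoc′ (a ∷ f) g h =
      ≈ᴾ-trans (*-distribʳ′ h (a · g) (0# ∷ (f *ᴾ g)))
        (+-cong′ (·-*-assoc a g h)
          (≈ᴾ-trans (0∷-* (f *ᴾ g) h) (∷-cong refl (*-assoc′ f g h))))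

    *-identityˡ′ : ∀ f → 1ᴾ *ᴾ f ≈ᴾ f
    *-identityˡ′ f =
      ≈ᴾ-trans (+-cong′ (·-identityˡ f) 0∷[]) (+-identityʳ′ f)

    isCommutativeRing′ : IsCommutativeRing _≈ᴾ_ _+ᴾ_ _*ᴾ_ -ᴾ_ 0ᴾ 1ᴾ
    isCommutativeRing′ = record
      { isRing = record
        { +-isAbelianGroup = record
          { isGroup = record
            { isMonoid = record
              { isSemigroup = record
                { isMagma = record
                  { isEquivalence = record
                    { refl = ≈ᴾ-refl ; sym = ≈ᴾ-sym ; trans = ≈ᴾ-trans }
                  ; ∙-cong = +-cong′
                  }
                ; assoc = +-assoc′
                }
              ; identity = (λ f → ≈ᴾ-refl) , +-identityʳ′
              }
            ; inverse = neg-inverseˡ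
                      , λ f → ≈ᴾ-trans (+-comm′ f (-ᴾ f)) (neg-inverseˡ f)
            ; ⁻¹-cong = neg-cong′
            }
          ; comm = +-comm′
          }
        ; *-cong = *-cong′
        ; *-assoc = *-assoc′
        ; *-identity = *-identityˡ′
                     , λ f → ≈ᴾ-trans (*-comm′ f 1ᴾ) (*-identityˡ′ f)
        ; distrib = *-distribˡ′ , *-distribʳ′
        }
      ; *-comm = *-comm′
      }

  polynomialRing : CRing
  polynomialRing = record { isCommutativeRing = isCommutativeRing′ }

_[X] : CRing → CRing
R [X] = PolynomialBase.polynomialRing R

-- The value of f at x ∈ S, its coefficients being sent to S by φ.
module _ (R S : CRing) where
  private
    module R = CommutativeRing R
    module S = CommutativeRing S
    module R[X] = CommutativeRing (R [X])

  eval : (R.Carrier → S.Carrier) → S.Carrier → R[X].Carrier → S.Carrier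
  eval φ x []      = S.0#
  eval φ x (a ∷ f) = φ a S.+ x S.* eval φ x f

module PolynomialDomain (D : DiscreteDomain) where
  open DiscreteDomain D
  open PolynomialBase commutativeRing
  private
    module P = CommutativeRing polynomialRing
    module PP = GroupProperties P.+-group using (x∙y⁻¹≈ε⇒x≈y; x≈y⇒x∙y⁻¹≈ε)

    zero? : ∀ f → Dec (f ≈ᴾ [])
    zero? []      = yes P.refl
    zero? (a ∷ f) with a ≟ 0# | zero? f
    ... | yes a≈0 | yes f≈0 = yes (coeffwise λ where
                                     zero    → a≈0
                                     (suc n) → coeff≈ f≈0 n)
    ... | no  a≉0 | _       = no λ p → a≉0 (coeff≈ p 0)
    ... | yes _   | no f≉0  = no λ p → f≉0 (coeffwise λ n → coeff≈ p (suc n))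

    _≟ᴾ_ : Decidable _≈ᴾ_
    f ≟ᴾ g = map′ (PP.x∙y⁻¹≈ε⇒x≈y f g) PP.x≈y⇒x∙y⁻¹≈ε (zero? (f P.- g))

    tail≈0 : ∀ {a f} → a ∷ f ≈ᴾ [] → f ≈ᴾ []
    tail≈0 p = coeffwise λ n → coeff≈ p (suc n)

    ∷≈0 : ∀ {a f} → a ≈ 0# → f ≈ᴾ [] → a ∷ f ≈ᴾ []
    ∷≈0 a≈0 f≈0 = coeffwise λ where
      zero    → a≈0
      (suc n) → coeff≈ f≈0 n

    0∷-*ˡ : ∀ {a} f g → a ≈ 0# → (a ∷ f) *ᴾ g ≈ᴾ 0# ∷ (f *ᴾ g)
    0∷-*ˡ {a} f g a≈0 = coeffwise λ n →
      trans (coeff-+ (a · g) (0# ∷ (f *ᴾ g)) n)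
        (trans (+-congʳ (trans (coeff-· a g n)
                           (trans (*-congʳ a≈0) (zeroˡ _))))
               (+-identityˡ _))

    leading : ∀ a f g → ¬ (a ≈ 0#) → (a ∷ f) *ᴾ g ≈ᴾ [] → g ≈ᴾ []
    leading a f []      a≉0 p = P.refl
    leading a f (b ∷ g) a≉0 p
      with noZeroDivisors a b (trans (sym (+-identityʳ _)) (coeff≈ p 0))
    ... | inj₁ a≈0 = ⊥-elim (a≉0 a≈0)
    ... | inj₂ b≈0 = ∷≈0 b≈0 (leading a f g a≉0 (tail≈0
      (P.trans (P.sym (0∷-*ˡ g (a ∷ f) b≈0 ⟨trans⟩ ∷-cong refl (P.*-comm g (a ∷ f))))
        (P.trans (P.*-comm (b ∷ g) (a ∷ f)) p))))
      where _⟨trans⟩_ = P.trans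

    domain : ∀ f g → f *ᴾ g ≈ᴾ [] → f ≈ᴾ [] ⊎ g ≈ᴾ []
    domain []      g p = inj₁ P.refl
    domain (a ∷ f) g p with a ≟ 0#
    ... | no a≉0  = inj₂ (leading a f g a≉0 p)
    ... | yes a≈0 with domain f g (tail≈0 (P.trans (P.sym (0∷-*ˡ f g a≈0)) p))
    ...   | inj₁ f≈0 = inj₁ (∷≈0 a≈0 f≈0)
    ...   | inj₂ g≈0 = inj₂ g≈0

  polynomialDomain : DiscreteDomain
  polynomialDomain = record
    { commutativeRing = polynomialRing
    ; _≟_             = _≟ᴾ_
    ; 1≉0             = λ p → 1≉0 (coeff≈ p 0)
    ; noZeroDivisors  = domain
    }

module Fractions (D : DiscreteDomain) where
  open DiscreteDomain D
  open RingProperties ring using (-‿distribˡ-*; -‿distribʳ-*)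
  open GroupProperties +-group using (x∙y⁻¹≈ε⇒x≈y; x≈y⇒x∙y⁻¹≈ε)
  private
    module Solver = NatSolver commutativeSemiring
    open Solver using (solve; _:+_; _:*_; _:=_)
    open SetoidReasoning setoid

  record Fraction : Set where
    constructor fraction
    field
      num   : Carrier
      den   : Carrier
      den≉0 : ¬ (den ≈ 0#)
  open Fraction public

  infix  4 _≈ꟳ_
  infixl 6 _+ꟳ_
  infixl 7 _*ꟳ_

  record _≈ꟳ_ (x y : Fraction) : Set where
    constructor cross
    field cross≈ : num x * den y ≈ num y * den x
  open _≈ꟳ_ public

  private
    *-≉0 : ∀ {x y} → ¬ (x ≈ 0#) → ¬ (y ≈ 0#) → ¬ (x * y ≈ 0#)
    *-≉0 {x} {y} x≉0 y≉0 xy≈0 with noZeroDivisors x y xy≈0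
    ... | inj₁ x≈0 = x≉0 x≈0
    ... | inj₂ y≈0 = y≉0 y≈0

    cancel : ∀ c {x y} → ¬ (c ≈ 0#) → c * x ≈ c * y → x ≈ y
    cancel c {x} {y} c≉0 p with noZeroDivisors c (x - y) (begin
        c * (x - y)        ≈⟨ distribˡ c x (- y) ⟩
        c * x + c * - y    ≈⟨ +-congˡ (-‿distribʳ-* c y) ⟨
        c * x - c * y      ≈⟨ x≈y⇒x∙y⁻¹≈ε p ⟩
        0#                 ∎)
    ... | inj₁ c≈0   = ⊥-elim (c≉0 c≈0)
    ... | inj₂ x-y≈0 = x∙y⁻¹≈ε⇒x≈y x y x-y≈0

  _+ꟳ_ _*ꟳ_ : Fraction → Fraction → Fraction
  fraction a b b≉0 +ꟳ fraction c d d≉0 = fraction (a * d + c * b) (b * d) (*-≉0 b≉0 d≉0)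
  fraction a b b≉0 *ꟳ fraction c d d≉0 = fraction (a * c) (b * d) (*-≉0 b≉0 d≉0)

  -ꟳ_ : Fraction → Fraction
  -ꟳ fraction a b b≉0 = fraction (- a) b b≉0

  ι : Carrier → Fraction
  ι a = fraction a 1# 1≉0

  0ꟳ 1ꟳ : Fraction
  0ꟳ = ι 0#
  1ꟳ = ι 1#

  private
    ≈-trans : ∀ {x y z} → x ≈ꟳ y → y ≈ꟳ z → x ≈ꟳ z
    ≈-trans {fraction a b _} {fraction c d d≉0} {fraction e f _} (cross p) (cross q) =
      cross (cancel d d≉0 (begin
        d * (a * f)    ≈⟨ solve 3 (λ a d f → d :* (a :* f) := (a :* d) :* f) refl a d f ⟩
        (a * d) * f    ≈⟨ *-congʳ p ⟩
        (c * b) * f    ≈⟨ solve 3 (λ b c f → (c :* b) :* f := (c :* f) :* b) refl b c f ⟩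
        (c * f) * b    ≈⟨ *-congʳ q ⟩
        (e * d) * b    ≈⟨ solve 3 (λ b d e → (e :* d) :* b := d :* (e :* b)) refl b d e ⟩
        d * (e * b)    ∎))

    +-cong′ : ∀ {x x′ y y′} → x ≈ꟳ x′ → y ≈ꟳ y′ → x +ꟳ y ≈ꟳ x′ +ꟳ y′
    +-cong′ {fraction a b _} {fraction a′ b′ _} {fraction c d _} {fraction c′ d′ _}
      (cross p) (cross q) = cross (begin
        (a * d + c * b) * (b′ * d′)
          ≈⟨ solve 6 (λ a b c d b′ d′ → (a :* d :+ c :* b) :* (b′ :* d′)
               := (a :* b′) :* (d :* d′) :+ (c :* d′) :* (b :* b′)) refl a b c d b′ d′ ⟩
        (a * b′) * (d * d′) + (c * d′) * (b * b′)
          ≈⟨ +-cong (*-congʳ p) (*-congʳ q) ⟩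
        (a′ * b) * (d * d′) + (c′ * d) * (b * b′)
          ≈⟨ solve 6 (λ a′ b c′ d b′ d′ → (a′ :* b) :* (d :* d′) :+ (c′ :* d) :* (b :* b′)
               := (a′ :* d′ :+ c′ :* b′) :* (b :* d)) refl a′ b c′ d b′ d′ ⟩
        (a′ * d′ + c′ * b′) * (b * d) ∎)

    *-cong′ : ∀ {x x′ y y′} → x ≈ꟳ x′ → y ≈ꟳ y′ → x *ꟳ y ≈ꟳ x′ *ꟳ y′
    *-cong′ {fraction a b _} {fraction a′ b′ _} {fraction c d _} {fraction c′ d′ _}
      (cross p) (cross q) = cross (begin
        (a * c) * (b′ * d′)    ≈⟨ solve 4 (λ a c b′ d′ → (a :* c) :* (b′ :* d′)
                                    := (a :* b′) :* (c :* d′)) refl a c b′ d′ ⟩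
        (a * b′) * (c * d′)    ≈⟨ *-cong p q ⟩
        (a′ * b) * (c′ * d)    ≈⟨ solve 4 (λ a′ b c′ d → (a′ :* b) :* (c′ :* d)
                                    := (a′ :* c′) :* (b :* d)) refl a′ b c′ d ⟩
        (a′ * c′) * (b * d)    ∎)

    neg-cong′ : ∀ {x y} → x ≈ꟳ y → -ꟳ x ≈ꟳ -ꟳ y
    neg-cong′ {fraction a b _} {fraction c d _} (cross p) = cross (begin
      - a * d      ≈⟨ -‿distribˡ-* a d ⟨
      - (a * d)    ≈⟨ -‿cong p ⟩
      - (c * b)    ≈⟨ -‿distribˡ-* c b ⟩
      - c * b      ∎)

    +-assoc′ : ∀ x y z → (x +ꟳ y) +ꟳ z ≈ꟳ x +ꟳ (y +ꟳ z)
    +-assoc′ (fraction a b _) (fraction c d _) (fraction e f _) = cross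
      (solve 6 (λ a b c d e f →
        ((a :* d :+ c :* b) :* f :+ e :* (b :* d)) :* (b :* (d :* f))
        := (a :* (d :* f) :+ (c :* f :+ e :* d) :* b) :* ((b :* d) :* f))
        refl a b c d e f)

    +-comm′ : ∀ x y → x +ꟳ y ≈ꟳ y +ꟳ x
    +-comm′ (fraction a b _) (fraction c d _) = cross
      (solve 4 (λ a b c d → (a :* d :+ c :* b) :* (d :* b)
        := (c :* b :+ a :* d) :* (b :* d)) refl a b c d)

    +-identityˡ′ : ∀ x → 0ꟳ +ꟳ x ≈ꟳ x
    +-identityˡ′ (fraction a b _) = cross (begin
      (0# * b + a * 1#) * b  ≈⟨ *-congʳ (trans (+-cong (zeroˡ b) (*-identityʳ a)) (+-identityˡ a)) ⟩
      a * b                  ≈⟨ *-congˡ (*-identityˡ b) ⟨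
      a * (1# * b)           ∎)

    neg-inverseˡ : ∀ x → (-ꟳ x) +ꟳ x ≈ꟳ 0ꟳ
    neg-inverseˡ (fraction a b _) = cross (begin
      (- a * b + a * b) * 1#    ≈⟨ *-identityʳ _ ⟩
      - a * b + a * b           ≈⟨ distribʳ b (- a) a ⟨
      (- a + a) * b             ≈⟨ *-congʳ (-‿inverseˡ a) ⟩
      0# * b                    ≈⟨ zeroˡ b ⟩
      0#                        ≈⟨ zeroˡ _ ⟨
      0# * (b * b)              ∎)

    *-assoc′ : ∀ x y z → (x *ꟳ y) *ꟳ z ≈ꟳ x *ꟳ (y *ꟳ z)
    *-assoc′ (fraction a b _) (fraction c d _) (fraction e f _) = cross
      (*-cong (*-assoc a c e) (sym (*-assoc b d f)))

    *-comm′ : ∀ x y → x *ꟳ y ≈ꟳ y *ꟳ x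
    *-comm′ (fraction a b _) (fraction c d _) = cross
      (*-cong (*-comm a c) (*-comm d b))

    *-identityˡ′ : ∀ x → 1ꟳ *ꟳ x ≈ꟳ x
    *-identityˡ′ (fraction a b _) = cross
      (*-cong (*-identityˡ a) (sym (*-identityˡ b)))

    *-distribʳ′ : ∀ x y z → (y +ꟳ z) *ꟳ x ≈ꟳ y *ꟳ x +ꟳ z *ꟳ x
    *-distribʳ′ (fraction a b _) (fraction c d _) (fraction e f _) = cross
      (solve 6 (λ a b c d e f →
        ((c :* f :+ e :* d) :* a) :* ((d :* b) :* (f :* b))
        := ((c :* a) :* (f :* b) :+ (e :* a) :* (d :* b)) :* ((d :* f) :* b))
        refl a b c d e f)

    *-distribˡ′ : ∀ x y z → x *ꟳ (y +ꟳ z) ≈ꟳ x *ꟳ y +ꟳ x *ꟳ z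
    *-distribˡ′ x y z = ≈-trans (*-comm′ x (y +ꟳ z))
      (≈-trans (*-distribʳ′ x y z) (+-cong′ (*-comm′ y x) (*-comm′ z x)))

    isCommutativeRing′ : IsCommutativeRing _≈ꟳ_ _+ꟳ_ _*ꟳ_ -ꟳ_ 0ꟳ 1ꟳ
    isCommutativeRing′ = record
      { isRing = record
        { +-isAbelianGroup = record
          { isGroup = record
            { isMonoid = record
              { isSemigroup = record
                { isMagma = record
                  { isEquivalence = record
                    { refl  = cross refl
                    ; sym   = λ p → cross (sym (cross≈ p))
                    ; trans = ≈-trans
                    }
                  ; ∙-cong = +-cong′
                  }
                ; assoc = +-assoc′
                }
              ; identity = +-identityˡ′
                         , λ x → ≈-trans (+-comm′ x 0ꟳ) (+-identityˡ′ x)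
              }
            ; inverse = neg-inverseˡ
                      , λ x → ≈-trans (+-comm′ x (-ꟳ x)) (neg-inverseˡ x)
            ; ⁻¹-cong = neg-cong′
            }
          ; comm = +-comm′
          }
        ; *-cong = *-cong′
        ; *-assoc = *-assoc′
        ; *-identity = *-identityˡ′
                     , λ x → ≈-trans (*-comm′ x 1ꟳ) (*-identityˡ′ x)
        ; distrib = *-distribˡ′ , *-distribʳ′
        }
      ; *-comm = *-comm′
      }

    num≉0 : ∀ x → ¬ (x ≈ꟳ 0ꟳ) → ¬ (num x ≈ 0#)
    num≉0 x x≉0 a≈0 = x≉0 (cross
      (trans (trans (*-congʳ a≈0) (zeroˡ 1#)) (sym (zeroˡ (den x)))))

  fractionField : DiscreteField
  fractionField = record
    { commutativeRing = record { isCommutativeRing = isCommutativeRing′ }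
    ; _≟_             = λ x y → map′ cross cross≈ ((num x * den y) ≟ (num y * den x))
    ; 1≉0             = λ p → 1≉0 (trans (sym (*-identityʳ 1#))
                                   (trans (cross≈ p) (zeroˡ 1#)))
    ; invertible      = λ x x≉0 → fraction (den x) (num x) (num≉0 x x≉0)
                                , cross (trans (*-identityʳ _)
                                    (trans (*-comm _ _) (sym (*-identityˡ _))))
    }

-- ℤ / p, the integers with congruence mod p as equality.
module PrimeField (p : ℕ) (p-prime : Prime p) where
  infix 4 _≈ₚ_

  record _≈ₚ_ (x y : ℤ) : Set where
    constructor congruent
    field divides- : + p ℤ∣.∣ x ℤ.- y
  open _≈ₚ_ public

  private
    via : ∀ {x y} → x ≡ y → + p ℤ∣.∣ x → + p ℤ∣.∣ y
    via ≡.refl d = d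

    reflexive : ∀ {x y} → x ≡ y → x ≈ₚ y
    reflexive {x} ≡.refl = congruent (via (≡.sym (ℤₚ.+-inverseʳ x)) (ℤ∣.divides (+ 0) ≡.refl))

    negate : ∀ x y → ℤ.- (x ℤ.- y) ≡ y ℤ.- x
    negate = ℤSolver.solve-∀

    telescope : ∀ x y z → (x ℤ.- y) ℤ.+ (y ℤ.- z) ≡ x ℤ.- z
    telescope = ℤSolver.solve-∀

    sums : ∀ x y u v → (x ℤ.- y) ℤ.+ (u ℤ.- v) ≡ (x ℤ.+ u) ℤ.- (y ℤ.+ v)
    sums = ℤSolver.solve-∀

    products : ∀ x y u v →
      (x ℤ.- y) ℤ.* u ℤ.+ y ℤ.* (u ℤ.- v) ≡ (x ℤ.* u) ℤ.- (y ℤ.* v)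
    products = ℤSolver.solve-∀

    negs : ∀ x y → ℤ.- (x ℤ.- y) ≡ (ℤ.- x) ℤ.- (ℤ.- y)
    negs = ℤSolver.solve-∀

    ≈-sym : ∀ {x y} → x ≈ₚ y → y ≈ₚ x
    ≈-sym {x} {y} (congruent d) = congruent (via (negate x y) (ℤ∣.∣m⇒∣-m d))

    ≈-trans : ∀ {x y z} → x ≈ₚ y → y ≈ₚ z → x ≈ₚ z
    ≈-trans {x} {y} {z} (congruent d) (congruent e) =
      congruent (via (telescope x y z) (ℤ∣.∣m∣n⇒∣m+n d e))

    +-cong : ∀ {x y u v} → x ≈ₚ y → u ≈ₚ v → x ℤ.+ u ≈ₚ y ℤ.+ v
    +-cong {x} {y} {u} {v} (congruent d) (congruent e) =
      congruent (via (sums x y u v) (ℤ∣.∣m∣n⇒∣m+n d e))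

    *-cong : ∀ {x y u v} → x ≈ₚ y → u ≈ₚ v → x ℤ.* u ≈ₚ y ℤ.* v
    *-cong {x} {y} {u} {v} (congruent d) (congruent e) =
      congruent (via (products x y u v)
        (ℤ∣.∣m∣n⇒∣m+n (ℤ∣.∣m⇒∣m*n u d) (ℤ∣.∣n⇒∣m*n y e)))

    neg-cong : ∀ {x y} → x ≈ₚ y → ℤ.- x ≈ₚ ℤ.- y
    neg-cong {x} {y} (congruent d) = congruent (via (negs x y) (ℤ∣.∣m⇒∣-m d))

    isCommutativeRing′ : IsCommutativeRing _≈ₚ_ ℤ._+_ ℤ._*_ ℤ.-_ (+ 0) (+ 1)
    isCommutativeRing′ = record
      { isRing = record
        { +-isAbelianGroup = record
          { isGroup = record
            { isMonoid = record
              { isSemigroup = record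
                { isMagma = record
                  { isEquivalence = record
                    { refl = reflexive ≡.refl ; sym = ≈-sym ; trans = ≈-trans }
                  ; ∙-cong = +-cong
                  }
                ; assoc = λ x y z → reflexive (ℤₚ.+-assoc x y z)
                }
              ; identity = (λ x → reflexive (ℤₚ.+-identityˡ x))
                         , (λ x → reflexive (ℤₚ.+-identityʳ x))
              }
            ; inverse = (λ x → reflexive (ℤₚ.+-inverseˡ x))
                      , (λ x → reflexive (ℤₚ.+-inverseʳ x))
            ; ⁻¹-cong = neg-cong
            }
          ; comm = λ x y → reflexive (ℤₚ.+-comm x y)
          }
        ; *-cong = *-cong
        ; *-assoc = λ x y z → reflexive (ℤₚ.*-assoc x y z)
        ; *-identity = (λ x → reflexive (ℤₚ.*-identityˡ x))
                     , (λ x → reflexive (ℤₚ.*-identityʳ x))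
        ; distrib = (λ x y z → reflexive (ℤₚ.*-distribˡ-+ x y z))
                  , (λ x y z → reflexive (ℤₚ.*-distribʳ-+ x y z))
        }
      ; *-comm = λ x y → reflexive (ℤₚ.*-comm x y)
      }

    minus0 : ∀ x → x ≡ x ℤ.- + 0
    minus0 = ℤSolver.solve-∀

    p∣⇒≈0 : ∀ m → p ℕ∣.∣ ℤ.∣ m ∣ → m ≈ₚ + 0
    p∣⇒≈0 m d = congruent (via (minus0 m) (ℤ∣.∣ᵤ⇒∣ d))

    1≉0 : ¬ (+ 1 ≈ₚ + 0)
    1≉0 (congruent d) =
      ¬prime[1] (≡.subst Prime (ℕ∣.∣1⇒≡1 (ℤ∣.∣⇒∣ᵤ d)) p-prime)

    coprime : ∀ m → ¬ (p ℕ∣.∣ m) → Coprimality.Coprime p m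
    coprime m p∤m (d∣p , d∣m) with prime⇒irreducible p-prime d∣p
    ... | inj₁ d≡1    = d≡1
    ... | inj₂ ≡.refl = ⊥-elim (p∤m d∣m)

    identity⁻ : ∀ m y x p → + 1 ℤ.+ y ℤ.* m ≡ x ℤ.* p →
                (ℤ.- x) ℤ.* p ≡ m ℤ.* (ℤ.- y) ℤ.- + 1
    identity⁻ m y x p e = ≡.trans (ℤₚ.*-identityˡ _ ⟨flip⟩ expand x p)
      (≡.trans (≡.cong ℤ.-_ (≡.sym e)) (collect m y))
      where
      _⟨flip⟩_ : ∀ {a b c : ℤ} → a ≡ b → c ≡ a → c ≡ b
      q ⟨flip⟩ r = ≡.trans r q
      expand : ∀ x p → (ℤ.- x) ℤ.* p ≡ + 1 ℤ.* (ℤ.- (x ℤ.* p))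
      expand = ℤSolver.solve-∀
      collect : ∀ m y → ℤ.- (+ 1 ℤ.+ y ℤ.* m) ≡ m ℤ.* (ℤ.- y) ℤ.- + 1
      collect = ℤSolver.solve-∀

    identity⁺ : ∀ m y x p → + 1 ℤ.+ x ℤ.* p ≡ y ℤ.* m →
                x ℤ.* p ≡ m ℤ.* y ℤ.- + 1
    identity⁺ m y x p e = ≡.trans (drop (x ℤ.* p))
      (≡.trans (≡.cong (ℤ._- + 1) e) (≡.cong (ℤ._- + 1) (ℤₚ.*-comm y m)))
      where
      drop : ∀ z → z ≡ (+ 1 ℤ.+ z) ℤ.- + 1
      drop = ℤSolver.solve-∀

    cast : ∀ a b c d → 1 ℕ.+ a ℕ.* b ≡ c ℕ.* d →
           + 1 ℤ.+ + a ℤ.* + b ≡ + c ℤ.* + d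
    cast a b c d e = ≡.trans (≡.cong (λ z → + 1 ℤ.+ z) (≡.sym (ℤₚ.pos-* a b)))
      (≡.trans (≡.cong +_ e) (ℤₚ.pos-* c d))

    invert⁺ : ∀ m → ¬ (p ℕ∣.∣ m) → ∃ λ y → + m ℤ.* y ≈ₚ + 1
    invert⁺ m p∤m with Coprimality.coprime-Bézout (coprime m p∤m)
    ... | Bézout.+- x y e = ℤ.- + y , congruent
      (ℤ∣.divides (ℤ.- + x) (≡.sym (identity⁻ (+ m) (+ y) (+ x) (+ p) (cast y m x p e))))
    ... | Bézout.-+ x y e = + y , congruent
      (ℤ∣.divides (+ x) (≡.sym (identity⁺ (+ m) (+ y) (+ x) (+ p) (cast x p y m e))))

    neg*neg : ∀ x y → (ℤ.- x) ℤ.* (ℤ.- y) ≡ x ℤ.* y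
    neg*neg = ℤSolver.solve-∀

    invert : ∀ x → ¬ (x ≈ₚ + 0) → ∃ λ y → x ℤ.* y ≈ₚ + 1
    invert (+ m)    x≉0 = invert⁺ m (λ d → x≉0 (p∣⇒≈0 (+ m) d))
    invert -[1+ m ] x≉0 with invert⁺ (suc m) (λ d → x≉0 (p∣⇒≈0 -[1+ m ] d))
    ... | y , e = ℤ.- y , ≈-trans (reflexive (neg*neg (+ suc m) y)) e

  primeField : DiscreteField
  primeField = record
    { commutativeRing = record { isCommutativeRing = isCommutativeRing′ }
    ; _≟_             = λ x y → map′ congruent divides- (+ p ℤ∣.∣? (x ℤ.- y))
    ; 1≉0             = 1≉0
    ; invertible      = invert
    }

𝔽 : (p : ℕ) → Prime p → DiscreteField
𝔽 = PrimeField.primeField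

-- F is meant to be the field of p elements.
module Laguerre (F : DiscreteField) (p : ℕ) where

  F[α] : DiscreteDomain
  F[α] = PolynomialDomain.polynomialDomain (DiscreteField.discreteDomain F)

  -- K = F(α)
  K : DiscreteField
  K = Fractions.fractionField F[α]

  private
    F-ring F[α]-ring K-ring : CRing
    F-ring    = DiscreteField.commutativeRing F
    F[α]-ring = DiscreteDomain.commutativeRing F[α]
    K-ring    = DiscreteField.commutativeRing K

  module F where
    open DiscreteField F public using (_⁻¹)
    open RingNotation F-ring public

  module F[α] where
    open PolynomialBase F-ring public using (C) renaming (X to α)
    open RingNotation F[α]-ring public

  module F[α,X] where
    open PolynomialBase F[α]-ring public using (C; X)
    open RingNotation (F[α]-ring [X]) public

  module K where
    open DiscreteField K public using (_⁻¹)
    open Fractions F[α] public using (ι)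
    open RingNotation K-ring public

    α : Carrier
    α = ι F[α].α

  module K[X] where
    open PolynomialBase K-ring public using (C; X)
    open RingNotation (K-ring [X]) public

    infixl 9 _∘ᴾ_
    _∘ᴾ_ : Carrier → Carrier → Carrier
    f ∘ᴾ g = eval K-ring (K-ring [X]) C g f

  infix 9 _at_
  _at_ : F[α].Carrier → K.Carrier → K.Carrier
  f at γ = eval F-ring K-ring (λ a → K.ι (F[α].C a)) γ f

  binomial : F[α].Carrier → ℕ → F[α].Carrier
  binomial x m = (∏[ 0 ≤ i < m ] (x - ⌜ i ⌝)) * C (F.⌜ m ! ⌝ F.⁻¹)
    where open F[α]

  b : ℕ → ℕ → F[α].Carrier
  b r s = ∑[ 0 ≤ k < p ]
      (C (F.- (F.⌜ r ⌝ F.* F.⌜ s ⌝ F.⁻¹)) ^ k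
        * binomial (⌜ r ⌝ * α - 1#) (p ∸ 1 ∸ k)
        * binomial (⌜ s ⌝ * α - 1#) k)
    where open F[α]

  L : F[α,X].Carrier
  L = ∑[ 0 ≤ k < p ]
      (C (binomial (F[α].α F[α].- F[α].1#) (p ∸ 1 ∸ k))
        * (- X) ^ k
        * C (F[α].C (F.⌜ k ! ⌝ F.⁻¹)))
    where open F[α,X]

  -- L with α replaced by γ and X replaced by x.
  L⟨_,_⟩ : K.Carrier → K.Carrier → K.Carrier
  L⟨ γ , x ⟩ = eval F[α]-ring K-ring (_at γ) x L

  -- Only b 1 s with 0 < s < p - 1 occur here.  Their constant term is
  -- (-1/s - 1) ^ (p - 1) ≠ 0, so they do not vanish at multiples of α.
  G : K.Carrier → K[X].Carrier
  G γ = - (∑[ 1 ≤ k < p ]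
      (C (K.⌜ k ⌝ K.⁻¹) * (X ^ k * C ((K.∏[ 1 ≤ s < k ] (b 1 s at γ)) K.⁻¹))))
    where open K[X]

{-# OPTIONS --safe #-}
module Submission where

open import Defs
open import Data.Nat.Base using (ℕ; _<_)
open import Data.Nat.Divisibility using (_∤_)
open import Data.Nat.Primality using (Prime)
open import Algebra.Bundles using (CommutativeMonoid; CommutativeRing)
import Algebra.Definitions.RawMagma as RawMagma
import Algebra.Morphism.Construct.Composition as Composition
import Algebra.Morphism.Construct.Identity as Identity
open import Algebra.Morphism.Structures using (IsRingHomomorphism)
import Algebra.Properties.AbelianGroup as AbelianGroupProperties
import Algebra.Properties.CommutativeMonoid.Sum as MonoidSum
import Algebra.Properties.CommutativeSemiring.Binomial as Binomial
import Algebra.Properties.CommutativeSemiring.Exp as CommutativeSemiringExp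
import Algebra.Properties.Group as GroupProperties
import Algebra.Properties.Ring as RingProperties
import Algebra.Properties.Semiring.Divisibility as SemiringDivisibility
import Algebra.Properties.Semiring.Exp as SemiringExp
import Algebra.Properties.Semiring.Mult as SemiringMult
import Algebra.Properties.Semiring.Sum as SemiringSum
import Algebra.Solver.Ring.NaturalCoefficients.Default as NatSolver
open import Data.Empty using (⊥-elim)
open import Data.Fin.Base using (Fin; toℕ; fromℕ<)
open import Data.Fin.Permutation using (Permutation′; permutation; reverse)
import Data.Fin.Properties as Finₚ
import Data.Integer.Base as ℤ
import Data.Integer.Divisibility.Signed as ℤ∣
import Data.Integer.Properties as ℤₚ
open import Data.List.Base using ([]; _∷_)
open import Data.Nat.Base as ℕ using (zero; suc; _∸_; _!; _≤_; z≤n; s≤s; NonZero)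
open import Data.Nat.Combinatorics using (nCn≡1; k![n∸k]!∣n!; nCk≡n!/k![n-k]!)
  renaming (_C_ to _choose_)
open import Data.Nat.Coprimality using (prime⇒coprime; coprime-Bézout)
import Data.Nat.Divisibility as ℕ∣
open ℕ∣ using (divides; >⇒∤; ∣1⇒≡1; m∣m*n)
open import Data.Nat.DivMod using (_%_; _/_; m/n*n≡m; m≡m%n+[m/n]*n; m%n<n)
open import Data.Nat.GCD using (module Bézout)
open import Data.Nat.Primality using (euclidsLemma; ¬prime[1])
import Data.Nat.Properties as ℕₚ
open import Data.Product.Base using (∃; _,_; proj₁; proj₂)
open import Data.Sum.Base using (inj₁; inj₂; [_,_]′)
open import Function.Base using (_∘_; id)
open import Level using (0ℓ)
open import Relation.Binary.Definitions using (tri<; tri≈; tri>)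
import Relation.Binary.PropositionalEquality as ≡
open ≡ using (_≡_)
import Relation.Binary.Reasoning.Setoid as SetoidReasoning
open import Relation.Nullary.Decidable.Core using (yes; no)
open import Relation.Nullary.Negation.Core using (¬_; contradiction)

-- Let u lie in a field of characteristic p, with x = u ^ p - u nonzero, and put
-- E(u) = L^(u ^ p)(u ^ p - u).  The relation x ^ p = α ^ p - α between α = u ^ p and x is the
-- one that makes the sequence (α - 1)(α - 2) ⋯ (α - i) / x ^ i periodic mod p, and E(u) is a
-- multiple of its sum over a period.  Cyclic convolution of the sequences of u and s u
-- satisfies the first order recurrence of the sequence of (1 + s) u, whence
--     E(u) E(s u) = b_{1,s}(u) ^ p E((1 + s) u)   and   E(u) ^ n = B_n(u) ^ p E(n u),
-- where B_n is the product of b_{1,s} over 0 < s < n.  For u = α the constant of the theorem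
-- is c = E(α).  If h k = d p + j with j < p, comparing the two values of c ^ (h k) and
-- cancelling the Frobenius map gives B_h(α) ^ k B_k(h α) = c ^ d B_j(α).  This is the required
-- equality between the k-th term on the left and the j-th on the right, since
-- X ^ (h k) ≡ c ^ d X ^ j.

-- The functional equation involves b_{1,s}(u) only through its p-th power: L is taken at u ^ p, and
-- b_{1,s}(u ^ p) = b_{1,s}(u) ^ p because b_{1,s} has coefficients in F_p. Injectivity of Frobenius
-- removes the exponent, but only after division by E(jα), so the argument rests on nonvanishing. It
-- comes from specialising α to 0, where (p - 1)! L^(0)(0) = (-1)(-2) ⋯ (-(p - 1)); this covers E(α)
-- and E(hα), and E(jα) and B_j(α) are then nonzero because E(α) ^ j = B_j(α) ^ p E(jα). The
-- factorials in the denominators are removed by k! (p - 1 - k)! = (-1) ^ k (p - 1)! in F_p: all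
-- terms of L and of b_{1,s} get the common factor 1 / (p - 1)!, and what remains are division-free
-- sums of falling factorials, which every ring homomorphism preserves, Frobenius included. Since 0
-- ⁻¹ = 0 by convention, the sum in G may start at k = 0, so that k ↦ h k permutes all its indices
-- mod p.

-- Finite sums and products in a commutative monoid.

-- big n f = f 0 ∙ ⋯ ∙ f (n - 1), opaque so that f can be inferred.
module BigOperator (M : CommutativeMonoid 0ℓ 0ℓ) where
  open CommutativeMonoid M
  open MonoidSum M
  open SetoidReasoning setoid

  opaque
    big : ℕ → (ℕ → Carrier) → Carrier
    big n f = sum {n} λ i → f (toℕ i)

    big-def : ∀ n f → sum {n} (λ i → f (toℕ i)) ≈ big n f
    big-def n f = refl

    big-cong : ∀ n {f g} → (∀ k → k < n → f k ≈ g k) → big n f ≈ big n g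
    big-cong n f≈g = sum-cong-≋ λ i → f≈g (toℕ i) (Finₚ.toℕ<n i)

    big-ε : ∀ n {f} → (∀ k → k < n → f k ≈ ε) → big n f ≈ ε
    big-ε n f≈ε = trans (sum-cong-≋ λ i → f≈ε (toℕ i) (Finₚ.toℕ<n i)) (sum-replicate-zero n)

    big-empty : ∀ f → big 0 f ≈ ε
    big-empty f = refl

    big-first : ∀ n f → big (suc n) f ≈ f 0 ∙ big n (f ∘ suc)
    big-first n f = refl

    big-last : ∀ n f → big (suc n) f ≈ big n f ∙ f n
    big-last zero    f = comm (f 0) ε
    big-last (suc n) f = trans (∙-congˡ (big-last n (f ∘ suc))) (sym (assoc _ _ _))

    big-reverse : ∀ n f → big (suc n) f ≈ big (suc n) (λ k → f (n ∸ k))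
    big-reverse n f = trans (sum-permute {suc n} {suc n} (λ i → f (toℕ i)) reverse)
      (sum-cong-≋ {suc n} λ i → reflexive (≡.cong f (Finₚ.opposite-prop i)))

    big-∙ : ∀ n f g → big n (λ k → f k ∙ g k) ≈ big n f ∙ big n g
    big-∙ n f g = ∑-distrib-+ {n} (f ∘ toℕ) (g ∘ toℕ)

    big-comm : ∀ m n (f : ℕ → ℕ → Carrier) →
               big m (λ i → big n λ j → f i j) ≈ big n (λ j → big m λ i → f i j)
    big-comm m n f = ∑-comm {m} {n} λ i j → f (toℕ i) (toℕ j)

    big-permute : ∀ n (σ τ : ℕ → ℕ) → (∀ k → k < n → σ k < n) → (∀ k → k < n → τ k < n) →
      (∀ k → k < n → σ (τ k) ≡ k) → (∀ k → k < n → τ (σ k) ≡ k) → ∀ f →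
      big n (f ∘ σ) ≈ big n f
    big-permute n σ τ σ< τ< στ τσ f = sym (trans (sum-permute {n} {n} (λ i → f (toℕ i)) π)
      (sum-cong-≋ {n} λ i → reflexive (≡.cong f (Finₚ.toℕ-fromℕ< (σ< (toℕ i) (Finₚ.toℕ<n i))))))
      where
      fin : (ρ : ℕ → ℕ) → (∀ k → k < n → ρ k < n) → Fin n → Fin n
      fin ρ ρ< i = fromℕ< (ρ< (toℕ i) (Finₚ.toℕ<n i))
      fin-fin : ∀ ρ ρ′ ρ< ρ′< → (∀ k → k < n → ρ (ρ′ k) ≡ k) → ∀ i → fin ρ ρ< (fin ρ′ ρ′< i) ≡ i
      fin-fin ρ ρ′ ρ< ρ′< ρρ′ i = Finₚ.toℕ-injective (≡.trans (Finₚ.toℕ-fromℕ< _)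
        (≡.trans (≡.cong ρ (Finₚ.toℕ-fromℕ< _)) (ρρ′ (toℕ i) (Finₚ.toℕ<n i))))
      π : Permutation′ n
      π = permutation (fin σ σ<) (fin τ τ<) (fin-fin σ τ σ< τ< στ) (fin-fin τ σ τ< σ< τσ)

  -- Moving a window of length n by one drops f m and gains f (m + n), which are equal by
  -- periodicity.
  big-shift : ∀ n f → (∀ k → f (n ℕ.+ k) ≈ f k) → ∀ m → big n (λ k → f (m ℕ.+ k)) ≈ big n f
  big-shift n f periodic zero    = refl
  big-shift n f periodic (suc m) = begin
    big n (λ k → f (suc m ℕ.+ k))                  ≈⟨ cancel ⟩
    big n (λ k → f (m ℕ.+ k))                      ≈⟨ big-shift n f periodic m ⟩
    big n f                                        ∎
    where
    step : ∀ n (g : ℕ → Carrier) → g n ≈ g 0 → big n (g ∘ suc) ≈ big n g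
    step zero    g _     = trans (big-empty _) (sym (big-empty _))
    step (suc n) g gn≈g0 = begin
      big (suc n) (g ∘ suc)           ≈⟨ big-last n (g ∘ suc) ⟩
      big n (g ∘ suc) ∙ g (suc n)     ≈⟨ comm _ _ ⟩
      g (suc n) ∙ big n (g ∘ suc)     ≈⟨ ∙-congʳ gn≈g0 ⟩
      g 0 ∙ big n (g ∘ suc)           ≈⟨ big-first n g ⟨
      big (suc n) g                   ∎
    cancel : big n (λ k → f (suc m ℕ.+ k)) ≈ big n (λ k → f (m ℕ.+ k))
    cancel = begin
      big n (λ k → f (suc m ℕ.+ k))
        ≈⟨ big-cong n (λ k _ → reflexive (≡.cong f (≡.sym (ℕₚ.+-suc m k)))) ⟩
      big n (λ k → f (m ℕ.+ suc k))
        ≈⟨ step n (λ k → f (m ℕ.+ k)) (begin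
             f (m ℕ.+ n)  ≡⟨ ≡.cong f (ℕₚ.+-comm m n) ⟩
             f (n ℕ.+ m)  ≈⟨ periodic m ⟩
             f m          ≡⟨ ≡.cong f (ℕₚ.+-identityʳ m) ⟨
             f (m ℕ.+ 0)  ∎) ⟩
      big n (λ k → f (m ℕ.+ k)) ∎

-- Falling factorials, Stirling numbers and triangular systems.

module RingLemmas (R : CRing) where
  open RingNotation R hiding (∑; ∏)
  open SetoidReasoning setoid
  open RingProperties ring public
    using (-‿distribˡ-*; -‿distribʳ-*; -‿involutive; -0#≈0#; x[y-z]≈xy-xz)
  open AbelianGroupProperties +-abelianGroup public using ()
    renaming (⁻¹-∙-comm to -‿+-comm; x∙y⁻¹≈ε⇒x≈y to x-y≈0⇒x≈y; x≈y⇒x∙y⁻¹≈ε to x≈y⇒x-y≈0)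
  open SemiringExp semiring public
    using (^-homo-*; ^-assocʳ; ^-congˡ)
  open CommutativeSemiringExp commutativeSemiring public using (^-distrib-*)
  open NatSolver commutativeSemiring public using (solve; _:=_; _:+_; _:*_)
  open BigOperator +-commutativeMonoid public using () renaming
    ( big-def to ∑-def; big-cong to ∑-cong; big-ε to ∑-zero; big-empty to ∑-empty
    ; big-first to ∑-first; big-last to ∑-last; big-reverse to ∑-reverse; big-∙ to ∑-distrib-+
    ; big-comm to ∑-comm; big-shift to ∑-shift )
  open BigOperator *-commutativeMonoid public using () renaming
    ( big-def to ∏-def; big-cong to ∏-cong; big-empty to ∏-empty
    ; big-first to ∏-first; big-last to ∏-last )

  private
    module Sum = BigOperator +-commutativeMonoid
    module Prod = BigOperator *-commutativeMonoid

  ∑ ∏ : ℕ → (ℕ → Carrier) → Carrier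
  ∑ = Sum.big
  ∏ = Prod.big

  infix 6 ∑ ∏
  infixr 8 _↓_
  syntax ∑ n (λ k → e) = ∑[ k < n ] e
  syntax ∏ n (λ k → e) = ∏[ k < n ] e

  opaque
    unfolding Sum.big
    *-distribˡ-∑ : ∀ n x f → x * ∑ n f ≈ ∑[ k < n ] (x * f k)
    *-distribˡ-∑ n x f = SemiringSum.*-distribˡ-sum semiring {n} x (f ∘ toℕ)

    *-distribʳ-∑ : ∀ n x f → ∑ n f * x ≈ ∑[ k < n ] (f k * x)
    *-distribʳ-∑ n x f = SemiringSum.*-distribʳ-sum semiring {n} x (f ∘ toℕ)

  1^ : ∀ n → 1# ^ n ≈ 1#
  1^ zero    = refl
  1^ (suc n) = trans (*-identityˡ _) (1^ n)

  0^ : ∀ n → 0# ^ suc n ≈ 0#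
  0^ n = zeroˡ _

  ⌜⌝-+ : ∀ m n → ⌜ m ℕ.+ n ⌝ ≈ ⌜ m ⌝ + ⌜ n ⌝
  ⌜⌝-+ m n = SemiringMult.×-homo-+ semiring 1# m n

  ⌜⌝-* : ∀ m n → ⌜ m ℕ.* n ⌝ ≈ ⌜ m ⌝ * ⌜ n ⌝
  ⌜⌝-* = SemiringMult.×1-homo-* semiring

  -- The falling factorial x (x - 1) ⋯ (x - n + 1). It replaces the binomial coefficient, which
  -- would require division by n!.
  _↓_ : Carrier → ℕ → Carrier
  x ↓ n = ∏[ i < n ] (x - ⌜ i ⌝)

  ↓-cong : ∀ {x y} → x ≈ y → ∀ n → x ↓ n ≈ y ↓ n
  ↓-cong x≈y n = ∏-cong n λ i _ → +-congʳ x≈y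

  ↓-suc : ∀ x n → x ↓ suc n ≈ (x - ⌜ n ⌝) * (x ↓ n)
  ↓-suc x n = trans (∏-last n _) (*-comm _ _)

  x-0≈x : ∀ x → x - 0# ≈ x
  x-0≈x x = trans (+-congˡ -0#≈0#) (+-identityʳ x)

  [x-y]-z : ∀ x y z → (x - y) - z ≈ x - (y + z)
  [x-y]-z x y z = trans (+-assoc _ _ _) (+-congˡ (-‿+-comm y z))

  [x-y]+y≈x : ∀ x y → (x - y) + y ≈ x
  [x-y]+y≈x x y = trans (+-assoc _ _ _) (trans (+-congˡ (-‿inverseˡ y)) (+-identityʳ x))

  [x+y]-y≈x : ∀ x y → (x + y) - y ≈ x
  [x+y]-y≈x x y = trans (+-assoc _ _ _) (trans (+-congˡ (-‿inverseʳ y)) (+-identityʳ x))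

  ↓-suc′ : ∀ x n → x ↓ suc n ≈ x * ((x - 1#) ↓ n)
  ↓-suc′ x n = trans (∏-first n _) (*-cong (x-0≈x x) (∏-cong n λ i _ → sym ([x-y]-z x 1# ⌜ i ⌝)))

  ⌜⌝↓ : ∀ m n → ⌜ suc m ⌝ ↓ suc n ≈ ⌜ suc m ⌝ * (⌜ m ⌝ ↓ n)
  ⌜⌝↓ m n = trans (↓-suc′ ⌜ suc m ⌝ n) (*-congˡ (↓-cong (trans (+-congʳ (+-comm 1# ⌜ m ⌝)) ([x+y]-y≈x _ _)) n))

  m<n⇒⌜m⌝↓n≈0 : ∀ m n → m < n → ⌜ m ⌝ ↓ n ≈ 0#
  m<n⇒⌜m⌝↓n≈0 zero    (suc n) _         = trans (∏-first n _) (trans (*-congʳ (x-0≈x 0#)) (zeroˡ _))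
  m<n⇒⌜m⌝↓n≈0 (suc m) (suc n) (s≤s m<n) = trans (⌜⌝↓ m n) (trans (*-congˡ (m<n⇒⌜m⌝↓n≈0 m n m<n)) (zeroʳ _))

  ⌜n⌝↓n≈⌜n!⌝ : ∀ n → ⌜ n ⌝ ↓ n ≈ ⌜ n ! ⌝
  ⌜n⌝↓n≈⌜n!⌝ zero    = trans (∏-empty _) (sym (+-identityʳ 1#))
  ⌜n⌝↓n≈⌜n!⌝ (suc n) = trans (⌜⌝↓ n n) (trans (*-congˡ (⌜n⌝↓n≈⌜n!⌝ n)) (sym (⌜⌝-* (suc n) (n !))))

  -- Stirling numbers of the second kind, the coefficients of x ^ n in the basis of falling
  -- factorials.
  stirling : ℕ → ℕ → ℕ
  stirling zero    zero    = 1
  stirling zero    (suc j) = 0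
  stirling (suc n) zero    = 0
  stirling (suc n) (suc j) = stirling n j ℕ.+ suc j ℕ.* stirling n (suc j)

  n<j⇒stirling≡0 : ∀ n j → n < j → stirling n j ≡ 0
  n<j⇒stirling≡0 zero    (suc j) _ = ≡.refl
  n<j⇒stirling≡0 (suc n) (suc j) (s≤s n<j)
    rewrite n<j⇒stirling≡0 n j n<j | n<j⇒stirling≡0 n (suc j) (ℕₚ.m<n⇒m<1+n n<j) = ℕₚ.*-zeroʳ j

  stirling[n,n] : ∀ n → stirling n n ≡ 1
  stirling[n,n] zero = ≡.refl
  stirling[n,n] (suc n) rewrite stirling[n,n] n | n<j⇒stirling≡0 n (suc n) (ℕₚ.n<1+n n) =
    ≡.cong suc (ℕₚ.*-zeroʳ n)

  stirling[1+n,1] : ∀ n → stirling (suc n) 1 ≡ 1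
  stirling[1+n,1] zero    = ≡.refl
  stirling[1+n,1] (suc n) = ≡.trans (ℕₚ.+-identityʳ _) (stirling[1+n,1] n)

  x*x↓j : ∀ x j → x * x ↓ j ≈ x ↓ suc j + ⌜ j ⌝ * x ↓ j
  x*x↓j x j = begin
    x * x ↓ j                                ≈⟨ *-congʳ ([x-y]+y≈x x ⌜ j ⌝) ⟨
    (x - ⌜ j ⌝ + ⌜ j ⌝) * x ↓ j              ≈⟨ distribʳ _ _ _ ⟩
    (x - ⌜ j ⌝) * x ↓ j + ⌜ j ⌝ * x ↓ j    ≈⟨ +-congʳ (↓-suc x j) ⟨
    x ↓ suc j + ⌜ j ⌝ * x ↓ j              ∎

  -- Induction on n: by `x*x↓j`, multiplication by x acts on the coefficients as the recurrence of
  -- `stirling`.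
  ^-stirling : ∀ x n → x ^ n ≈ ∑[ j < suc n ] (⌜ stirling n j ⌝ * x ↓ j)
  ^-stirling x zero    = sym (begin
    ∑[ j < 1 ] (⌜ stirling 0 j ⌝ * x ↓ j)  ≈⟨ ∑-first 0 _ ⟩
    ⌜ 1 ⌝ * x ↓ 0 + ∑ 0 _                  ≈⟨ +-cong (*-cong (+-identityʳ 1#) (∏-empty _)) (∑-empty _) ⟩
    1# * 1# + 0#                           ≈⟨ trans (+-identityʳ _) (*-identityʳ 1#) ⟩
    1#                                     ∎)
  ^-stirling x (suc n) = begin
    x * x ^ n
      ≈⟨ *-congˡ (^-stirling x n) ⟩
    x * (∑[ j < suc n ] (⌜ S n j ⌝ * x ↓ j))
      ≈⟨ *-distribˡ-∑ (suc n) x _ ⟩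
    ∑[ j < suc n ] (x * (⌜ S n j ⌝ * x ↓ j))
      ≈⟨ ∑-cong (suc n) (λ j _ → trans (solve 3 (λ x a b → x :* (a :* b) := a :* (x :* b)) refl x _ _)
           (trans (*-congˡ (x*x↓j x j)) (distribˡ _ _ _))) ⟩
    ∑[ j < suc n ] (g j + h j)
      ≈⟨ ∑-distrib-+ (suc n) g h ⟩
    ∑ (suc n) g + ∑ (suc n) h
      ≈⟨ +-congˡ shift ⟩
    ∑ (suc n) g + ∑ (suc n) (h ∘ suc)
      ≈⟨ ∑-distrib-+ (suc n) g (h ∘ suc) ⟨
    ∑[ j < suc n ] (g j + h (suc j))
      ≈⟨ ∑-cong (suc n) (λ j _ → sym (collect j)) ⟩
    ∑[ j < suc n ] (⌜ S (suc n) (suc j) ⌝ * x ↓ suc j)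
      ≈⟨ +-identityˡ _ ⟨
    0# + (∑[ j < suc n ] (⌜ S (suc n) (suc j) ⌝ * x ↓ suc j))
      ≈⟨ +-congʳ (zeroˡ _) ⟨
    0# * x ↓ 0 + (∑[ j < suc n ] (⌜ S (suc n) (suc j) ⌝ * x ↓ suc j))
      ≈⟨ ∑-first (suc n) _ ⟨
    ∑[ j < suc (suc n) ] (⌜ S (suc n) j ⌝ * x ↓ j)
      ∎
    where
    S = stirling
    g h : ℕ → Carrier
    g j = ⌜ S n j ⌝ * x ↓ suc j
    h j = ⌜ S n j ⌝ * (⌜ j ⌝ * x ↓ j)
    -- Neither end contributes: h 0 has the factor ⌜ 0 ⌝, and h (suc n) has the factor stirling n
    -- (suc n) = 0.
    shift : ∑ (suc n) h ≈ ∑ (suc n) (h ∘ suc)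
    shift = begin
      ∑ (suc n) h                 ≈⟨ ∑-first n h ⟩
      h 0 + ∑ n (h ∘ suc)         ≈⟨ +-congʳ (trans (*-congˡ (zeroˡ _)) (zeroʳ _)) ⟩
      0# + ∑ n (h ∘ suc)          ≈⟨ +-comm _ _ ⟩
      ∑ n (h ∘ suc) + 0#
        ≈⟨ +-congˡ (trans (*-congʳ (reflexive (≡.cong ⌜_⌝ (n<j⇒stirling≡0 n (suc n) (ℕₚ.n<1+n n))))) (zeroˡ _)) ⟨
      ∑ n (h ∘ suc) + h (suc n)   ≈⟨ ∑-last n (h ∘ suc) ⟨
      ∑ (suc n) (h ∘ suc)         ∎
    collect : ∀ j → ⌜ S (suc n) (suc j) ⌝ * x ↓ suc j ≈
              ⌜ S n j ⌝ * x ↓ suc j + ⌜ S n (suc j) ⌝ * (⌜ suc j ⌝ * x ↓ suc j)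
    collect j = begin
      ⌜ S n j ℕ.+ suc j ℕ.* S n (suc j) ⌝ * x ↓ suc j
        ≈⟨ *-congʳ (trans (⌜⌝-+ (S n j) _) (+-congˡ (⌜⌝-* (suc j) (S n (suc j))))) ⟩
      (⌜ S n j ⌝ + ⌜ suc j ⌝ * ⌜ S n (suc j) ⌝) * x ↓ suc j
        ≈⟨ solve 4 (λ a b c d → (a :+ b :* c) :* d := a :* d :+ c :* (b :* d)) refl _ _ _ _ ⟩
      ⌜ S n j ⌝ * x ↓ suc j + ⌜ S n (suc j) ⌝ * (⌜ suc j ⌝ * x ↓ suc j)
        ∎

  -- Forward substitution: row 0 gives c 0 = 0, after which row and column 0 can be deleted.
  triangular : ∀ n (t : ℕ → ℕ → Carrier) (c : ℕ → Carrier) →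
    (∀ m j → m < n → m < j → t m j ≈ 0#) →
    (∀ m x → m < n → x * t m m ≈ 0# → x ≈ 0#) →
    (∀ m → m < n → ∑[ j < n ] (c j * t m j) ≈ 0#) →
    ∀ m → m < n → c m ≈ 0#
  triangular (suc n) t c upper regular system = λ where
      zero    _         → c0≈0
      (suc m) (s≤s m<n) → triangular n (λ m j → t (suc m) (suc j)) (c ∘ suc)
        (λ m j m<n m<j → upper (suc m) (suc j) (s≤s m<n) (s≤s m<j))
        (λ m x m<n → regular (suc m) x (s≤s m<n))
        (λ m m<n → begin
          ∑[ j < n ] (c (suc j) * t (suc m) (suc j))
            ≈⟨ +-identityˡ _ ⟨
          0# + (∑[ j < n ] (c (suc j) * t (suc m) (suc j)))
            ≈⟨ +-congʳ (trans (*-congʳ c0≈0) (zeroˡ _)) ⟨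
          c 0 * t (suc m) 0 + (∑[ j < n ] (c (suc j) * t (suc m) (suc j)))
            ≈⟨ ∑-first n _ ⟨
          ∑[ j < suc n ] (c j * t (suc m) j)
            ≈⟨ system (suc m) (s≤s m<n) ⟩
          0# ∎)
        m m<n
    where
    c0≈0 : c 0 ≈ 0#
    c0≈0 = regular 0 (c 0) (s≤s z≤n) (begin
      c 0 * t 0 0                                       ≈⟨ +-identityʳ _ ⟨
      c 0 * t 0 0 + 0#                                  ≈⟨ +-congˡ (∑-zero n λ j _ →
        trans (*-congˡ (upper 0 (suc j) (s≤s z≤n) (s≤s z≤n))) (zeroʳ _)) ⟨
      c 0 * t 0 0 + (∑[ j < n ] (c (suc j) * t 0 (suc j))) ≈⟨ ∑-first n _ ⟨
      ∑[ j < suc n ] (c j * t 0 j)                  ≈⟨ system 0 (s≤s z≤n) ⟩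
      0#                                                ∎)

-- Ring homomorphisms.

infix 4 _≈0in_
_≈0in_ : ℕ → CRing → Set
n ≈0in R = ⌜ n ⌝ ≈ 0#
  where open RingNotation R

IsHom : (R S : CRing) → (CommutativeRing.Carrier R → CommutativeRing.Carrier S) → Set
IsHom R S = IsRingHomomorphism (CommutativeRing.rawRing R) (CommutativeRing.rawRing S)

module HomLemmas (R S : CRing) where
  private
    module R where
      open RingNotation R public hiding (∑; ∏)
      open RingLemmas R public
    module S where
      open RingNotation S public hiding (∑; ∏)
      open RingLemmas S public
  open SetoidReasoning S.setoid

  -- Preservation of 0 and of negatives follows from additivity, because addition in S is a group
  -- law.
  mkHom : ∀ φ → (∀ {x y} → x R.≈ y → φ x S.≈ φ y) →
          (∀ x y → φ (x R.+ y) S.≈ φ x S.+ φ y) →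
          (∀ x y → φ (x R.* y) S.≈ φ x S.* φ y) → φ R.1# S.≈ S.1# → IsHom R S φ
  mkHom φ φ-cong φ-+ φ-* φ-1 = record
    { isSemiringHomomorphism = record
      { isNearSemiringHomomorphism = record
        { +-isMonoidHomomorphism = record
          { isMagmaHomomorphism = record
            { isRelHomomorphism = record { cong = φ-cong }
            ; homo = φ-+
            }
          ; ε-homo = φ-0
          }
        ; *-homo = φ-*
        }
      ; 1#-homo = φ-1
      }
    ; -‿homo = λ x → uniqueˡ (φ (R.- x)) (φ x) (begin
        φ (R.- x) S.+ φ x  ≈⟨ φ-+ _ _ ⟨
        φ (R.- x R.+ x)    ≈⟨ φ-cong (R.-‿inverseˡ x) ⟩
        φ R.0#             ≈⟨ φ-0 ⟩
        S.0#               ∎)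
    }
    where
    open RingProperties S.ring using (x+x≈x⇒x≈0)
    uniqueˡ : ∀ x y → x S.+ y S.≈ S.0# → x S.≈ S.- y
    uniqueˡ = GroupProperties.inverseˡ-unique S.+-group
    φ-0 : φ R.0# S.≈ S.0#
    φ-0 = x+x≈x⇒x≈0 _ (S.trans (S.sym (φ-+ _ _)) (φ-cong (R.+-identityˡ _)))

  module _ {φ} (φ-hom : IsHom R S φ) where
    open IsRingHomomorphism φ-hom

    hom-minus : ∀ x y → φ (x R.- y) S.≈ φ x S.- φ y
    hom-minus x y = S.trans (+-homo _ _) (S.+-congˡ (-‿homo y))

    hom-^ : ∀ x n → φ (x R.^ n) S.≈ φ x S.^ n
    hom-^ x zero    = 1#-homo
    hom-^ x (suc n) = S.trans (*-homo _ _) (S.*-congˡ (hom-^ x n))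

    hom-⌜⌝ : ∀ n → φ R.⌜ n ⌝ S.≈ S.⌜ n ⌝
    hom-⌜⌝ zero    = 0#-homo
    hom-⌜⌝ (suc n) = S.trans (+-homo _ _) (S.+-cong 1#-homo (hom-⌜⌝ n))

    hom-∑ : ∀ n f → φ (R.∑ n f) S.≈ S.∑ n (φ ∘ f)
    hom-∑ zero    f = S.trans (⟦⟧-cong (R.∑-empty f)) (S.trans 0#-homo (S.sym (S.∑-empty _)))
    hom-∑ (suc n) f = begin
      φ (R.∑ (suc n) f)             ≈⟨ ⟦⟧-cong (R.∑-first n f) ⟩
      φ (f 0 R.+ R.∑ n (f ∘ suc))   ≈⟨ +-homo _ _ ⟩
      φ (f 0) S.+ φ (R.∑ n (f ∘ suc)) ≈⟨ S.+-congˡ (hom-∑ n (f ∘ suc)) ⟩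
      φ (f 0) S.+ S.∑ n (φ ∘ f ∘ suc) ≈⟨ S.∑-first n (φ ∘ f) ⟨
      S.∑ (suc n) (φ ∘ f)           ∎

    hom-∏ : ∀ n f → φ (R.∏ n f) S.≈ S.∏ n (φ ∘ f)
    hom-∏ zero    f = S.trans (⟦⟧-cong (R.∏-empty f)) (S.trans 1#-homo (S.sym (S.∏-empty _)))
    hom-∏ (suc n) f = begin
      φ (R.∏ (suc n) f)             ≈⟨ ⟦⟧-cong (R.∏-first n f) ⟩
      φ (f 0 R.* R.∏ n (f ∘ suc))   ≈⟨ *-homo _ _ ⟩
      φ (f 0) S.* φ (R.∏ n (f ∘ suc)) ≈⟨ S.*-congˡ (hom-∏ n (f ∘ suc)) ⟩
      φ (f 0) S.* S.∏ n (φ ∘ f ∘ suc) ≈⟨ S.∏-first n (φ ∘ f) ⟨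
      S.∏ (suc n) (φ ∘ f)           ∎

    hom-↓ : ∀ x n → φ (x R.↓ n) S.≈ φ x S.↓ n
    hom-↓ x n = S.trans (hom-∏ n _) (S.∏-cong n λ i _ →
      S.trans (hom-minus x _) (S.+-congˡ (S.-‿cong (hom-⌜⌝ i))))

-- Divisibility by p and the Frobenius map.

module _ {p} (p-prime : Prime p) where

  p∤n! : ∀ n → n < p → p ∤ n !
  p∤n! zero    _   p∣1 = ¬prime[1] (≡.subst Prime (∣1⇒≡1 p∣1) p-prime)
  p∤n! (suc n) n<p p∣  = [ >⇒∤ n<p , p∤n! n (ℕₚ.<-trans (ℕₚ.n<1+n n) n<p) ]′
    (euclidsLemma (suc n) (n !) p-prime p∣)

  -- In (p choose k) k! (p - k)! = p! the right side is divisible by p, whereas the two factorials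
  -- on the left are not.
  p∣pCk : ∀ k → 0 < k → k < p → p ℕ∣.∣ p choose k
  p∣pCk k 0<k k<p with euclidsLemma (p choose k) (k ! ℕ.* (p ∸ k) !) p-prime (≡.subst (p ℕ∣.∣_) (≡.sym eq) p∣p!)
    where
    instance
      _ : NonZero (k ! ℕ.* (p ∸ k) !)
      _ = k ℕₚ.!* (p ∸ k) !≢0
    k≤p : k ≤ p
    k≤p = ℕₚ.<⇒≤ k<p
    eq : (p choose k) ℕ.* (k ! ℕ.* (p ∸ k) !) ≡ p !
    eq = ≡.trans (≡.cong (ℕ._* (k ! ℕ.* (p ∸ k) !)) (nCk≡n!/k![n-k]! k≤p)) (m/n*n≡m (k![n∸k]!∣n! k≤p))
    p∣p! : p ℕ∣.∣ p !
    p∣p! = ∣n! p (ℕₚ.≤-<-trans z≤n k<p)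
      where
      ∣n! : ∀ n → 0 < n → n ℕ∣.∣ n !
      ∣n! (suc n) _ = m∣m*n (n !)
  ... | inj₁ p∣C  = p∣C
  ... | inj₂ p∣k! = ⊥-elim ([ p∤n! k k<p , p∤n! (p ∸ k) (ℕₚ.∸-monoʳ-< 0<k (ℕₚ.<⇒≤ k<p)) ]′
    (euclidsLemma (k !) _ p-prime p∣k!))

module CharP (R : CRing) (q : ℕ) (p-prime : Prime (suc q))
             (⌜p⌝≈0 : suc q ≈0in R) where
  open RingNotation R hiding (∑; ∏)
  open RingLemmas R
  open SetoidReasoning setoid
  private
    p : ℕ
    p = suc q
    module Mult = SemiringMult semiring

  p∣n⇒⌜n⌝≈0 : ∀ {n} → p ℕ∣.∣ n → ⌜ n ⌝ ≈ 0#
  p∣n⇒⌜n⌝≈0 (divides d ≡.refl) = trans (⌜⌝-* d p) (trans (*-congˡ ⌜p⌝≈0) (zeroʳ _))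

  ⌜n%p⌝≈⌜n⌝ : ∀ n → ⌜ n % p ⌝ ≈ ⌜ n ⌝
  ⌜n%p⌝≈⌜n⌝ n = begin
    ⌜ n % p ⌝                      ≈⟨ +-identityʳ _ ⟨
    ⌜ n % p ⌝ + 0#                 ≈⟨ +-congˡ (p∣n⇒⌜n⌝≈0 (divides (n / p) ≡.refl)) ⟨
    ⌜ n % p ⌝ + ⌜ n / p ℕ.* p ⌝    ≈⟨ ⌜⌝-+ (n % p) _ ⟨
    ⌜ n % p ℕ.+ n / p ℕ.* p ⌝      ≡⟨ ≡.cong ⌜_⌝ (m≡m%n+[m/n]*n n p) ⟨
    ⌜ n ⌝                          ∎

  frobenius-+ : ∀ x y → (x + y) ^ p ≈ x ^ p + y ^ p
  frobenius-+ x y = begin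
    (x + y) ^ p                                ≈⟨ Binomial.theorem commutativeSemiring p x y ⟩
    Binomial.binomialExpansion commutativeSemiring x y p ≈⟨ ∑-def (suc p) term ⟩
    ∑ (suc p) term                             ≈⟨ ∑-first p term ⟩
    term 0 + ∑ p (term ∘ suc)                  ≈⟨ +-congˡ (∑-last q (term ∘ suc)) ⟩
    term 0 + (∑ q (term ∘ suc) + term p)       ≈⟨ +-cong first (+-cong (∑-zero q middle) last) ⟩
    y ^ p + (0# + x ^ p)                       ≈⟨ +-congˡ (+-identityˡ _) ⟩
    y ^ p + x ^ p                              ≈⟨ +-comm _ _ ⟩
    x ^ p + y ^ p                              ∎
    where
    open Mult using (_×_)
    term : ℕ → Carrier
    term k = (p choose k) × (x ^ k * y ^ (p ∸ k))
    term≈ : ∀ k → term k ≈ ⌜ p choose k ⌝ * (x ^ k * y ^ (p ∸ k))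
    term≈ k = sym (trans (Mult.×-assoc-* (p choose k) 1# _) (Mult.×-congʳ (p choose k) (*-identityˡ _)))
    first : term 0 ≈ y ^ p
    first = trans (Mult.×-homo-1 _) (*-identityˡ _)
    last : term p ≈ x ^ p
    last = begin
      (p choose p) × (x ^ p * y ^ (p ∸ p))
        ≡⟨ ≡.cong₂ (λ m n → m × (x ^ p * y ^ n)) (nCn≡1 p) (ℕₚ.n∸n≡0 p) ⟩
      1 × (x ^ p * 1#)                 ≈⟨ trans (Mult.×-homo-1 _) (*-identityʳ _) ⟩
      x ^ p                            ∎
    middle : ∀ k → k < q → term (suc k) ≈ 0#
    middle k k<q = trans (term≈ (suc k))
      (trans (*-congʳ (p∣n⇒⌜n⌝≈0 (p∣pCk p-prime (suc k) (s≤s z≤n) (s≤s k<q)))) (zeroˡ _))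

  frobenius : IsHom R R (_^ p)
  frobenius = HomLemmas.mkHom R R (_^ p) (^-congˡ p) frobenius-+ (λ x y → ^-distrib-* x y p) (1^ p)

  -- Fermat's little theorem: Frobenius is a ring homomorphism, so it fixes every sum of copies of
  -- 1.
  ⌜⌝^p : ∀ n → ⌜ n ⌝ ^ p ≈ ⌜ n ⌝
  ⌜⌝^p = HomLemmas.hom-⌜⌝ R R frobenius

  ⌜n⌝*-^p : ∀ n x → (⌜ n ⌝ * x) ^ p ≈ ⌜ n ⌝ * x ^ p
  ⌜n⌝*-^p n x = trans (^-distrib-* _ _ p) (*-congʳ (⌜⌝^p n))

  -- The Artin-Schreier map x ↦ x ^ p - x commutes with integer multiples. Hence passing from E(u)
  -- to E(n u) multiplies both arguments of L by n.
  ⌜n⌝*-℘ : ∀ n x → (⌜ n ⌝ * x) ^ p - ⌜ n ⌝ * x ≈ ⌜ n ⌝ * (x ^ p - x)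
  ⌜n⌝*-℘ n x = trans (+-congʳ (⌜n⌝*-^p n x)) (sym (x[y-z]≈xy-xz _ _ _))

  ⌜⌝-inverse : ∀ n → 0 < n → n < p → ∃ λ y → ⌜ n ⌝ * y ≈ 1#
  ⌜⌝-inverse (suc n) _ n<p with coprime-Bézout (prime⇒coprime p-prime n<p)
  ... | Bézout.-+ x y eq = ⌜ y ⌝ , (begin
    ⌜ suc n ⌝ * ⌜ y ⌝            ≈⟨ *-comm _ _ ⟩
    ⌜ y ⌝ * ⌜ suc n ⌝            ≈⟨ ⌜⌝-* y (suc n) ⟨
    ⌜ y ℕ.* suc n ⌝              ≡⟨ ≡.cong ⌜_⌝ eq ⟨
    1# + ⌜ x ℕ.* p ⌝             ≈⟨ +-congˡ (p∣n⇒⌜n⌝≈0 (divides x ≡.refl)) ⟩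
    1# + 0#                      ≈⟨ +-identityʳ 1# ⟩
    1#                           ∎)
  ... | Bézout.+- x y eq = - ⌜ y ⌝ , (begin
    ⌜ suc n ⌝ * - ⌜ y ⌝          ≈⟨ -‿distribʳ-* _ _ ⟨
    - (⌜ suc n ⌝ * ⌜ y ⌝)        ≈⟨ -‿cong (trans (*-comm _ _) (sym (⌜⌝-* y (suc n)))) ⟩
    - ⌜ y ℕ.* suc n ⌝            ≈⟨ +-identityˡ _ ⟨
    0# - ⌜ y ℕ.* suc n ⌝         ≈⟨ +-congʳ (p∣n⇒⌜n⌝≈0 (divides x ≡.refl)) ⟨
    ⌜ x ℕ.* p ⌝ - ⌜ y ℕ.* suc n ⌝ ≡⟨ ≡.cong (λ m → ⌜ m ⌝ - ⌜ y ℕ.* suc n ⌝) eq ⟨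
    (1# + ⌜ y ℕ.* suc n ⌝) - ⌜ y ℕ.* suc n ⌝ ≈⟨ [x+y]-y≈x _ _ ⟩
    1#                           ∎)

-- Cyclic convolution of two periodic sequences with first order recurrences.

module CyclicConvolution (R : CRing) where
  open RingNotation R hiding (∑; ∏)
  open RingLemmas R
  open SetoidReasoning setoid

  module Convolution (q : ℕ) {x y ζ s : Carrier} {f g : ℕ → Carrier}
    (f-suc : ∀ i → f (suc i) ≈ ζ * ((x - ⌜ i ⌝) * f i))
    (g-suc : ∀ i → s * g (suc i) ≈ ζ * ((y - ⌜ i ⌝) * g i))
    (f-periodic : ∀ i → f (suc q ℕ.+ i) ≈ f i)
    (g-periodic : ∀ i → g (suc q ℕ.+ i) ≈ g i)
    where

    -- The index of g is m - 1 - i mod q + 1, written so that i ≤ q keeps the subtraction from being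
    -- truncated.
    conv : ℕ → Carrier
    conv m = ∑[ i < suc q ] (f i * g (m ℕ.+ (q ∸ i)))

    -- For fixed i, the index m + (q - i) runs through a full period of g as m runs from 0 to q.
    ∑f*∑g : ∑ (suc q) f * ∑ (suc q) g ≈ ∑ (suc q) conv
    ∑f*∑g = begin
      ∑ (suc q) f * ∑ (suc q) g
        ≈⟨ *-distribʳ-∑ (suc q) _ f ⟩
      ∑[ i < suc q ] (f i * ∑ (suc q) g)
        ≈⟨ ∑-cong (suc q) (λ i _ → *-congˡ (trans (sym (∑-shift (suc q) g g-periodic (q ∸ i)))
             (∑-cong (suc q) λ m _ → reflexive (≡.cong g (ℕₚ.+-comm (q ∸ i) m))))) ⟩
      ∑[ i < suc q ] (f i * (∑[ m < suc q ] g (m ℕ.+ (q ∸ i))))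
        ≈⟨ ∑-cong (suc q) (λ i _ → *-distribˡ-∑ (suc q) (f i) _) ⟩
      ∑[ i < suc q ] ∑[ m < suc q ] (f i * g (m ℕ.+ (q ∸ i)))
        ≈⟨ ∑-comm (suc q) (suc q) _ ⟩
      ∑ (suc q) conv
        ∎

    -- The shift passes from g to f by renumbering i; the term i = 0 becomes the last one, by
    -- periodicity of both sequences.
    conv-suc : ∀ m → conv (suc m) ≈ ∑[ i < suc q ] (f (suc i) * g (m ℕ.+ (q ∸ i)))
    conv-suc m = begin
      conv (suc m)
        ≈⟨ ∑-first q _ ⟩
      f 0 * g (suc m ℕ.+ q) + (∑[ i < q ] (f (suc i) * g (suc m ℕ.+ (q ∸ suc i))))
        ≈⟨ +-cong (*-cong wrap-f wrap-g) (∑-cong q λ i i<q → *-congˡ (reflexive (≡.cong g (inner i i<q)))) ⟩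
      f (suc q) * g (m ℕ.+ (q ∸ q)) + (∑[ i < q ] (f (suc i) * g (m ℕ.+ (q ∸ i))))
        ≈⟨ +-comm _ _ ⟩
      (∑[ i < q ] (f (suc i) * g (m ℕ.+ (q ∸ i)))) + f (suc q) * g (m ℕ.+ (q ∸ q))
        ≈⟨ ∑-last q _ ⟨
      ∑[ i < suc q ] (f (suc i) * g (m ℕ.+ (q ∸ i)))
        ∎
      where
      wrap-f : f 0 ≈ f (suc q)
      wrap-f = trans (sym (f-periodic 0)) (reflexive (≡.cong f (ℕₚ.+-identityʳ (suc q))))
      wrap-g : g (suc m ℕ.+ q) ≈ g (m ℕ.+ (q ∸ q))
      wrap-g = begin
        g (suc m ℕ.+ q)      ≡⟨ ≡.cong (g ∘ suc) (ℕₚ.+-comm m q) ⟩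
        g (suc q ℕ.+ m)      ≈⟨ g-periodic m ⟩
        g m                  ≡⟨ ≡.cong g (≡.trans (≡.cong (m ℕ.+_) (ℕₚ.n∸n≡0 q)) (ℕₚ.+-identityʳ m)) ⟨
        g (m ℕ.+ (q ∸ q))    ∎
      inner : ∀ i → i < q → suc m ℕ.+ (q ∸ suc i) ≡ m ℕ.+ (q ∸ i)
      inner i i<q = ≡.trans (≡.sym (ℕₚ.+-suc m (q ∸ suc i))) (≡.cong (m ℕ.+_) (≡.sym (ℕₚ.+-∸-assoc 1 i<q)))

    -- In conv (suc m) the shift is moved onto f, in s * conv (suc m) it stays on g. The recurrences
    -- then produce the factors x - i and y - (m + q - i), whose sum does not depend on i.
    conv-recurrence : ∀ m → (1# + s) * conv (suc m) ≈ ζ * ((x + y - ⌜ m ℕ.+ q ⌝) * conv m)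
    conv-recurrence m = begin
      (1# + s) * conv (suc m)
        ≈⟨ trans (distribʳ _ _ _) (+-congʳ (*-identityˡ _)) ⟩
      conv (suc m) + s * conv (suc m)
        ≈⟨ +-cong (trans (conv-suc m) (∑-cong (suc q) λ i _ → *-congʳ (f-suc i)))
                  (trans (*-distribˡ-∑ (suc q) s _) (∑-cong (suc q) λ i _ → push i)) ⟩
      (∑[ i < suc q ] (ζ * ((x - ⌜ i ⌝) * f i) * G i)) + (∑[ i < suc q ] (f i * (ζ * ((y - ⌜ m ℕ.+ (q ∸ i) ⌝) * G i))))
        ≈⟨ ∑-distrib-+ (suc q) _ _ ⟨
      ∑[ i < suc q ] (ζ * ((x - ⌜ i ⌝) * f i) * G i + f i * (ζ * ((y - ⌜ m ℕ.+ (q ∸ i) ⌝) * G i)))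
        ≈⟨ ∑-cong (suc q) (λ i i<p → trans
             (solve 5 (λ ζ a b f g → ζ :* (a :* f) :* g :+ f :* (ζ :* (b :* g)) := ζ :* (a :+ b) :* (f :* g))
               refl ζ (x - ⌜ i ⌝) _ (f i) (G i))
             (*-congʳ (*-congˡ (total i (ℕₚ.≤-pred i<p))))) ⟩
      ∑[ i < suc q ] (ζ * (x + y - ⌜ m ℕ.+ q ⌝) * (f i * G i))
        ≈⟨ *-distribˡ-∑ (suc q) _ _ ⟨
      ζ * (x + y - ⌜ m ℕ.+ q ⌝) * conv m
        ≈⟨ *-assoc _ _ _ ⟩
      ζ * ((x + y - ⌜ m ℕ.+ q ⌝) * conv m)
        ∎
      where
      G : ℕ → Carrier
      G i = g (m ℕ.+ (q ∸ i))
      push : ∀ i → s * (f i * g (suc m ℕ.+ (q ∸ i))) ≈ f i * (ζ * ((y - ⌜ m ℕ.+ (q ∸ i) ⌝) * G i))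
      push i = trans (solve 3 (λ s f g → s :* (f :* g) := f :* (s :* g)) refl s (f i) _)
        (*-congˡ (g-suc (m ℕ.+ (q ∸ i))))
      total : ∀ i → i ≤ q → (x - ⌜ i ⌝) + (y - ⌜ m ℕ.+ (q ∸ i) ⌝) ≈ x + y - ⌜ m ℕ.+ q ⌝
      total i i≤q = begin
        (x - ⌜ i ⌝) + (y - ⌜ m ℕ.+ (q ∸ i) ⌝)
          ≈⟨ solve 4 (λ x y a b → (x :+ a) :+ (y :+ b) := (x :+ y) :+ (a :+ b)) refl x y _ _ ⟩
        x + y + (- ⌜ i ⌝ - ⌜ m ℕ.+ (q ∸ i) ⌝)
          ≈⟨ +-congˡ (trans (-‿+-comm _ _) (-‿cong (sym (⌜⌝-+ i _)))) ⟩
        x + y - ⌜ i ℕ.+ (m ℕ.+ (q ∸ i)) ⌝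
          ≡⟨ ≡.cong (λ k → x + y - ⌜ k ⌝) (≡.trans (≡.sym (ℕₚ.+-assoc i m _))
               (≡.trans (≡.cong (ℕ._+ (q ∸ i)) (ℕₚ.+-comm i m))
                 (≡.trans (ℕₚ.+-assoc m i _) (≡.cong (m ℕ.+_) (ℕₚ.m+[n∸m]≡n i≤q))))) ⟩
        x + y - ⌜ m ℕ.+ q ⌝
          ∎

-- Inverses in a field, and the Newton form of x ^ p in characteristic p.

module FieldLemmas (K : DiscreteField) where
  open DiscreteField K using (_⁻¹; _≟_; 1≉0; ⁻¹-inverseʳ; invertible)
  open RingNotation (DiscreteField.commutativeRing K) hiding (∑; ∏)
  open RingLemmas (DiscreteField.commutativeRing K)
  open SetoidReasoning setoid

  infix 4 _≉0
  _≉0 : Carrier → Set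
  x ≉0 = ¬ (x ≈ 0#)

  unit⇒≉0 : ∀ {x y} → x * y ≈ 1# → x ≉0
  unit⇒≉0 xy≈1 x≈0 = 1≉0 (trans (sym xy≈1) (trans (*-congʳ x≈0) (zeroˡ _)))

  *-cancelˡ : ∀ {x y z} → x ≉0 → x * y ≈ x * z → y ≈ z
  *-cancelˡ {x} {y} {z} x≉0 xy≈xz = begin
    y                  ≈⟨ expand y ⟩
    x ⁻¹ * (x * y)     ≈⟨ *-congˡ xy≈xz ⟩
    x ⁻¹ * (x * z)     ≈⟨ expand z ⟨
    z                  ∎
    where
    expand : ∀ y → y ≈ x ⁻¹ * (x * y)
    expand y = sym (trans (sym (*-assoc _ _ _))
      (trans (*-congʳ (trans (*-comm _ _) (⁻¹-inverseʳ x x≉0))) (*-identityˡ y)))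

  *-cancelʳ : ∀ {x y z} → x ≉0 → y * x ≈ z * x → y ≈ z
  *-cancelʳ x≉0 yx≈zx = *-cancelˡ x≉0 (trans (*-comm _ _) (trans yx≈zx (*-comm _ _)))

  *-≉0 : ∀ {x y} → x ≉0 → y ≉0 → x * y ≉0
  *-≉0 x≉0 y≉0 xy≈0 = y≉0 (*-cancelˡ x≉0 (trans xy≈0 (sym (zeroʳ _))))

  ≉0-*ˡ : ∀ {x y} → x * y ≉0 → x ≉0
  ≉0-*ˡ xy≉0 x≈0 = xy≉0 (trans (*-congʳ x≈0) (zeroˡ _))

  ≉0-*ʳ : ∀ {x y} → x * y ≉0 → y ≉0
  ≉0-*ʳ xy≉0 y≈0 = xy≉0 (trans (*-congˡ y≈0) (zeroʳ _))

  ≉0-resp : ∀ {x y} → x ≈ y → x ≉0 → y ≉0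
  ≉0-resp x≈y x≉0 y≈0 = x≉0 (trans x≈y y≈0)

  ^-≉0 : ∀ {x} n → x ≉0 → x ^ n ≉0
  ^-≉0 zero    x≉0 = 1≉0
  ^-≉0 (suc n) x≉0 = *-≉0 x≉0 (^-≉0 n x≉0)

  ∏-≉0 : ∀ n {f} → (∀ k → k < n → f k ≉0) → ∏ n f ≉0
  ∏-≉0 zero    f≉0 = ≉0-resp (sym (∏-empty _)) 1≉0
  ∏-≉0 (suc n) f≉0 = ≉0-resp (sym (∏-first n _)) (*-≉0 (f≉0 0 (s≤s z≤n)) (∏-≉0 n λ k k<n → f≉0 (suc k) (s≤s k<n)))

  x^n≈0⇒x≈0 : ∀ n {x} → x ^ n ≈ 0# → x ≈ 0#
  x^n≈0⇒x≈0 n {x} x^n≈0 with x ≟ 0#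
  ... | yes x≈0 = x≈0
  ... | no  x≉0 = contradiction x^n≈0 (^-≉0 n x≉0)

  ⁻¹-unique : ∀ {x y} → x * y ≈ 1# → x ⁻¹ ≈ y
  ⁻¹-unique xy≈1 = *-cancelˡ (unit⇒≉0 xy≈1) (trans (⁻¹-inverseʳ _ (unit⇒≉0 xy≈1)) (sym xy≈1))

  ≈0⇒⁻¹≈0 : ∀ {x} → x ≈ 0# → x ⁻¹ ≈ 0#
  ≈0⇒⁻¹≈0 {x} x≈0 with x ≟ 0#
  ... | yes _  = refl
  ... | no x≉0 = contradiction x≈0 x≉0

  -- `_⁻¹` is defined by a decision about the given representative; that it respects `_≈_` comes
  -- from uniqueness of inverses.
  ⁻¹-cong : ∀ {x y} → x ≈ y → x ⁻¹ ≈ y ⁻¹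
  ⁻¹-cong {x} {y} x≈y with y ≟ 0#
  ... | yes y≈0 = ≈0⇒⁻¹≈0 (trans x≈y y≈0)
  ... | no  y≉0 = ⁻¹-unique (trans (*-congʳ x≈y) (proj₂ (invertible y y≉0)))

module FieldCharP (K : DiscreteField) (q : ℕ) (p-prime : Prime (suc q))
  (⌜p⌝≈0 : suc q ≈0in DiscreteField.commutativeRing K) where
  open DiscreteField K using (_⁻¹; 1≉0; ⁻¹-inverseʳ)
  open RingNotation (DiscreteField.commutativeRing K) hiding (∑; ∏)
  open RingLemmas (DiscreteField.commutativeRing K)
  open FieldLemmas K
  open CharP (DiscreteField.commutativeRing K) q p-prime ⌜p⌝≈0
  open HomLemmas (DiscreteField.commutativeRing K) (DiscreteField.commutativeRing K)
  open SetoidReasoning setoid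
  private
    p : ℕ
    p = suc q

  ⌜⌝-≉0 : ∀ n → 0 < n → n < p → ⌜ n ⌝ ≉0
  ⌜⌝-≉0 n 0<n n<p = unit⇒≉0 (proj₂ (⌜⌝-inverse n 0<n n<p))

  ⌜!⌝-≉0 : ∀ n → n < p → ⌜ n ! ⌝ ≉0
  ⌜!⌝-≉0 zero    _   = ≉0-resp (sym (+-identityʳ 1#)) 1≉0
  ⌜!⌝-≉0 (suc n) n<p = ≉0-resp (sym (⌜⌝-* (suc n) (n !)))
    (*-≉0 (⌜⌝-≉0 (suc n) (s≤s z≤n) n<p) (⌜!⌝-≉0 n (ℕₚ.<-trans (ℕₚ.n<1+n n) n<p)))

  -- Frobenius is additive, hence (x - y) ^ p = x ^ p - y ^ p, and a field has no nonzero
  -- nilpotents.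
  ^p-injective : ∀ {x y} → x ^ p ≈ y ^ p → x ≈ y
  ^p-injective {x} {y} x^p≈y^p = x-y≈0⇒x≈y x y
    (x^n≈0⇒x≈0 p (trans (hom-minus frobenius x y) (x≈y⇒x-y≈0 x^p≈y^p)))

  ⌜n⌝^q≈1 : ∀ n → 0 < n → n < p → ⌜ n ⌝ ^ q ≈ 1#
  ⌜n⌝^q≈1 n 0<n n<p = *-cancelˡ (⌜⌝-≉0 n 0<n n<p) (trans (⌜⌝^p n) (sym (*-identityʳ _)))

  -- The Stirling numbers S(p, j) with 1 < j < p vanish mod p: by Fermat's little theorem they
  -- solve a triangular system, obtained by evaluating the Newton expansion of x ^ p at 0, …, p - 1.
  x^p≈x+x↓p : ∀ x → x ^ p ≈ x + x ↓ p
  x^p≈x+x↓p x = trans (expansion x) (+-congˡ (trans (+-congʳ (∑-zero p λ j j<p →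
      trans (*-congʳ (c≈0 j j<p)) (zeroˡ _))) (+-identityˡ _)))
    where
    -- The coefficient at 1 is replaced by 0: since stirling p 1 = 1 and x ↓ 1 = x, its term is the
    -- x split off in front.
    c : ℕ → Carrier
    c 1 = 0#
    c j = ⌜ stirling p j ⌝
    -- Matching on r in place of q exposes the terms 0 and 1 of the sum; q = 0 would mean p = 1.
    split : ∀ r → r ≡ q → ∀ x → ∑[ j < suc r ] (⌜ stirling p j ⌝ * x ↓ j) ≈ x + (∑[ j < suc r ] (c j * x ↓ j))
    split zero    ≡.refl x = ⊥-elim (¬prime[1] p-prime)
    split (suc r) r≡q x = begin
      ∑[ j < 2 ℕ.+ r ] (⌜ stirling p j ⌝ * x ↓ j)
        ≈⟨ trans (∑-first (suc r) _) (+-congˡ (∑-first r _)) ⟩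
      c 0 * x ↓ 0 + (⌜ stirling p 1 ⌝ * x ↓ 1 + rest)
        ≈⟨ +-congˡ (+-congʳ (trans (*-cong (trans (reflexive (≡.cong ⌜_⌝ (stirling[1+n,1] q))) (+-identityʳ 1#)) x↓1) (*-identityˡ x))) ⟩
      c 0 * x ↓ 0 + (x + rest)
        ≈⟨ solve 3 (λ a x b → a :+ (x :+ b) := x :+ (a :+ b)) refl _ _ _ ⟩
      x + (c 0 * x ↓ 0 + rest)
        ≈⟨ +-congˡ (+-congˡ (trans (+-congʳ (zeroˡ _)) (+-identityˡ _))) ⟨
      x + (c 0 * x ↓ 0 + (c 1 * x ↓ 1 + rest))
        ≈⟨ +-congˡ (trans (∑-first (suc r) _) (+-congˡ (∑-first r _))) ⟨
      x + (∑[ j < 2 ℕ.+ r ] (c j * x ↓ j))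
        ∎
      where
      rest : Carrier
      rest = ∑[ j < r ] (⌜ stirling p (2 ℕ.+ j) ⌝ * x ↓ (2 ℕ.+ j))
      x↓1 : x ↓ 1 ≈ x
      x↓1 = trans (↓-suc′ x 0) (trans (*-congˡ (∏-empty _)) (*-identityʳ x))
    expansion : ∀ x → x ^ p ≈ x + ((∑[ j < p ] (c j * x ↓ j)) + x ↓ p)
    expansion x = begin
      x ^ p                                                              ≈⟨ ^-stirling x p ⟩
      ∑[ j < suc p ] (⌜ stirling p j ⌝ * x ↓ j)                          ≈⟨ ∑-last p _ ⟩
      (∑[ j < p ] (⌜ stirling p j ⌝ * x ↓ j)) + ⌜ stirling p p ⌝ * x ↓ p
        ≈⟨ +-cong (split q ≡.refl x) (trans (*-congʳ (trans (reflexive (≡.cong ⌜_⌝ (stirling[n,n] p))) (+-identityʳ 1#))) (*-identityˡ _)) ⟩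
      (x + (∑[ j < p ] (c j * x ↓ j))) + x ↓ p                           ≈⟨ +-assoc _ _ _ ⟩
      x + ((∑[ j < p ] (c j * x ↓ j)) + x ↓ p)                           ∎
    c≈0 : ∀ j → j < p → c j ≈ 0#
    c≈0 = triangular p (λ m j → ⌜ m ⌝ ↓ j) c
      (λ m j _ → m<n⇒⌜m⌝↓n≈0 m j)
      (λ m x m<p xm!≈0 → *-cancelʳ (≉0-resp (sym (⌜n⌝↓n≈⌜n!⌝ m)) (⌜!⌝-≉0 m m<p)) (trans xm!≈0 (sym (zeroˡ _))))
      (λ m m<p → begin
        ∑[ j < p ] (c j * ⌜ m ⌝ ↓ j)
          ≈⟨ trans (+-congˡ (m<n⇒⌜m⌝↓n≈0 m p m<p)) (+-identityʳ _) ⟨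
        (∑[ j < p ] (c j * ⌜ m ⌝ ↓ j)) + ⌜ m ⌝ ↓ p
          ≈⟨ [x+y]-y≈x _ ⌜ m ⌝ ⟨
        ((∑[ j < p ] (c j * ⌜ m ⌝ ↓ j)) + ⌜ m ⌝ ↓ p) + ⌜ m ⌝ - ⌜ m ⌝
          ≈⟨ +-congʳ (trans (+-comm _ _) (trans (sym (expansion ⌜ m ⌝)) (⌜⌝^p m))) ⟩
        ⌜ m ⌝ - ⌜ m ⌝
          ≈⟨ -‿inverseʳ _ ⟩
        0#
          ∎)

  -x≈-1*x : ∀ x → - x ≈ - 1# * x
  -x≈-1*x x = trans (-‿cong (sym (*-identityˡ x))) (-‿distribˡ-* 1# x)

  [-x]^k : ∀ x k → (- x) ^ k ≈ (- 1#) ^ k * x ^ k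
  [-x]^k x k = trans (^-congˡ k (-x≈-1*x x)) (^-distrib-* (- 1#) x k)

  -- Induction on k: the factor k + 1 gained by k! is minus the factor q - k lost by (q - k)!,
  -- because the two add up to p.
  k![q∸k]! : ∀ k → k ≤ q → ⌜ k ! ⌝ * ⌜ (q ∸ k) ! ⌝ ≈ (- 1#) ^ k * ⌜ q ! ⌝
  k![q∸k]! zero    _   = *-congʳ (+-identityʳ 1#)
  k![q∸k]! (suc k) k<q = begin
    ⌜ suc k ! ⌝ * ⌜ m ! ⌝
      ≈⟨ trans (*-congʳ (⌜⌝-* (suc k) (k !))) (*-congʳ (*-congʳ k≈-m)) ⟩
    - ⌜ suc m ⌝ * ⌜ k ! ⌝ * ⌜ m ! ⌝
      ≈⟨ *-congʳ (*-congʳ (-x≈-1*x _)) ⟩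
    - 1# * ⌜ suc m ⌝ * ⌜ k ! ⌝ * ⌜ m ! ⌝
      ≈⟨ solve 4 (λ e m k n → e :* m :* k :* n := e :* (k :* (m :* n))) refl (- 1#) ⌜ suc m ⌝ ⌜ k ! ⌝ ⌜ m ! ⌝ ⟩
    - 1# * (⌜ k ! ⌝ * (⌜ suc m ⌝ * ⌜ m ! ⌝))
      ≈⟨ *-congˡ (*-congˡ (⌜⌝-* (suc m) (m !))) ⟨
    - 1# * (⌜ k ! ⌝ * ⌜ suc m ! ⌝)
      ≡⟨ ≡.cong (λ n → - 1# * (⌜ k ! ⌝ * ⌜ n ! ⌝)) (ℕₚ.+-∸-assoc 1 k<q) ⟨
    - 1# * (⌜ k ! ⌝ * ⌜ (q ∸ k) ! ⌝)
      ≈⟨ *-congˡ (k![q∸k]! k (ℕₚ.<⇒≤ k<q)) ⟩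
    - 1# * ((- 1#) ^ k * ⌜ q ! ⌝)
      ≈⟨ *-assoc _ _ _ ⟨
    (- 1#) ^ suc k * ⌜ q ! ⌝
      ∎
    where
    m : ℕ
    m = q ∸ suc k
    k+m : ⌜ suc k ⌝ + ⌜ suc m ⌝ ≈ 0#
    k+m = begin
      ⌜ suc k ⌝ + ⌜ suc m ⌝      ≈⟨ ⌜⌝-+ (suc k) (suc m) ⟨
      ⌜ suc k ℕ.+ suc m ⌝
        ≡⟨ ≡.cong ⌜_⌝ (≡.trans (ℕₚ.+-suc (suc k) m) (≡.cong suc (ℕₚ.m+[n∸m]≡n k<q))) ⟩
      ⌜ p ⌝                      ≈⟨ ⌜p⌝≈0 ⟩
      0#                         ∎
    k≈-m : ⌜ suc k ⌝ ≈ - ⌜ suc m ⌝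
    k≈-m = inverseˡ-unique _ _ k+m
      where open GroupProperties +-group using (inverseˡ-unique)

  -- The sign is the one found in (-X) ^ k and (-1 / s) ^ k, so the terms of L and of b_{1,s} all
  -- get the constant 1 / (p - 1)!.
  k!⁻¹[q∸k]!⁻¹ : ∀ k → k ≤ q → ⌜ (q ∸ k) ! ⌝ ⁻¹ * ⌜ k ! ⌝ ⁻¹ * (- 1#) ^ k ≈ ⌜ q ! ⌝ ⁻¹
  k!⁻¹[q∸k]!⁻¹ k k≤q = sym (⁻¹-unique (begin
    ⌜ q ! ⌝ * (⌜ (q ∸ k) ! ⌝ ⁻¹ * ⌜ k ! ⌝ ⁻¹ * (- 1#) ^ k)
      ≈⟨ solve 4 (λ q a b e → q :* (a :* b :* e) := e :* q :* (b :* a)) refl _ _ _ _ ⟩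
    (- 1#) ^ k * ⌜ q ! ⌝ * (⌜ k ! ⌝ ⁻¹ * ⌜ (q ∸ k) ! ⌝ ⁻¹)
      ≈⟨ *-congʳ (k![q∸k]! k k≤q) ⟨
    ⌜ k ! ⌝ * ⌜ (q ∸ k) ! ⌝ * (⌜ k ! ⌝ ⁻¹ * ⌜ (q ∸ k) ! ⌝ ⁻¹)
      ≈⟨ solve 4 (λ a b c d → a :* b :* (c :* d) := a :* c :* (b :* d)) refl _ _ _ _ ⟩
    ⌜ k ! ⌝ * ⌜ k ! ⌝ ⁻¹ * (⌜ (q ∸ k) ! ⌝ * ⌜ (q ∸ k) ! ⌝ ⁻¹)
      ≈⟨ *-cong (⁻¹-inverseʳ _ (⌜!⌝-≉0 k (s≤s k≤q))) (⁻¹-inverseʳ _ (⌜!⌝-≉0 (q ∸ k) (s≤s (ℕₚ.m∸n≤m q k)))) ⟩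
    1# * 1#
      ≈⟨ *-identityˡ 1# ⟩
    1#
      ∎))

-- The functional equation of the Laguerre sums.

module LaguerreSums (R : CRing) (q : ℕ) where
  open RingNotation R hiding (∑; ∏)
  open RingLemmas R

  -- (p - 1)! times L^(α)(x), and (p - 1)! times b_{r,s} at γ, if σ = r / s, α = r γ, β = s γ.
  Lag : Carrier → Carrier → Carrier
  Lag α x = ∑[ k < suc q ] ((α - 1#) ↓ (q ∸ k) * x ^ k)

  bSum : Carrier → Carrier → Carrier → Carrier
  bSum σ α β = ∑[ k < suc q ] (σ ^ k * (α - 1#) ↓ (q ∸ k) * (β - 1#) ↓ k)

  Lag-cong : ∀ {α α′ x x′} → α ≈ α′ → x ≈ x′ → Lag α x ≈ Lag α′ x′
  Lag-cong α≈ x≈ = ∑-cong (suc q) λ k _ → *-cong (↓-cong (+-congʳ α≈) (q ∸ k)) (^-congˡ k x≈)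

  bSum-cong : ∀ {σ σ′ α α′ β β′} → σ ≈ σ′ → α ≈ α′ → β ≈ β′ → bSum σ α β ≈ bSum σ′ α′ β′
  bSum-cong σ≈ α≈ β≈ = ∑-cong (suc q) λ k _ →
    *-cong (*-cong (^-congˡ k σ≈) (↓-cong (+-congʳ α≈) (q ∸ k))) (↓-cong (+-congʳ β≈) k)

module FunctionalEquation (K : DiscreteField) (q : ℕ) (p-prime : Prime (suc q))
  (⌜p⌝≈0 : suc q ≈0in DiscreteField.commutativeRing K) where
  open DiscreteField K using (_⁻¹; ⁻¹-inverseʳ)
  open RingNotation (DiscreteField.commutativeRing K) hiding (∑; ∏)
  open RingLemmas (DiscreteField.commutativeRing K)
  open FieldLemmas K
  open CharP (DiscreteField.commutativeRing K) q p-prime ⌜p⌝≈0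
  open FieldCharP K q p-prime ⌜p⌝≈0
  open HomLemmas (DiscreteField.commutativeRing K) (DiscreteField.commutativeRing K)
  open LaguerreSums (DiscreteField.commutativeRing K) q
  open SetoidReasoning setoid
  private
    p : ℕ
    p = suc q

  -- Periodic mod p if (α ^ p - α) z ^ p = 1.
  A : Carrier → Carrier → ℕ → Carrier
  A α z i = (α - 1#) ↓ i * z ^ i

  A-suc : ∀ α z i → A α z (suc i) ≈ z * ((α - 1# - ⌜ i ⌝) * A α z i)
  A-suc α z i = trans (*-congʳ (↓-suc (α - 1#) i))
    (solve 4 (λ a b z w → a :* b :* (z :* w) := z :* (a :* (b :* w))) refl _ _ z (z ^ i))

  -- The Newton form of x ^ p at x = α - 1, together with (α - 1) ^ p = α ^ p - 1.
  [α-1]↓p : ∀ α → (α - 1#) ↓ p ≈ α ^ p - α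
  [α-1]↓p α = begin
    (α - 1#) ↓ p                       ≈⟨ [x+y]-y≈x _ α ⟨
    (α - 1#) ↓ p + α - α               ≈⟨ +-congʳ (begin
      (α - 1#) ↓ p + α                       ≈⟨ +-congˡ ([x-y]+y≈x α 1#) ⟨
      (α - 1#) ↓ p + (α - 1# + 1#)
        ≈⟨ solve 3 (λ a b c → a :+ (b :+ c) := (b :+ a) :+ c) refl _ _ _ ⟩
      (α - 1#) + (α - 1#) ↓ p + 1#           ≈⟨ +-congʳ (x^p≈x+x↓p (α - 1#)) ⟨
      (α - 1#) ^ p + 1#
        ≈⟨ +-congʳ (trans (hom-minus frobenius α 1#) (+-congˡ (-‿cong (1^ p)))) ⟩
      α ^ p - 1# + 1#                        ≈⟨ [x-y]+y≈x _ _ ⟩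
      α ^ p                                  ∎) ⟩
    α ^ p - α                          ∎

  ⌜m+p⌝≈⌜m⌝ : ∀ m → ⌜ m ℕ.+ p ⌝ ≈ ⌜ m ⌝
  ⌜m+p⌝≈⌜m⌝ m = trans (⌜⌝-+ m p) (trans (+-congˡ ⌜p⌝≈0) (+-identityʳ _))

  -- The factors of the falling factorial with numbers p + i and i agree in characteristic p.
  [α-1]↓-periodic : ∀ α i → (α - 1#) ↓ (p ℕ.+ i) ≈ (α ^ p - α) * (α - 1#) ↓ i
  [α-1]↓-periodic α zero    = begin
    (α - 1#) ↓ (p ℕ.+ 0)            ≡⟨ ≡.cong ((α - 1#) ↓_) (ℕₚ.+-identityʳ p) ⟩
    (α - 1#) ↓ p                    ≈⟨ [α-1]↓p α ⟩
    α ^ p - α                       ≈⟨ *-identityʳ _ ⟨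
    (α ^ p - α) * 1#                ≈⟨ *-congˡ (∏-empty _) ⟨
    (α ^ p - α) * (α - 1#) ↓ 0      ∎
  [α-1]↓-periodic α (suc i) = begin
    (α - 1#) ↓ (p ℕ.+ suc i)                               ≡⟨ ≡.cong ((α - 1#) ↓_) (ℕₚ.+-suc p i) ⟩
    (α - 1#) ↓ suc (p ℕ.+ i)                               ≈⟨ ↓-suc _ _ ⟩
    (α - 1# - ⌜ p ℕ.+ i ⌝) * (α - 1#) ↓ (p ℕ.+ i)          ≈⟨ *-cong
      (+-congˡ (-‿cong (trans (reflexive (≡.cong ⌜_⌝ (ℕₚ.+-comm p i))) (⌜m+p⌝≈⌜m⌝ i)))) ([α-1]↓-periodic α i) ⟩
    (α - 1# - ⌜ i ⌝) * ((α ^ p - α) * (α - 1#) ↓ i)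
      ≈⟨ solve 3 (λ a b c → a :* (b :* c) := b :* (a :* c)) refl _ _ _ ⟩
    (α ^ p - α) * ((α - 1# - ⌜ i ⌝) * (α - 1#) ↓ i)        ≈⟨ *-congˡ (↓-suc _ _) ⟨
    (α ^ p - α) * (α - 1#) ↓ suc i                         ∎

  A-periodic : ∀ {α x z} → x ^ p ≈ α ^ p - α → x * z ≈ 1# → ∀ i → A α z (p ℕ.+ i) ≈ A α z i
  A-periodic {α} {x} {z} x^p xz≈1 i = begin
    (α - 1#) ↓ (p ℕ.+ i) * z ^ (p ℕ.+ i)
      ≈⟨ *-cong ([α-1]↓-periodic α i) (^-homo-* z p i) ⟩
    (α ^ p - α) * (α - 1#) ↓ i * (z ^ p * z ^ i)
      ≈⟨ solve 4 (λ a b c d → a :* b :* (c :* d) := a :* c :* (b :* d)) refl _ _ _ _ ⟩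
    (α ^ p - α) * z ^ p * A α z i
      ≈⟨ *-congʳ (begin
           (α ^ p - α) * z ^ p   ≈⟨ *-congʳ x^p ⟨
           x ^ p * z ^ p         ≈⟨ ^-distrib-* x z p ⟨
           (x * z) ^ p           ≈⟨ ^-congˡ p xz≈1 ⟩
           1# ^ p                ≈⟨ 1^ p ⟩
           1#                    ∎) ⟩
    1# * A α z i
      ≈⟨ *-identityˡ _ ⟩
    A α z i
      ∎

  x^[q∸k] : ∀ {x z} → x * z ≈ 1# → ∀ {k} → k ≤ q → x ^ (q ∸ k) ≈ x ^ q * z ^ k
  x^[q∸k] {x} {z} xz≈1 {k} k≤q = begin
    x ^ (q ∸ k)                       ≈⟨ *-identityʳ _ ⟨
    x ^ (q ∸ k) * 1#
      ≈⟨ *-congˡ (trans (sym (^-distrib-* x z k)) (trans (^-congˡ k xz≈1) (1^ k))) ⟨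
    x ^ (q ∸ k) * (x ^ k * z ^ k)     ≈⟨ *-assoc _ _ _ ⟨
    x ^ (q ∸ k) * x ^ k * z ^ k       ≈⟨ *-congʳ (^-homo-* x (q ∸ k) k) ⟨
    x ^ (q ∸ k ℕ.+ k) * z ^ k         ≡⟨ ≡.cong (λ n → x ^ n * z ^ k) (ℕₚ.m∸n+n≡m k≤q) ⟩
    x ^ q * z ^ k                     ∎

  -- Reversing the sum makes k the length of the falling factorial, and x ^ (q - k) is x ^ q z ^ k.
  Lag≈x^q*∑A : ∀ {α x z} → x * z ≈ 1# → Lag α x ≈ x ^ q * ∑ p (A α z)
  Lag≈x^q*∑A {α} {x} {z} xz≈1 = begin
    Lag α x
      ≈⟨ ∑-reverse q _ ⟩
    ∑[ k < p ] ((α - 1#) ↓ (q ∸ (q ∸ k)) * x ^ (q ∸ k))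
      ≈⟨ ∑-cong p (λ k k<p → trans
           (*-cong (reflexive (≡.cong ((α - 1#) ↓_) (ℕₚ.m∸[m∸n]≡n (ℕₚ.≤-pred k<p)))) (x^[q∸k] xz≈1 (ℕₚ.≤-pred k<p)))
           (solve 3 (λ a b c → a :* (b :* c) := b :* (a :* c)) refl _ _ _)) ⟩
    ∑[ k < p ] (x ^ q * A α z k)
      ≈⟨ *-distribˡ-∑ p _ _ ⟨
    x ^ q * ∑ p (A α z)
      ∎

  scaled : ∀ {α x} n → x ^ p ≈ α ^ p - α → (⌜ n ⌝ * x) ^ p ≈ (⌜ n ⌝ * α) ^ p - ⌜ n ⌝ * α
  scaled {α} {x} n x^p = trans (⌜n⌝*-^p n x) (trans (*-congˡ x^p) (sym (⌜n⌝*-℘ n α)))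

  -- `conv` and h satisfy the same first order recurrence, which determines the next value because s
  -- + 1 is invertible; so `conv` is `conv 0` times h, and `conv 0` is ζ ^ q times the b-sum. Of the
  -- two factors x ^ q one cancels ζ ^ q, the other belongs to the Laguerre sum on the right.
  Lag-mult : ∀ {α x} → x ^ p ≈ α ^ p - α → x ≉0 → ∀ s → 0 < s → suc s < p →
    Lag α x * Lag (⌜ s ⌝ * α) (⌜ s ⌝ * x) ≈
    bSum (⌜ s ⌝ ⁻¹) α (⌜ s ⌝ * α) * Lag (⌜ suc s ⌝ * α) (⌜ suc s ⌝ * x)
  Lag-mult {α} {x} x^p x≉0 s 0<s r<p = begin
    Lag α x * Lag (⌜ s ⌝ * α) (⌜ s ⌝ * x)
      ≈⟨ *-cong (Lag≈x^q*∑A xζ≈1) (Lag≈ s 0<s s<p) ⟩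
    x ^ q * ∑ p f * (x ^ q * ∑ p g)
      ≈⟨ solve 3 (λ x f g → x :* f :* (x :* g) := x :* (x :* (f :* g))) refl _ _ _ ⟩
    x ^ q * (x ^ q * (∑ p f * ∑ p g))
      ≈⟨ *-congˡ (*-congˡ (trans ∑f*∑g (trans (∑-cong p λ m _ → conv≈ m) (sym (*-distribˡ-∑ p _ _))))) ⟩
    x ^ q * (x ^ q * (conv 0 * ∑ p h))
      ≈⟨ *-congˡ (*-congˡ (*-congʳ conv0)) ⟩
    x ^ q * (x ^ q * (ζ ^ q * B * ∑ p h))
      ≈⟨ solve 4 (λ x z b h → x :* (x :* (z :* b :* h)) := x :* z :* (b :* (x :* h))) refl _ _ _ _ ⟩
    x ^ q * ζ ^ q * (B * (x ^ q * ∑ p h))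
      ≈⟨ trans (*-congʳ (trans (sym (^-distrib-* x ζ q)) (trans (^-congˡ q xζ≈1) (1^ q)))) (*-identityˡ _) ⟩
    B * (x ^ q * ∑ p h)
      ≈⟨ *-congˡ (Lag≈ (suc s) (s≤s z≤n) r<p) ⟨
    B * Lag (⌜ suc s ⌝ * α) (⌜ suc s ⌝ * x)
      ∎
    where
    s<p : s < p
    s<p = ℕₚ.<-trans (ℕₚ.n<1+n s) r<p
    ζ σ ρ B : Carrier
    ζ = x ⁻¹
    σ = ⌜ s ⌝ ⁻¹
    ρ = ⌜ suc s ⌝ ⁻¹
    B = bSum σ α (⌜ s ⌝ * α)
    xζ≈1 : x * ζ ≈ 1#
    xζ≈1 = ⁻¹-inverseʳ x x≉0
    scaled-unit : ∀ n → 0 < n → n < p → ⌜ n ⌝ * x * (ζ * ⌜ n ⌝ ⁻¹) ≈ 1#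
    scaled-unit n 0<n n<p = begin
      ⌜ n ⌝ * x * (ζ * ⌜ n ⌝ ⁻¹)
        ≈⟨ solve 4 (λ n x z m → n :* x :* (z :* m) := n :* m :* (x :* z)) refl _ _ _ _ ⟩
      ⌜ n ⌝ * ⌜ n ⌝ ⁻¹ * (x * ζ)    ≈⟨ *-cong (⁻¹-inverseʳ _ (⌜⌝-≉0 n 0<n n<p)) xζ≈1 ⟩
      1# * 1#                       ≈⟨ *-identityˡ 1# ⟩
      1#                            ∎
    -- The power (n x) ^ q is just x ^ q, since n ^ q = 1 by Fermat's little theorem.
    Lag≈ : ∀ n → 0 < n → n < p → Lag (⌜ n ⌝ * α) (⌜ n ⌝ * x) ≈ x ^ q * ∑ p (A (⌜ n ⌝ * α) (ζ * ⌜ n ⌝ ⁻¹))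
    Lag≈ n 0<n n<p = trans (Lag≈x^q*∑A (scaled-unit n 0<n n<p))
      (*-congʳ (trans (^-distrib-* _ _ q) (trans (*-congʳ (⌜n⌝^q≈1 n 0<n n<p)) (*-identityˡ _))))
    f g h : ℕ → Carrier
    f = A α ζ
    g = A (⌜ s ⌝ * α) (ζ * σ)
    h = A (⌜ suc s ⌝ * α) (ζ * ρ)
    unscale : ∀ n → 0 < n → n < p → ∀ a → ⌜ n ⌝ * (ζ * ⌜ n ⌝ ⁻¹ * a) ≈ ζ * a
    unscale n 0<n n<p a = begin
      ⌜ n ⌝ * (ζ * ⌜ n ⌝ ⁻¹ * a)
        ≈⟨ solve 4 (λ n z m a → n :* (z :* m :* a) := n :* m :* (z :* a)) refl _ _ _ _ ⟩
      ⌜ n ⌝ * ⌜ n ⌝ ⁻¹ * (ζ * a)    ≈⟨ trans (*-congʳ (⁻¹-inverseʳ _ (⌜⌝-≉0 n 0<n n<p))) (*-identityˡ _) ⟩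
      ζ * a                         ∎
    open CyclicConvolution.Convolution (DiscreteField.commutativeRing K) q
      {x = α - 1#} {y = ⌜ s ⌝ * α - 1#} {ζ = ζ} {s = ⌜ s ⌝} {f = f} {g = g}
      (A-suc α ζ)
      (λ i → trans (*-congˡ (A-suc _ _ i)) (unscale s 0<s s<p _))
      (A-periodic x^p xζ≈1)
      (A-periodic (scaled s x^p) (scaled-unit s 0<s s<p))
    -- Of the two subtracted units one remains, and the other completes m + q to m + p.
    total : ∀ m → (α - 1#) + (⌜ s ⌝ * α - 1#) - ⌜ m ℕ.+ q ⌝ ≈ ⌜ suc s ⌝ * α - 1# - ⌜ m ⌝
    total m = begin
      (α - 1#) + (⌜ s ⌝ * α - 1#) - ⌜ m ℕ.+ q ⌝
        ≈⟨ solve 4 (λ a b o c → (a :+ o) :+ (b :+ o) :+ c := (a :+ b) :+ o :+ (o :+ c)) refl α (⌜ s ⌝ * α) (- 1#) (- ⌜ m ℕ.+ q ⌝) ⟩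
      (α + ⌜ s ⌝ * α) - 1# + (- 1# - ⌜ m ℕ.+ q ⌝)
        ≈⟨ +-cong (+-congʳ (trans (+-congʳ (sym (*-identityˡ α))) (sym (distribʳ _ _ _)))) (-‿+-comm 1# _) ⟩
      ⌜ suc s ⌝ * α - 1# - ⌜ suc (m ℕ.+ q) ⌝
        ≈⟨ +-congˡ (-‿cong (trans (reflexive (≡.cong ⌜_⌝ (≡.sym (ℕₚ.+-suc m q)))) (⌜m+p⌝≈⌜m⌝ m))) ⟩
      ⌜ suc s ⌝ * α - 1# - ⌜ m ⌝
        ∎
    conv≈ : ∀ m → conv m ≈ conv 0 * h m
    conv≈ zero    = sym (trans (*-congˡ (trans (*-congʳ (∏-empty _)) (*-identityˡ _))) (*-identityʳ _))
    conv≈ (suc m) = *-cancelˡ (⌜⌝-≉0 (suc s) (s≤s z≤n) r<p) (begin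
      ⌜ suc s ⌝ * conv (suc m)
        ≈⟨ conv-recurrence m ⟩
      ζ * (((α - 1#) + (⌜ s ⌝ * α - 1#) - ⌜ m ℕ.+ q ⌝) * conv m)
        ≈⟨ *-congˡ (*-cong (total m) (conv≈ m)) ⟩
      ζ * ((⌜ suc s ⌝ * α - 1# - ⌜ m ⌝) * (conv 0 * h m))
        ≈⟨ solve 4 (λ z a c h → z :* (a :* (c :* h)) := c :* (z :* (a :* h))) refl _ _ _ _ ⟩
      conv 0 * (ζ * ((⌜ suc s ⌝ * α - 1# - ⌜ m ⌝) * h m))
        ≈⟨ *-congˡ (trans (*-congˡ (A-suc _ _ m)) (unscale (suc s) (s≤s z≤n) r<p _)) ⟨
      conv 0 * (⌜ suc s ⌝ * h (suc m))
        ≈⟨ solve 3 (λ a b c → a :* (b :* c) := b :* (a :* c)) refl _ _ _ ⟩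
      ⌜ suc s ⌝ * (conv 0 * h (suc m))
        ∎)
    -- At m = 0 the indices i and q - i add up to q, which gives ζ a constant exponent; `bSum` has
    -- the terms in reverse order.
    conv0 : conv 0 ≈ ζ ^ q * B
    conv0 = begin
      ∑[ i < p ] (f i * g (q ∸ i))
        ≈⟨ ∑-cong p (λ i i<p → conv0-term i (ℕₚ.≤-pred i<p)) ⟩
      ∑[ i < p ] (ζ ^ q * (σ ^ (q ∸ i) * (α - 1#) ↓ (q ∸ (q ∸ i)) * (⌜ s ⌝ * α - 1#) ↓ (q ∸ i)))
        ≈⟨ *-distribˡ-∑ p _ _ ⟨
      ζ ^ q * (∑[ i < p ] (σ ^ (q ∸ i) * (α - 1#) ↓ (q ∸ (q ∸ i)) * (⌜ s ⌝ * α - 1#) ↓ (q ∸ i)))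
        ≈⟨ *-congˡ (∑-reverse q _) ⟨
      ζ ^ q * B
        ∎
      where
      conv0-term : ∀ i → i ≤ q → f i * g (q ∸ i) ≈
        ζ ^ q * (σ ^ (q ∸ i) * (α - 1#) ↓ (q ∸ (q ∸ i)) * (⌜ s ⌝ * α - 1#) ↓ (q ∸ i))
      conv0-term i i≤q = begin
        (α - 1#) ↓ i * ζ ^ i * ((⌜ s ⌝ * α - 1#) ↓ (q ∸ i) * (ζ * σ) ^ (q ∸ i))
          ≈⟨ *-congˡ (*-congˡ (^-distrib-* ζ σ (q ∸ i))) ⟩
        (α - 1#) ↓ i * ζ ^ i * ((⌜ s ⌝ * α - 1#) ↓ (q ∸ i) * (ζ ^ (q ∸ i) * σ ^ (q ∸ i)))
          ≈⟨ solve 5 (λ a z b y s → a :* z :* (b :* (y :* s)) := z :* y :* (s :* a :* b)) refl _ _ _ _ _ ⟩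
        ζ ^ i * ζ ^ (q ∸ i) * (σ ^ (q ∸ i) * (α - 1#) ↓ i * (⌜ s ⌝ * α - 1#) ↓ (q ∸ i))
          ≈⟨ *-cong (trans (sym (^-homo-* ζ i (q ∸ i))) (reflexive (≡.cong (ζ ^_) (ℕₚ.m+[n∸m]≡n i≤q))))
               (*-congʳ (*-congˡ (reflexive (≡.cong ((α - 1#) ↓_) (≡.sym (ℕₚ.m∸[m∸n]≡n i≤q)))))) ⟩
        ζ ^ q * (σ ^ (q ∸ i) * (α - 1#) ↓ (q ∸ (q ∸ i)) * (⌜ s ⌝ * α - 1#) ↓ (q ∸ i))
          ∎

-- Applied to Frobenius, to the embedding of polynomials in fractions and to evaluation at 0.
module LaguerreHom (R S : CRing) (q : ℕ) where
  private
    module R where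
      open RingNotation R public hiding (∑; ∏)
      open RingLemmas R public
      open LaguerreSums R q public
    module S where
      open RingNotation S public hiding (∑; ∏)
      open RingLemmas S public
      open LaguerreSums S q public
  open HomLemmas R S

  module _ {φ} (φ-hom : IsHom R S φ) where
    open IsRingHomomorphism φ-hom

    hom-[x-1]↓ : ∀ x n → φ ((x R.- R.1#) R.↓ n) S.≈ (φ x S.- S.1#) S.↓ n
    hom-[x-1]↓ x n = S.trans (hom-↓ φ-hom _ n)
      (S.↓-cong (S.trans (hom-minus φ-hom _ _) (S.+-congˡ (S.-‿cong 1#-homo))) n)

    hom-Lag : ∀ α x → φ (R.Lag α x) S.≈ S.Lag (φ α) (φ x)
    hom-Lag α x = S.trans (hom-∑ φ-hom (suc q) _) (S.∑-cong (suc q) λ k _ →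
      S.trans (*-homo _ _) (S.*-cong (hom-[x-1]↓ α (q ∸ k)) (hom-^ φ-hom x k)))

    hom-bSum : ∀ σ α β → φ (R.bSum σ α β) S.≈ S.bSum (φ σ) (φ α) (φ β)
    hom-bSum σ α β = S.trans (hom-∑ φ-hom (suc q) _) (S.∑-cong (suc q) λ k _ →
      S.trans (*-homo _ _) (S.*-cong
        (S.trans (*-homo _ _) (S.*-cong (hom-^ φ-hom σ k) (hom-[x-1]↓ α (q ∸ k)))) (hom-[x-1]↓ β k)))

-- Powers of E, and the resulting identity between the coefficients of G.

module PowerFormula (K : DiscreteField) (q : ℕ) (p-prime : Prime (suc q))
  (⌜p⌝≈0 : suc q ≈0in DiscreteField.commutativeRing K) where
  open DiscreteField K using (_⁻¹; ⁻¹-inverseʳ)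
  private
    Kʳ = DiscreteField.commutativeRing K
  open RingNotation Kʳ hiding (∑; ∏)
  open RingLemmas Kʳ
  open FieldLemmas K
  open CharP Kʳ q p-prime ⌜p⌝≈0
  open FieldCharP K q p-prime ⌜p⌝≈0
  open HomLemmas Kʳ Kʳ
  open LaguerreSums Kʳ q
  open LaguerreHom Kʳ Kʳ q
  open FunctionalEquation K q p-prime ⌜p⌝≈0
  open SetoidReasoning setoid
  private
    p : ℕ
    p = suc q

  w : Carrier
  w = ⌜ q ! ⌝ ⁻¹

  -- b s, B n and E u are b_{1,s}, the product of b_{1,s} over 0 < s < n, and L^(u ^ p)(u ^ p - u).
  b : ℕ → Carrier → Carrier
  b s γ = w * bSum (⌜ s ⌝ ⁻¹) γ (⌜ s ⌝ * γ)

  B : ℕ → Carrier → Carrier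
  B n γ = ∏[ i < n ∸ 1 ] b (suc i) γ

  E : Carrier → Carrier
  E u = w * Lag (u ^ p) (u ^ p - u)

  E-cong : ∀ {u v} → u ≈ v → E u ≈ E v
  E-cong u≈v = *-congˡ (Lag-cong (^-congˡ p u≈v) (+-cong (^-congˡ p u≈v) (-‿cong u≈v)))

  [⌜n⌝⁻¹]^p : ∀ n → ⌜ n ⌝ ≉0 → (⌜ n ⌝ ⁻¹) ^ p ≈ ⌜ n ⌝ ⁻¹
  [⌜n⌝⁻¹]^p n n≉0 = sym (⁻¹-unique (begin
    ⌜ n ⌝ * (⌜ n ⌝ ⁻¹) ^ p        ≈⟨ *-congʳ (⌜⌝^p n) ⟨
    ⌜ n ⌝ ^ p * (⌜ n ⌝ ⁻¹) ^ p    ≈⟨ ^-distrib-* _ _ p ⟨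
    (⌜ n ⌝ * ⌜ n ⌝ ⁻¹) ^ p        ≈⟨ ^-congˡ p (⁻¹-inverseʳ _ n≉0) ⟩
    1# ^ p                        ≈⟨ 1^ p ⟩
    1#                            ∎))

  -- The coefficients of b_{1,s} come from F_p and are fixed by Frobenius, which therefore acts on γ
  -- alone.
  b-^p : ∀ s → 0 < s → s < p → ∀ γ → b s γ ^ p ≈ b s (γ ^ p)
  b-^p s 0<s s<p γ = begin
    (w * bSum (⌜ s ⌝ ⁻¹) γ (⌜ s ⌝ * γ)) ^ p
      ≈⟨ ^-distrib-* _ _ p ⟩
    w ^ p * bSum (⌜ s ⌝ ⁻¹) γ (⌜ s ⌝ * γ) ^ p
      ≈⟨ *-cong ([⌜n⌝⁻¹]^p (q !) (⌜!⌝-≉0 q (ℕₚ.n<1+n q))) (hom-bSum frobenius _ _ _) ⟩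
    w * bSum ((⌜ s ⌝ ⁻¹) ^ p) (γ ^ p) ((⌜ s ⌝ * γ) ^ p)
      ≈⟨ *-congˡ (bSum-cong ([⌜n⌝⁻¹]^p s (⌜⌝-≉0 s 0<s s<p)) refl (⌜n⌝*-^p s γ)) ⟩
    b s (γ ^ p)
      ∎

  -- `Lag-mult` at α = u ^ p and x = u ^ p - u, where x ^ p = α ^ p - α by additivity of Frobenius.
  E-mult : ∀ {u} → u ^ p - u ≉0 → ∀ s → 0 < s → suc s < p →
           E u * E (⌜ s ⌝ * u) ≈ b s u ^ p * E (⌜ suc s ⌝ * u)
  E-mult {u} x≉0 s 0<s r<p = begin
    E u * E (⌜ s ⌝ * u)
      ≈⟨ *-congˡ (E⌜ s ⌝) ⟩
    w * Lag α x * (w * Lag (⌜ s ⌝ * α) (⌜ s ⌝ * x))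
      ≈⟨ solve 3 (λ w f g → w :* f :* (w :* g) := w :* (w :* (f :* g))) refl _ _ _ ⟩
    w * (w * (Lag α x * Lag (⌜ s ⌝ * α) (⌜ s ⌝ * x)))
      ≈⟨ *-congˡ (*-congˡ (Lag-mult (hom-minus frobenius α u) x≉0 s 0<s r<p)) ⟩
    w * (w * (bSum (⌜ s ⌝ ⁻¹) α (⌜ s ⌝ * α) * Lag (⌜ suc s ⌝ * α) (⌜ suc s ⌝ * x)))
      ≈⟨ solve 3 (λ w f g → w :* (w :* (f :* g)) := w :* f :* (w :* g)) refl _ _ _ ⟩
    b s α * (w * Lag (⌜ suc s ⌝ * α) (⌜ suc s ⌝ * x))
      ≈⟨ *-cong (b-^p s 0<s (ℕₚ.<-trans (ℕₚ.n<1+n s) r<p) u) (E⌜ suc s ⌝) ⟨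
    b s u ^ p * E (⌜ suc s ⌝ * u)
      ∎
    where
    α x : Carrier
    α = u ^ p
    x = u ^ p - u
    E⌜_⌝ : ∀ n → E (⌜ n ⌝ * u) ≈ w * Lag (⌜ n ⌝ * α) (⌜ n ⌝ * x)
    E⌜ n ⌝ = *-congˡ (Lag-cong (⌜n⌝*-^p n u) (⌜n⌝*-℘ n u))

  E-^ : ∀ {u} → u ^ p - u ≉0 → ∀ n → 0 < n → n < p → E u ^ n ≈ B n u ^ p * E (⌜ n ⌝ * u)
  E-^ {u} x≉0 (suc zero)    _ _   = begin
    E u * 1#                       ≈⟨ *-comm _ _ ⟩
    1# * E u
      ≈⟨ *-cong (trans (^-congˡ p (∏-empty _)) (1^ p)) (E-cong (trans (*-congʳ (+-identityʳ 1#)) (*-identityˡ u))) ⟨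
    B 1 u ^ p * E (⌜ 1 ⌝ * u)      ∎
  E-^ {u} x≉0 (suc m@(suc n)) _ r<p = begin
    E u * E u ^ m
      ≈⟨ *-congˡ (E-^ x≉0 m (s≤s z≤n) (ℕₚ.<-trans (ℕₚ.n<1+n m) r<p)) ⟩
    E u * (B m u ^ p * E (⌜ m ⌝ * u))
      ≈⟨ solve 3 (λ a b c → a :* (b :* c) := b :* (a :* c)) refl _ _ _ ⟩
    B m u ^ p * (E u * E (⌜ m ⌝ * u))
      ≈⟨ *-congˡ (E-mult x≉0 m (s≤s z≤n) r<p) ⟩
    B m u ^ p * (b m u ^ p * E (⌜ suc m ⌝ * u))
      ≈⟨ *-assoc _ _ _ ⟨
    B m u ^ p * b m u ^ p * E (⌜ suc m ⌝ * u)
      ≈⟨ *-congʳ (trans (^-congˡ p (∏-last n _)) (^-distrib-* _ _ p)) ⟨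
    B (suc m) u ^ p * E (⌜ suc m ⌝ * u)
      ∎

  ^p-comm : ∀ x k → (x ^ p) ^ k ≈ (x ^ k) ^ p
  ^p-comm x k = trans (^-assocʳ x p k) (trans (reflexive (≡.cong (x ^_) (ℕₚ.*-comm p k))) (sym (^-assocʳ x k p)))

  module _ {α : Carrier} (℘α≉0 : α ^ p - α ≉0) (Eα≉0 : E α ≉0) where

    -- `E-^` exhibits B_n(α) ^ p as a factor of E(α) ^ n, which is nonzero.
    B≉0 : ∀ n → 0 < n → n < p → B n α ≉0
    B≉0 n 0<n n<p B≈0 = ≉0-*ˡ (≉0-resp (E-^ ℘α≉0 n 0<n n<p) (^-≉0 n Eα≉0))
      (trans (^-congˡ p B≈0) (0^ q))

  module _ {α : Carrier} (℘α≉0 : α ^ p - α ≉0) (Eα≉0 : E α ≉0)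
           (h : ℕ) (0<h : 0 < h) (h<p : h < p) (Ehα≉0 : E (⌜ h ⌝ * α) ≉0)
           (k : ℕ) (0<k : 0 < k) (k<p : k < p) where
    private
      j d : ℕ
      j = h ℕ.* k % p
      d = h ℕ.* k / p

      0<j : 0 < j
      0<j = ℕₚ.n≢0⇒n>0 λ j≡0 → [ ℕ∣.>⇒∤ {{ℕ.>-nonZero 0<h}} h<p , ℕ∣.>⇒∤ {{ℕ.>-nonZero 0<k}} k<p ]′
        (euclidsLemma h k p-prime (ℕ∣.m%n≡0⇒n∣m (h ℕ.* k) p j≡0))

      j<p : j < p
      j<p = m%n<n (h ℕ.* k) p

      ⌜j⌝≈⌜h⌝⌜k⌝ : ⌜ j ⌝ ≈ ⌜ h ⌝ * ⌜ k ⌝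
      ⌜j⌝≈⌜h⌝⌜k⌝ = trans (⌜n%p⌝≈⌜n⌝ (h ℕ.* k)) (⌜⌝-* h k)

      ℘hα≉0 : (⌜ h ⌝ * α) ^ p - ⌜ h ⌝ * α ≉0
      ℘hα≉0 = ≉0-resp (sym (⌜n⌝*-℘ h α)) (*-≉0 (⌜⌝-≉0 h 0<h h<p) ℘α≉0)

    -- After raising to the power p and multiplying by E(jα), both sides are E(α) ^ (h k): the left
    -- one through E(hα) ^ k and k (h α) = j α, the right one through h k = d p + j.
    B-product : B h α ^ k * B k (⌜ h ⌝ * α) ≈ E α ^ d * B j α
    B-product = ^p-injective (*-cancelʳ Ejα≉0 (begin
      (B h α ^ k * B k hα) ^ p * E (⌜ j ⌝ * α)
        ≈⟨ *-cong (^-distrib-* _ _ p) (E-cong (trans (*-congʳ (trans ⌜j⌝≈⌜h⌝⌜k⌝ (*-comm _ _))) (*-assoc _ _ _))) ⟩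
      (B h α ^ k) ^ p * B k hα ^ p * E (⌜ k ⌝ * hα)
        ≈⟨ trans (*-assoc _ _ _) (*-cong (sym (^p-comm _ k)) (sym (E-^ ℘hα≉0 k 0<k k<p))) ⟩
      (B h α ^ p) ^ k * E hα ^ k
        ≈⟨ trans (sym (^-distrib-* _ _ k)) (^-congˡ k (sym (E-^ ℘α≉0 h 0<h h<p))) ⟩
      (E α ^ h) ^ k
        ≈⟨ trans (^-assocʳ _ h k) (reflexive (≡.cong (E α ^_) (≡.trans (m≡m%n+[m/n]*n (h ℕ.* k) p) (ℕₚ.+-comm j _)))) ⟩
      E α ^ (d ℕ.* p ℕ.+ j)
        ≈⟨ trans (^-homo-* _ (d ℕ.* p) j) (*-cong (sym (^-assocʳ _ d p)) (E-^ ℘α≉0 j 0<j j<p)) ⟩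
      (E α ^ d) ^ p * (B j α ^ p * E (⌜ j ⌝ * α))
        ≈⟨ trans (sym (*-assoc _ _ _)) (*-congʳ (sym (^-distrib-* _ _ p))) ⟩
      (E α ^ d * B j α) ^ p * E (⌜ j ⌝ * α)
        ∎))
      where
      hα : Carrier
      hα = ⌜ h ⌝ * α
      Ejα≉0 : E (⌜ j ⌝ * α) ≉0
      Ejα≉0 = ≉0-*ʳ (≉0-resp (E-^ ℘α≉0 j 0<j j<p) (^-≉0 j Eα≉0))

    -- `B-product` inverted, combined with 1 / k = h / j, which is j = h k in characteristic p.
    coefficient-identity :
      ⌜ k ⌝ ⁻¹ * (E α ^ d * ((B h α ⁻¹) ^ k * B k (⌜ h ⌝ * α) ⁻¹)) ≈ ⌜ h ⌝ * (⌜ j ⌝ ⁻¹ * B j α ⁻¹)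
    coefficient-identity = begin
      ⌜ k ⌝ ⁻¹ * (E α ^ d * (β ^ k * β′))     ≈⟨ *-cong k⁻¹ B⁻¹ ⟩
      ⌜ h ⌝ * ⌜ j ⌝ ⁻¹ * B j α ⁻¹             ≈⟨ *-assoc _ _ _ ⟩
      ⌜ h ⌝ * (⌜ j ⌝ ⁻¹ * B j α ⁻¹)           ∎
      where
      β β′ : Carrier
      β  = B h α ⁻¹
      β′ = B k (⌜ h ⌝ * α) ⁻¹
      k⁻¹ : ⌜ k ⌝ ⁻¹ ≈ ⌜ h ⌝ * ⌜ j ⌝ ⁻¹
      k⁻¹ = ⁻¹-unique (begin
        ⌜ k ⌝ * (⌜ h ⌝ * ⌜ j ⌝ ⁻¹)    ≈⟨ solve 3 (λ k h j → k :* (h :* j) := h :* k :* j) refl _ _ _ ⟩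
        ⌜ h ⌝ * ⌜ k ⌝ * ⌜ j ⌝ ⁻¹      ≈⟨ *-congʳ ⌜j⌝≈⌜h⌝⌜k⌝ ⟨
        ⌜ j ⌝ * ⌜ j ⌝ ⁻¹              ≈⟨ ⁻¹-inverseʳ _ (⌜⌝-≉0 j 0<j j<p) ⟩
        1#                            ∎)
      B⁻¹ : E α ^ d * (β ^ k * β′) ≈ B j α ⁻¹
      B⁻¹ = sym (⁻¹-unique (begin
        B j α * (E α ^ d * (β ^ k * β′))
          ≈⟨ solve 3 (λ b e c → b :* (e :* c) := e :* b :* c) refl _ _ _ ⟩
        E α ^ d * B j α * (β ^ k * β′)
          ≈⟨ *-congʳ B-product ⟨
        B h α ^ k * B k (⌜ h ⌝ * α) * (β ^ k * β′)
          ≈⟨ solve 4 (λ a b c d → a :* b :* (c :* d) := a :* c :* (b :* d)) refl _ _ _ _ ⟩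
        B h α ^ k * β ^ k * (B k (⌜ h ⌝ * α) * β′)
          ≈⟨ *-cong (trans (sym (^-distrib-* _ _ k)) (trans (^-congˡ k (⁻¹-inverseʳ _ (B≉0 ℘α≉0 Eα≉0 h 0<h h<p))) (1^ k)))
               (⁻¹-inverseʳ _ (B≉0 ℘hα≉0 Ehα≉0 k 0<k k<p)) ⟩
        1# * 1#
          ≈⟨ *-identityˡ 1# ⟩
        1#
          ∎))

-- Congruences in a ring, and evaluation of polynomials.

module Modular (R : CRing) (m : CommutativeRing.Carrier R) where
  open RingNotation R hiding (∑; ∏)
  open RingLemmas R
  open SemiringDivisibility semiring using (_,_)
  open SetoidReasoning setoid

  mod-reflexive : ∀ {f g} → f ≈ g → f ≡ g [mod m ]
  mod-reflexive f≈g = 0# , trans (zeroˡ m) (sym (x≈y⇒x-y≈0 f≈g))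

  mod-trans : ∀ {f g h} → f ≡ g [mod m ] → g ≡ h [mod m ] → f ≡ h [mod m ]
  mod-trans {f} {g} {h} (a , am≈f-g) (b , bm≈g-h) = a + b , (begin
    (a + b) * m          ≈⟨ distribʳ _ _ _ ⟩
    a * m + b * m        ≈⟨ +-cong am≈f-g bm≈g-h ⟩
    (f - g) + (g - h)    ≈⟨ +-assoc _ _ _ ⟨
    (f - g) + g - h      ≈⟨ +-congʳ ([x-y]+y≈x f g) ⟩
    f - h                ∎)

  mod-+ : ∀ {f g f′ g′} → f ≡ g [mod m ] → f′ ≡ g′ [mod m ] → f + f′ ≡ g + g′ [mod m ]
  mod-+ {f} {g} {f′} {g′} (a , am≈f-g) (b , bm≈f′-g′) = a + b , (begin
    (a + b) * m                ≈⟨ distribʳ _ _ _ ⟩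
    a * m + b * m              ≈⟨ +-cong am≈f-g bm≈f′-g′ ⟩
    (f - g) + (f′ - g′)
      ≈⟨ solve 4 (λ f g h k → (f :+ g) :+ (h :+ k) := (f :+ h) :+ (g :+ k)) refl f (- g) f′ (- g′) ⟩
    (f + f′) + (- g - g′)      ≈⟨ +-congˡ (-‿+-comm g g′) ⟩
    (f + f′) - (g + g′)        ∎)

  mod-neg : ∀ {f g} → f ≡ g [mod m ] → - f ≡ - g [mod m ]
  mod-neg {f} {g} (a , am≈f-g) = - a , (begin
    - a * m        ≈⟨ -‿distribˡ-* _ _ ⟨
    - (a * m)      ≈⟨ -‿cong am≈f-g ⟩
    - (f - g)      ≈⟨ -‿+-comm f (- g) ⟨
    - f - - g      ∎)

  mod-*ˡ : ∀ c {f g} → f ≡ g [mod m ] → c * f ≡ c * g [mod m ]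
  mod-*ˡ c (a , am≈f-g) = c * a , trans (*-assoc _ _ _) (trans (*-congˡ am≈f-g) (x[y-z]≈xy-xz _ _ _))

  mod-^ : ∀ {f g} → f ≡ g [mod m ] → ∀ n → f ^ n ≡ g ^ n [mod m ]
  mod-^ f≡g zero    = mod-reflexive refl
  mod-^ {f} {g} f≡g (suc n) = mod-trans (mod-*ˡ f (mod-^ f≡g n))
    (mod-trans (mod-reflexive (*-comm _ _)) (mod-trans (mod-*ˡ (g ^ n) f≡g) (mod-reflexive (*-comm _ _))))

  mod-∑ : ∀ n {f g} → (∀ k → k < n → f k ≡ g k [mod m ]) → ∑ n f ≡ ∑ n g [mod m ]
  mod-∑ zero    f≡g = mod-reflexive (trans (∑-empty _) (sym (∑-empty _)))
  mod-∑ (suc n) f≡g = mod-trans (mod-reflexive (∑-first n _)) (mod-trans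
    (mod-+ (f≡g 0 (s≤s z≤n)) (mod-∑ n λ k k<n → f≡g (suc k) (s≤s k<n))) (mod-reflexive (sym (∑-first n _))))

module Evaluation (R S : CRing) {φ : CommutativeRing.Carrier R → CommutativeRing.Carrier S}
                  (φ-hom : IsHom R S φ) (x : CommutativeRing.Carrier S) where
  private
    module R where
      open CommutativeRing R public
      open PolynomialBase R public
    module S = CommutativeRing S
    module R[X] = CommutativeRing (R [X])
    open NatSolver S.commutativeSemiring using (solve; _:=_; _:+_; _:*_)
  open IsRingHomomorphism φ-hom
  open SetoidReasoning S.setoid

  private
    ⟦_⟧ : R.Poly → S.Carrier
    ⟦_⟧ = eval R S φ x

    absorb : ∀ a f → a S.≈ S.0# → a S.+ x S.* f S.≈ x S.* f
    absorb a f a≈0 = S.trans (S.+-congʳ a≈0) (S.+-identityˡ _)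

    -- A list equal to [] may still consist of zeros, so this case of `eval-cong` takes its own
    -- induction.
    eval-≈0 : ∀ f → f R.≈ᴾ [] → ⟦ f ⟧ S.≈ S.0#
    eval-≈0 []      f≈0 = S.refl
    eval-≈0 (a ∷ f) f≈0 = S.trans (absorb _ _ (S.trans (⟦⟧-cong (R.coeff≈ f≈0 0)) 0#-homo))
      (S.trans (S.*-congˡ (eval-≈0 f (R.coeffwise λ n → R.coeff≈ f≈0 (suc n)))) (S.zeroʳ x))

    eval-cong : ∀ f g → f R.≈ᴾ g → ⟦ f ⟧ S.≈ ⟦ g ⟧
    eval-cong []      g       f≈g = S.sym (eval-≈0 g (R[X].sym {[]} {g} f≈g))
    eval-cong (a ∷ f) []      f≈g = eval-≈0 (a ∷ f) f≈g
    eval-cong (a ∷ f) (b ∷ g) f≈g = S.+-cong (⟦⟧-cong (R.coeff≈ f≈g 0))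
      (S.*-congˡ (eval-cong f g (R.coeffwise λ n → R.coeff≈ f≈g (suc n))))

    eval-+ : ∀ f g → ⟦ f R.+ᴾ g ⟧ S.≈ ⟦ f ⟧ S.+ ⟦ g ⟧
    eval-+ []      g       = S.sym (S.+-identityˡ _)
    eval-+ (a ∷ f) []      = S.sym (S.+-identityʳ _)
    eval-+ (a ∷ f) (b ∷ g) = begin
      φ (a R.+ b) S.+ x S.* ⟦ f R.+ᴾ g ⟧
        ≈⟨ S.+-cong (+-homo a b) (S.*-congˡ (eval-+ f g)) ⟩
      φ a S.+ φ b S.+ x S.* (⟦ f ⟧ S.+ ⟦ g ⟧)
        ≈⟨ solve 5 (λ a b x f g → a :+ b :+ x :* (f :+ g) :=
                                                                (a :+ x :* f) :+ (b :+ x :* g)) S.refl _ _ _ _ _ ⟩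
      (φ a S.+ x S.* ⟦ f ⟧) S.+ (φ b S.+ x S.* ⟦ g ⟧)      ∎

    eval-· : ∀ a f → ⟦ a R.· f ⟧ S.≈ φ a S.* ⟦ f ⟧
    eval-· a []      = S.sym (S.zeroʳ _)
    eval-· a (b ∷ f) = begin
      φ (a R.* b) S.+ x S.* ⟦ a R.· f ⟧          ≈⟨ S.+-cong (*-homo a b) (S.*-congˡ (eval-· a f)) ⟩
      φ a S.* φ b S.+ x S.* (φ a S.* ⟦ f ⟧)
        ≈⟨ solve 4 (λ a b x f → a :* b :+ x :* (a :* f) := a :* (b :+ x :* f)) S.refl _ _ _ _ ⟩
      φ a S.* (φ b S.+ x S.* ⟦ f ⟧)              ∎

    eval-* : ∀ f g → ⟦ f R.*ᴾ g ⟧ S.≈ ⟦ f ⟧ S.* ⟦ g ⟧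
    eval-* []      g = S.sym (S.zeroˡ _)
    eval-* (a ∷ f) g = begin
      ⟦ a R.· g R.+ᴾ (R.0# ∷ (f R.*ᴾ g)) ⟧           ≈⟨ eval-+ (a R.· g) _ ⟩
      ⟦ a R.· g ⟧ S.+ ⟦ R.0# ∷ (f R.*ᴾ g) ⟧
        ≈⟨ S.+-cong (eval-· a g) (S.trans (absorb _ _ 0#-homo) (S.*-congˡ (eval-* f g))) ⟩
      φ a S.* ⟦ g ⟧ S.+ x S.* (⟦ f ⟧ S.* ⟦ g ⟧)
        ≈⟨ solve 4 (λ a g x f → a :* g :+ x :* (f :* g) := (a :+ x :* f) :* g) S.refl _ _ _ _ ⟩
      (φ a S.+ x S.* ⟦ f ⟧) S.* ⟦ g ⟧                ∎

  eval-C : ∀ a → eval R S φ x (R.C a) S.≈ φ a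
  eval-C a = S.trans (S.+-congˡ (S.zeroʳ x)) (S.+-identityʳ _)

  eval-X : eval R S φ x R.X S.≈ x
  eval-X = begin
    φ R.0# S.+ x S.* (φ R.1# S.+ x S.* S.0#)   ≈⟨ absorb _ _ 0#-homo ⟩
    x S.* (φ R.1# S.+ x S.* S.0#)              ≈⟨ S.*-congˡ (S.trans (eval-C R.1#) 1#-homo) ⟩
    x S.* S.1#                                 ≈⟨ S.*-identityʳ x ⟩
    x                                          ∎

  eval-hom : IsHom (R [X]) S (eval R S φ x)
  eval-hom = HomLemmas.mkHom (R [X]) S _ (eval-cong _ _) eval-+ eval-* (S.trans (eval-C R.1#) 1#-homo)

C-hom : (R : CRing) → IsHom R (R [X]) (PolynomialBase.C R)
C-hom R = HomLemmas.mkHom R (R [X]) C (λ a≈b → ∷-cong a≈b (coeffwise λ _ → refl))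
  (λ _ _ → coeffwise λ _ → refl)
  (λ _ _ → ∷-cong (sym (+-identityʳ _)) (coeffwise λ _ → refl))
  (coeffwise λ _ → refl)
  where
  open CommutativeRing R
  open PolynomialBase R

-- Multiplication by h on residues, and the congruence term by term.

module Reindexing (K : DiscreteField) (q : ℕ) (p-prime : Prime (suc q))
  (⌜p⌝≈0 : suc q ≈0in DiscreteField.commutativeRing K)
  (h : ℕ) (0<h : 0 < h) (h<p : h < suc q) where
  private
    Kʳ = DiscreteField.commutativeRing K
    p : ℕ
    p = suc q
  open RingNotation Kʳ hiding (∑; ∏)
  open RingLemmas Kʳ
  open FieldLemmas K
  open CharP Kʳ q p-prime ⌜p⌝≈0
  open FieldCharP K q p-prime ⌜p⌝≈0
  open SetoidReasoning setoid

  private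
    m<n⇒⌜m⌝≉⌜n⌝ : ∀ {m n} → m < n → n < p → ¬ (⌜ m ⌝ ≈ ⌜ n ⌝)
    m<n⇒⌜m⌝≉⌜n⌝ {m} {n} m<n n<p m≈n = ⌜⌝-≉0 (n ∸ m) (ℕₚ.m<n⇒0<n∸m m<n) (ℕₚ.≤-<-trans (ℕₚ.m∸n≤m n m) n<p) (begin
      ⌜ n ∸ m ⌝                        ≈⟨ [x+y]-y≈x _ ⌜ m ⌝ ⟨
      ⌜ n ∸ m ⌝ + ⌜ m ⌝ - ⌜ m ⌝
        ≈⟨ +-congʳ (trans (sym (⌜⌝-+ (n ∸ m) m)) (reflexive (≡.cong ⌜_⌝ (ℕₚ.m∸n+n≡m (ℕₚ.<⇒≤ m<n))))) ⟩
      ⌜ n ⌝ - ⌜ m ⌝                    ≈⟨ x≈y⇒x-y≈0 (sym m≈n) ⟩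
      0#                               ∎)

    -- Allows equalities of residues mod p to be verified by ring computations in K.
    ⌜⌝-injective : ∀ {m n} → m < p → n < p → ⌜ m ⌝ ≈ ⌜ n ⌝ → m ≡ n
    ⌜⌝-injective {m} {n} m<p n<p m≈n with ℕₚ.<-cmp m n
    ... | tri< m<n _ _ = contradiction m≈n (m<n⇒⌜m⌝≉⌜n⌝ m<n n<p)
    ... | tri≈ _ m≡n _ = m≡n
    ... | tri> _ _ n<m = contradiction (sym m≈n) (m<n⇒⌜m⌝≉⌜n⌝ n<m m<p)

    ⌜⌝-^ : ∀ m n → ⌜ m ℕ.^ n ⌝ ≈ ⌜ m ⌝ ^ n
    ⌜⌝-^ m zero    = +-identityʳ 1#
    ⌜⌝-^ m (suc n) = trans (⌜⌝-* m (m ℕ.^ n)) (*-congˡ (⌜⌝-^ m n))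

    -- Inverse to h mod p by Fermat's little theorem.
    h′ : ℕ
    h′ = h ℕ.^ (q ∸ 1)

    ⌜h⌝⌜h′⌝≈1 : ⌜ h ⌝ * ⌜ h′ ⌝ ≈ 1#
    ⌜h⌝⌜h′⌝≈1 = begin
      ⌜ h ⌝ * ⌜ h′ ⌝              ≈⟨ *-congˡ (⌜⌝-^ h (q ∸ 1)) ⟩
      ⌜ h ⌝ ^ suc (q ∸ 1)         ≡⟨ ≡.cong (⌜ h ⌝ ^_) (ℕₚ.m+[n∸m]≡n (ℕₚ.<-≤-trans 0<h (ℕₚ.≤-pred h<p))) ⟩
      ⌜ h ⌝ ^ q                   ≈⟨ ⌜n⌝^q≈1 h 0<h h<p ⟩
      1#                          ∎

    inverse : ∀ m n → ⌜ m ⌝ * ⌜ n ⌝ ≈ 1# → ∀ k → k < p → m ℕ.* (n ℕ.* k % p) % p ≡ k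
    inverse m n mn≈1 k k<p = ⌜⌝-injective (m%n<n (m ℕ.* (n ℕ.* k % p)) p) k<p (begin
      ⌜ m ℕ.* (n ℕ.* k % p) % p ⌝     ≈⟨ trans (⌜n%p⌝≈⌜n⌝ (m ℕ.* (n ℕ.* k % p))) (⌜⌝-* m (n ℕ.* k % p)) ⟩
      ⌜ m ⌝ * ⌜ n ℕ.* k % p ⌝         ≈⟨ *-congˡ (trans (⌜n%p⌝≈⌜n⌝ (n ℕ.* k)) (⌜⌝-* n k)) ⟩
      ⌜ m ⌝ * (⌜ n ⌝ * ⌜ k ⌝)         ≈⟨ trans (sym (*-assoc _ _ _)) (*-congʳ mn≈1) ⟩
      1# * ⌜ k ⌝                      ≈⟨ *-identityˡ _ ⟩
      ⌜ k ⌝                           ∎)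

  module _ (M : CommutativeMonoid 0ℓ 0ℓ) where
    open BigOperator M

    -- Multiplication by h′ is the inverse permutation. The monoid is arbitrary because the sums to
    -- be permuted lie in the polynomial ring, not in K.
    big-*% : ∀ f → CommutativeMonoid._≈_ M (big p (λ k → f (h ℕ.* k % p))) (big p f)
    big-*% = big-permute p (λ k → h ℕ.* k % p) (λ k → h′ ℕ.* k % p)
      (λ k _ → m%n<n (h ℕ.* k) p) (λ k _ → m%n<n (h′ ℕ.* k) p)
      (inverse h h′ ⌜h⌝⌜h′⌝≈1) (inverse h′ h (trans (*-comm _ _) ⌜h⌝⌜h′⌝≈1))

-- P with C and X plays the role of the polynomial ring over K.
module CongruenceModXᵖ (K : DiscreteField) (q : ℕ) (p-prime : Prime (suc q))
  (⌜p⌝≈0 : suc q ≈0in DiscreteField.commutativeRing K)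
  (P : CRing) {C : DiscreteField.Carrier K → CommutativeRing.Carrier P}
  (C-hom : IsHom (DiscreteField.commutativeRing K) P C) (X : CommutativeRing.Carrier P) where
  private
    Kʳ = DiscreteField.commutativeRing K
    p : ℕ
    p = suc q
    module K where
      open DiscreteField K public using (_⁻¹)
      open RingNotation Kʳ public hiding (∑; ∏)
      open RingLemmas Kʳ public
      open FieldLemmas K public
      open PowerFormula K q p-prime ⌜p⌝≈0 public
  open RingNotation P hiding (∑; ∏)
  open RingLemmas P
  open HomLemmas Kʳ P
  open IsRingHomomorphism C-hom using () renaming (*-homo to C-*; ⟦⟧-cong to C-cong; 0#-homo to C-0)
  open SetoidReasoning setoid

  module _ {α : K.Carrier} (℘α≉0 : α K.^ p K.- α K.≉0) (Eα≉0 : K.E α K.≉0)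
           (h : ℕ) (0<h : 0 < h) (h<p : h < p) (Ehα≉0 : K.E (K.⌜ h ⌝ K.* α) K.≉0) where
    private
      β : K.Carrier
      β = K.B h α K.⁻¹
      modulus : Carrier
      modulus = X ^ p - C (K.E α)
    open Modular P modulus

    lhs-term rhs-term : ℕ → Carrier
    lhs-term k = C (K.⌜ k ⌝ K.⁻¹) * ((X ^ h * C β) ^ k * C (K.B k (K.⌜ h ⌝ K.* α) K.⁻¹))
    rhs-term k = C (K.⌜ k ⌝ K.⁻¹) * (X ^ k * C (K.B k α K.⁻¹))

    -- The totalised inverse of 0 is 0. Hence the sums may include k = 0 and range over all residues
    -- mod p.
    term-0 : ∀ {f} → C (K.⌜ 0 ⌝ K.⁻¹) * f ≈ 0#
    term-0 = trans (*-congʳ (trans (C-cong (K.≈0⇒⁻¹≈0 K.refl)) C-0)) (zeroˡ _)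

    X^p≡C : X ^ p ≡ C (K.E α) [mod modulus ]
    X^p≡C = 1# , *-identityˡ _
      where open SemiringDivisibility semiring using (_,_)

    -- (X ^ h) ^ k is X ^ j (X ^ p) ^ d, where X ^ p may be replaced by E(α); `coefficient-identity`
    -- then matches the constants.
    term≡ : ∀ k → k < p → lhs-term k ≡ ⌜ h ⌝ * rhs-term (h ℕ.* k % p) [mod modulus ]
    term≡ zero    _   rewrite ℕₚ.*-zeroʳ h = mod-reflexive
      (trans term-0 (sym (trans (*-congˡ term-0) (zeroʳ _))))
    term≡ k@(suc _) k<p = mod-trans (mod-reflexive expand)
      (mod-trans (mod-*ˡ _ (mod-^ X^p≡C d)) (mod-reflexive collect))
      where
      j d : ℕ
      j = h ℕ.* k % p
      d = h ℕ.* k / p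
      β′ : K.Carrier
      β′ = K.B k (K.⌜ h ⌝ K.* α) K.⁻¹
      a : Carrier
      a = X ^ j * C (K.⌜ k ⌝ K.⁻¹ K.* (β K.^ k K.* β′))
      X^hk : (X ^ h) ^ k ≈ X ^ j * (X ^ p) ^ d
      X^hk = begin
        (X ^ h) ^ k               ≈⟨ ^-assocʳ X h k ⟩
        X ^ (h ℕ.* k)
          ≡⟨ ≡.cong (X ^_) (≡.trans (m≡m%n+[m/n]*n (h ℕ.* k) p) (≡.cong (j ℕ.+_) (ℕₚ.*-comm d p))) ⟩
        X ^ (j ℕ.+ p ℕ.* d)       ≈⟨ ^-homo-* X j (p ℕ.* d) ⟩
        X ^ j * X ^ (p ℕ.* d)     ≈⟨ *-congˡ (^-assocʳ X p d) ⟨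
        X ^ j * (X ^ p) ^ d       ∎
      expand : lhs-term k ≈ a * (X ^ p) ^ d
      expand = begin
        C (K.⌜ k ⌝ K.⁻¹) * ((X ^ h * C β) ^ k * C β′)
          ≈⟨ *-congˡ (*-congʳ (trans (^-distrib-* _ _ k) (*-cong X^hk (sym (hom-^ C-hom β k))))) ⟩
        C (K.⌜ k ⌝ K.⁻¹) * (X ^ j * (X ^ p) ^ d * C (β K.^ k) * C β′)
          ≈⟨ solve 5 (λ k x y b c → k :* (x :* y :* b :* c) := x :* (k :* (b :* c)) :* y) refl _ _ _ _ _ ⟩
        X ^ j * (C (K.⌜ k ⌝ K.⁻¹) * (C (β K.^ k) * C β′)) * (X ^ p) ^ d
          ≈⟨ *-congʳ (*-congˡ (trans (C-* _ _) (*-congˡ (C-* _ _)))) ⟨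
        a * (X ^ p) ^ d
          ∎
      collect : a * C (K.E α) ^ d ≈ ⌜ h ⌝ * rhs-term j
      collect = begin
        X ^ j * C (K.⌜ k ⌝ K.⁻¹ K.* (β K.^ k K.* β′)) * C (K.E α) ^ d
          ≈⟨ *-congˡ (hom-^ C-hom (K.E α) d) ⟨
        X ^ j * C (K.⌜ k ⌝ K.⁻¹ K.* (β K.^ k K.* β′)) * C (K.E α K.^ d)
          ≈⟨ trans (*-assoc _ _ _) (*-congˡ (sym (C-* _ _))) ⟩
        X ^ j * C (K.⌜ k ⌝ K.⁻¹ K.* (β K.^ k K.* β′) K.* K.E α K.^ d)
          ≈⟨ *-congˡ (C-cong (K.trans (K.solve 3 (λ k b e → k K.:* b K.:* e K.:= k K.:* (e K.:* b)) K.refl _ _ _)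
               (K.coefficient-identity ℘α≉0 Eα≉0 h 0<h h<p Ehα≉0 k (s≤s z≤n) k<p))) ⟩
        X ^ j * C (K.⌜ h ⌝ K.* (K.⌜ j ⌝ K.⁻¹ K.* K.B j α K.⁻¹))
          ≈⟨ *-congˡ (trans (C-* _ _) (*-cong (hom-⌜⌝ C-hom h) (C-* _ _))) ⟩
        X ^ j * (⌜ h ⌝ * (C (K.⌜ j ⌝ K.⁻¹) * C (K.B j α K.⁻¹)))
          ≈⟨ solve 4 (λ x h j b → x :* (h :* (j :* b)) := h :* (j :* (x :* b))) refl _ _ _ _ ⟩
        ⌜ h ⌝ * rhs-term j
          ∎

    sum≡ : - ∑ q (lhs-term ∘ suc) ≡ ⌜ h ⌝ * - ∑ q (rhs-term ∘ suc) [mod modulus ]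
    sum≡ = mod-trans (mod-neg
      (mod-trans (mod-reflexive (from0 lhs-term term-0))
      (mod-trans (mod-∑ p term≡)
      (mod-reflexive (begin
        ∑[ k < p ] (⌜ h ⌝ * rhs-term (h ℕ.* k % p))      ≈⟨ *-distribˡ-∑ p _ _ ⟨
        ⌜ h ⌝ * (∑[ k < p ] rhs-term (h ℕ.* k % p))
          ≈⟨ *-congˡ (Reindexing.big-*% K q p-prime ⌜p⌝≈0 h 0<h h<p +-commutativeMonoid rhs-term) ⟩
        ⌜ h ⌝ * ∑ p rhs-term                             ≈⟨ *-congˡ (from0 rhs-term term-0) ⟨
        ⌜ h ⌝ * ∑ q (rhs-term ∘ suc)                     ∎)))))
      (mod-reflexive (-‿distribʳ-* _ _))
      where
      from0 : ∀ f → f 0 ≈ 0# → ∑ q (f ∘ suc) ≈ ∑ p f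
      from0 f f0≈0 = sym (trans (∑-first q f) (trans (+-congʳ f0≈0) (+-identityˡ _)))

-- Comparison of the given b and L with the division-free sums.

module Specialisation (K : DiscreteField) (q : ℕ) (p-prime : Prime (suc q))
  (⌜p⌝≈0 : suc q ≈0in DiscreteField.commutativeRing K)
  (A : CRing) where
  private
    Kʳ = DiscreteField.commutativeRing K
    p : ℕ
    p = suc q
    module A where
      open RingNotation A public
      open RingLemmas A using (∏-def; ∑-def; _↓_) public
  open DiscreteField K using (_⁻¹)
  open RingNotation Kʳ hiding (∑; ∏)
  open RingLemmas Kʳ
  open FieldCharP K q p-prime ⌜p⌝≈0
  open LaguerreSums Kʳ q
  open PowerFormula K q p-prime ⌜p⌝≈0 using (b; w)
  open HomLemmas A Kʳ
  open SetoidReasoning setoid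

  -- `c n` abstracts the constant 1 / n!, whose factorial is invertible for n < p; ψ abstracts the
  -- substitution of γ for α.
  module At {ψ : A.Carrier → Carrier} (ψ-hom : IsHom A Kʳ ψ)
            (c : ℕ → A.Carrier) (ψ-c : ∀ n → n < suc q → ψ (c n) ≈ ⌜ n ! ⌝ ⁻¹)
            (α : A.Carrier) {γ : Carrier} (ψ-α : ψ α ≈ γ) where
    open IsRingHomomorphism ψ-hom

    binomial : A.Carrier → ℕ → A.Carrier
    binomial x m = (A.∏ 0 m λ i → x A.- A.⌜ i ⌝) A.* c m

    ψ-binomial : ∀ {x y} m → m < p → ψ x ≈ y → ψ (binomial x m) ≈ y ↓ m * ⌜ m ! ⌝ ⁻¹
    ψ-binomial {x} {y} m m<p ψx≈y = begin
      ψ ((A.∏ 0 m λ i → x A.- A.⌜ i ⌝) A.* c m)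
        ≈⟨ *-homo _ _ ⟩
      ψ (A.∏ 0 m λ i → x A.- A.⌜ i ⌝) * ψ (c m)
        ≈⟨ *-cong (⟦⟧-cong (A.∏-def m (λ i → x A.- A.⌜ i ⌝))) (ψ-c m m<p) ⟩
      ψ (x A.↓ m) * ⌜ m ! ⌝ ⁻¹
        ≈⟨ *-congʳ (trans (hom-↓ ψ-hom x m) (↓-cong ψx≈y m)) ⟩
      y ↓ m * ⌜ m ! ⌝ ⁻¹
        ∎

    ψ-[x-1] : ∀ {x y} → ψ x ≈ y → ψ (x A.- A.1#) ≈ y - 1#
    ψ-[x-1] ψx≈y = trans (hom-minus ψ-hom _ _) (+-cong ψx≈y (-‿cong 1#-homo))

    ψ-⌜n⌝α : ∀ n → ψ (A.⌜ n ⌝ A.* α) ≈ ⌜ n ⌝ * γ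
    ψ-⌜n⌝α n = trans (*-homo _ _) (*-cong (hom-⌜⌝ ψ-hom n) ψ-α)

    ψ-b : ∀ s t → ψ t ≈ - ⌜ s ⌝ ⁻¹ →
      ψ (A.∑ 0 p λ k → t A.^ k A.* binomial (A.⌜ 1 ⌝ A.* α A.- A.1#) (q ∸ k) A.* binomial (A.⌜ s ⌝ A.* α A.- A.1#) k)
      ≈ b s γ
    ψ-b s t ψt≈-σ = begin
      ψ (A.∑ 0 p f)              ≈⟨ ⟦⟧-cong (A.∑-def p f) ⟩
      ψ (RingLemmas.∑ A p f)     ≈⟨ hom-∑ ψ-hom p f ⟩
      ∑ p (ψ ∘ f)                ≈⟨ ∑-cong p (λ k k<p → term k (ℕₚ.≤-pred k<p)) ⟩
      ∑[ k < p ] (w * (σ ^ k * (γ - 1#) ↓ (q ∸ k) * (⌜ s ⌝ * γ - 1#) ↓ k)) ≈⟨ *-distribˡ-∑ p w _ ⟨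
      b s γ                      ∎
      where
      σ : Carrier
      σ = ⌜ s ⌝ ⁻¹
      f : ℕ → A.Carrier
      f k = t A.^ k A.* binomial (A.⌜ 1 ⌝ A.* α A.- A.1#) (q ∸ k) A.* binomial (A.⌜ s ⌝ A.* α A.- A.1#) k
      ψ-⌜1⌝α : ψ (A.⌜ 1 ⌝ A.* α) ≈ γ
      ψ-⌜1⌝α = trans (ψ-⌜n⌝α 1) (trans (*-congʳ (+-identityʳ 1#)) (*-identityˡ γ))
      term : ∀ k → k ≤ q → ψ (f k) ≈ w * (σ ^ k * (γ - 1#) ↓ (q ∸ k) * (⌜ s ⌝ * γ - 1#) ↓ k)
      term k k≤q = begin
        ψ (f k)
          ≈⟨ trans (*-homo _ _) (*-congʳ (*-homo _ _)) ⟩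
        ψ (t A.^ k) * ψ (binomial (A.⌜ 1 ⌝ A.* α A.- A.1#) (q ∸ k)) * ψ (binomial (A.⌜ s ⌝ A.* α A.- A.1#) k)
          ≈⟨ *-cong (*-cong
               (trans (hom-^ ψ-hom t k) (trans (^-congˡ k ψt≈-σ) ([-x]^k σ k)))
               (ψ-binomial (q ∸ k) (s≤s (ℕₚ.m∸n≤m q k)) (ψ-[x-1] ψ-⌜1⌝α)))
               (ψ-binomial k (s≤s k≤q) (ψ-[x-1] (ψ-⌜n⌝α s))) ⟩
        (- 1#) ^ k * σ ^ k * ((γ - 1#) ↓ (q ∸ k) * ⌜ (q ∸ k) ! ⌝ ⁻¹) * ((⌜ s ⌝ * γ - 1#) ↓ k * ⌜ k ! ⌝ ⁻¹)
          ≈⟨ solve 6 (λ e s x a y b → e :* s :* (x :* a) :* (y :* b) := a :* b :* e :* (s :* x :* y)) refl _ _ _ _ _ _ ⟩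
        ⌜ (q ∸ k) ! ⌝ ⁻¹ * ⌜ k ! ⌝ ⁻¹ * (- 1#) ^ k * (σ ^ k * (γ - 1#) ↓ (q ∸ k) * (⌜ s ⌝ * γ - 1#) ↓ k)
          ≈⟨ *-congʳ (k!⁻¹[q∸k]!⁻¹ k k≤q) ⟩
        w * (σ ^ k * (γ - 1#) ↓ (q ∸ k) * (⌜ s ⌝ * γ - 1#) ↓ k)
          ∎

    module _ (Q : CRing) {ε : CommutativeRing.Carrier Q → Carrier} (ε-hom : IsHom Q Kʳ ε)
             (C : A.Carrier → CommutativeRing.Carrier Q) (ε-C : ∀ a → ε (C a) ≈ ψ a)
             (X : CommutativeRing.Carrier Q) {x : Carrier} (ε-X : ε X ≈ x) where
      private
        module Q where
          open RingNotation Q public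
          open RingLemmas Q using (∑-def) public
        module ε = IsRingHomomorphism ε-hom

      ε-L : ε (Q.∑ 0 p λ k → C (binomial (α A.- A.1#) (q ∸ k)) Q.* (Q.- X) Q.^ k Q.* C (c k)) ≈ w * Lag γ x
      ε-L = begin
        ε (Q.∑ 0 p f)              ≈⟨ ε.⟦⟧-cong (Q.∑-def p f) ⟩
        ε (RingLemmas.∑ Q p f)     ≈⟨ HomLemmas.hom-∑ Q Kʳ ε-hom p f ⟩
        ∑ p (ε ∘ f)                ≈⟨ ∑-cong p (λ k k<p → term k (ℕₚ.≤-pred k<p)) ⟩
        ∑[ k < p ] (w * ((γ - 1#) ↓ (q ∸ k) * x ^ k)) ≈⟨ *-distribˡ-∑ p w _ ⟨
        w * Lag γ x                ∎
        where
        f : ℕ → Q.Carrier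
        f k = C (binomial (α A.- A.1#) (q ∸ k)) Q.* (Q.- X) Q.^ k Q.* C (c k)
        term : ∀ k → k ≤ q → ε (f k) ≈ w * ((γ - 1#) ↓ (q ∸ k) * x ^ k)
        term k k≤q = begin
          ε (f k)
            ≈⟨ trans (ε.*-homo _ _) (*-congʳ (ε.*-homo _ _)) ⟩
          ε (C (binomial (α A.- A.1#) (q ∸ k))) * ε ((Q.- X) Q.^ k) * ε (C (c k))
            ≈⟨ *-cong (*-cong
                 (trans (ε-C _) (ψ-binomial (q ∸ k) (s≤s (ℕₚ.m∸n≤m q k)) (ψ-[x-1] ψ-α)))
                 (trans (HomLemmas.hom-^ Q Kʳ ε-hom _ k) (trans (^-congˡ k (trans (ε.-‿homo X) (-‿cong ε-X))) ([-x]^k x k))))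
                 (trans (ε-C _) (ψ-c k (s≤s k≤q))) ⟩
          (γ - 1#) ↓ (q ∸ k) * ⌜ (q ∸ k) ! ⌝ ⁻¹ * ((- 1#) ^ k * x ^ k) * ⌜ k ! ⌝ ⁻¹
            ≈⟨ solve 5 (λ y a e x b → y :* a :* (e :* x) :* b := a :* b :* e :* (y :* x)) refl _ _ _ _ _ ⟩
          ⌜ (q ∸ k) ! ⌝ ⁻¹ * ⌜ k ! ⌝ ⁻¹ * (- 1#) ^ k * ((γ - 1#) ↓ (q ∸ k) * x ^ k)
            ≈⟨ *-congʳ (k!⁻¹[q∸k]!⁻¹ k k≤q) ⟩
          w * ((γ - 1#) ↓ (q ∸ k) * x ^ k)
            ∎

module PowerSum (R P Q : CRing) where
  private
    module R = CommutativeRing R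
    module P = RingNotation P
    module Q = RingNotation Q
  open RingLemmas P
  open SetoidReasoning P.setoid

  module _ {φ : Q.Carrier → P.Carrier} (φ-hom : IsHom Q P φ)
           (C : R.Carrier → Q.Carrier) {C′ : R.Carrier → P.Carrier} (C′-hom : IsHom R P C′)
           (φ-C : ∀ a → φ (C a) P.≈ C′ a) (X : Q.Carrier) {Y : P.Carrier} (φ-X : φ X P.≈ Y) where
    private
      module φ = IsRingHomomorphism φ-hom
      module C′ = IsRingHomomorphism C′-hom

    -- Serves both for G itself, with the identity as φ, and for G after the substitution for X.
    φ-power-sum : ∀ q (a b b′ : ℕ → R.Carrier) → (∀ k → k < suc q → b k R.≈ b′ k) →
      φ (Q.- (Q.∑ 1 (suc q) λ k → C (a k) Q.* (X Q.^ k Q.* C (b k)))) P.≈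
      P.- ∑ q (λ i → C′ (a (suc i)) P.* (Y P.^ suc i P.* C′ (b′ (suc i))))
    φ-power-sum q a b b′ b≈b′ = P.trans (φ.-‿homo _) (P.-‿cong (begin
      φ (Q.∑ 1 (suc q) f)                    ≈⟨ φ.⟦⟧-cong (RingLemmas.∑-def Q q (f ∘ suc)) ⟩
      φ (RingLemmas.∑ Q q (f ∘ suc))         ≈⟨ HomLemmas.hom-∑ Q P φ-hom q (f ∘ suc) ⟩
      ∑ q (φ ∘ f ∘ suc)                      ≈⟨ ∑-cong q (λ i i<q → term (suc i) (s≤s i<q)) ⟩
      ∑ q (λ i → C′ (a (suc i)) P.* (Y P.^ suc i P.* C′ (b′ (suc i)))) ∎))
      where
      f : ℕ → Q.Carrier
      f k = C (a k) Q.* (X Q.^ k Q.* C (b k))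
      term : ∀ k → k < suc q → φ (f k) P.≈ C′ (a k) P.* (Y P.^ k P.* C′ (b′ k))
      term k k<p = P.trans (φ.*-homo _ _) (P.*-cong (φ-C (a k)) (P.trans (φ.*-homo _ _)
        (P.*-cong (P.trans (HomLemmas.hom-^ Q P φ-hom X k) (^-congˡ k φ-X))
          (P.trans (φ-C (b k)) (C′.⟦⟧-cong (b≈b′ k k<p))))))

-- Nonvanishing by specialisation at 0.

module NonVanishing (F : DiscreteField) (D : DiscreteDomain) (K : DiscreteField)
  (q : ℕ) (p-prime : Prime (suc q))
  (⌜p⌝≈0-F : suc q ≈0in DiscreteField.commutativeRing F)
  (⌜p⌝≈0 : suc q ≈0in DiscreteField.commutativeRing K)
  {ι : DiscreteDomain.Carrier D → DiscreteField.Carrier K}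
  (ι-hom : IsHom (DiscreteDomain.commutativeRing D) (DiscreteField.commutativeRing K) ι)
  (ι-injective : ∀ {x} → DiscreteField._≈_ K (ι x) (DiscreteField.0# K) →
    DiscreteDomain._≈_ D x (DiscreteDomain.0# D))
  {θ : DiscreteDomain.Carrier D → DiscreteField.Carrier F}
  (θ-hom : IsHom (DiscreteDomain.commutativeRing D) (DiscreteField.commutativeRing F) θ)
  {g : DiscreteDomain.Carrier D} (θ-g : DiscreteField._≈_ F (θ g) (DiscreteField.0# F)) where
  private
    module F = DiscreteField F
    module D = DiscreteDomain D
    module K = DiscreteField K
    module KN = RingNotation K.commutativeRing
    module KL = RingLemmas K.commutativeRing
    module DN = RingNotation D.commutativeRing
    module DL = RingLemmas D.commutativeRing
    module ι = IsRingHomomorphism ι-hom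
    module θ = IsRingHomomorphism θ-hom
    module ιL = HomLemmas D.commutativeRing K.commutativeRing
    module θL = HomLemmas D.commutativeRing F.commutativeRing
    p : ℕ
    p = suc q
  open RingNotation F.commutativeRing hiding (∑; ∏)
  open RingLemmas F.commutativeRing
  open FieldLemmas F
  open FieldCharP F q p-prime ⌜p⌝≈0-F using (⌜⌝-≉0)
  open LaguerreSums F.commutativeRing q using (Lag)
  open PowerFormula K q p-prime ⌜p⌝≈0 using (E; w)
  open SetoidReasoning setoid
  private
    module K′ = FieldLemmas K
    module KC = FieldCharP K q p-prime ⌜p⌝≈0

  -- Only the term k = 0 survives, and it is (-1)(-2) ⋯ (-q), a product of units.
  Lag[0,0]≉0 : Lag 0# 0# ≉0
  Lag[0,0]≉0 = ≉0-resp (sym (begin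
      Lag 0# 0#                                         ≈⟨ ∑-first q _ ⟩
      (0# - 1#) ↓ q * 1# + (∑[ k < q ] ((0# - 1#) ↓ (q ∸ suc k) * 0# ^ suc k)) ≈⟨ +-cong (*-identityʳ _)
        (∑-zero q λ k _ → trans (*-congˡ (0^ k)) (zeroʳ _)) ⟩
      (0# - 1#) ↓ q + 0#                                ≈⟨ +-identityʳ _ ⟩
      (0# - 1#) ↓ q                                     ∎))
    (∏-≉0 q λ i i<q 0-1-i≈0 → ⌜⌝-≉0 (suc i) (s≤s z≤n) (s≤s i<q) (begin
      ⌜ suc i ⌝              ≈⟨ -‿involutive _ ⟨
      - - ⌜ suc i ⌝          ≈⟨ -‿cong (trans (sym (+-identityˡ _)) (sym ([x-y]-z 0# 1# ⌜ i ⌝))) ⟩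
      - (0# - 1# - ⌜ i ⌝)    ≈⟨ trans (-‿cong 0-1-i≈0) -0#≈0# ⟩
      0#                     ∎))

  θ-g^p : θ (g DN.^ p) ≈ 0#
  θ-g^p = trans (θL.hom-^ θ-hom g p) (trans (^-congˡ p θ-g) (0^ q))

  θ-℘g : θ (g DN.^ p DN.- g) ≈ 0#
  θ-℘g = trans (θL.hom-minus θ-hom _ _) (trans (+-cong θ-g^p (-‿cong θ-g)) (-‿inverseʳ 0#))

  -- If E(ι g) were 0, injectivity of ι would make the Laguerre sum formed in D zero; but θ, which
  -- kills g, sends that sum to `Lag 0# 0#`.
  E[ιg]≉0 : ¬ (E (ι g) K.≈ K.0#)
  E[ιg]≉0 = K′.*-≉0 w≉0 λ Lag≈0 → Lag[0,0]≉0 (begin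
    Lag 0# 0#
      ≈⟨ LaguerreSums.Lag-cong F.commutativeRing q (sym θ-g^p) (sym θ-℘g) ⟩
    Lag (θ (g DN.^ p)) (θ (g DN.^ p DN.- g))
      ≈⟨ LaguerreHom.hom-Lag D.commutativeRing F.commutativeRing q θ-hom _ _ ⟨
    θ (LagD (g DN.^ p) (g DN.^ p DN.- g))                  ≈⟨ θ.⟦⟧-cong (ι-injective (K.trans ιLag Lag≈0)) ⟩
    θ D.0#                                                 ≈⟨ θ.0#-homo ⟩
    0#                                                     ∎)
    where
    LagD = LaguerreSums.Lag D.commutativeRing q
    LagK = LaguerreSums.Lag K.commutativeRing q
    w≉0 : ¬ (w K.≈ K.0#)
    w≉0 = K′.unit⇒≉0 (K.trans (K.*-comm _ _) (K.⁻¹-inverseʳ _ (KC.⌜!⌝-≉0 q (ℕₚ.n<1+n q))))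
    ι-g^p : ι (g DN.^ p) K.≈ ι g KN.^ p
    ι-g^p = ιL.hom-^ ι-hom g p
    ιLag : ι (LagD (g DN.^ p) (g DN.^ p DN.- g)) K.≈ LagK (ι g KN.^ p) (ι g KN.^ p K.- ι g)
    ιLag = K.trans (LaguerreHom.hom-Lag D.commutativeRing K.commutativeRing q ι-hom _ _)
      (LaguerreSums.Lag-cong K.commutativeRing q ι-g^p (K.trans (ιL.hom-minus ι-hom _ _) (K.+-congʳ ι-g^p)))

  -- In g ^ p - g = g (g ^ q - 1) the second factor has the image -1 under θ.
  ℘[ιg]≉0 : 0 < q → ¬ (g D.≈ D.0#) → ¬ (ι g KN.^ p K.- ι g K.≈ K.0#)
  ℘[ιg]≉0 0<q g≉0 ℘≈0 with D.noZeroDivisors g (g DN.^ q DN.- D.1#) g[g^q-1]≈0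
    where
    ℘g≈0 : g DN.^ p DN.- g D.≈ D.0#
    ℘g≈0 = ι-injective (K.trans (ιL.hom-minus ι-hom _ _) (K.trans (K.+-congʳ (ιL.hom-^ ι-hom g p)) ℘≈0))
    g[g^q-1]≈0 : g D.* (g DN.^ q DN.- D.1#) D.≈ D.0#
    g[g^q-1]≈0 = D.trans (DL.x[y-z]≈xy-xz _ _ _) (D.trans (D.+-congˡ (D.-‿cong (D.*-identityʳ g))) ℘g≈0)
  ... | inj₁ g≈0     = g≉0 g≈0
  ... | inj₂ g^q-1≈0 = F.1≉0 (begin
    1#                        ≈⟨ θ.1#-homo ⟨
    θ D.1#                    ≈⟨ θ.⟦⟧-cong (DL.x-y≈0⇒x≈y _ _ g^q-1≈0) ⟨
    θ (g DN.^ q)              ≈⟨ trans (θL.hom-^ θ-hom g q) (^-congˡ q θ-g) ⟩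
    0# ^ q                    ≡⟨ ≡.cong (0# ^_) (ℕₚ.m+[n∸m]≡n 0<q) ⟨
    0# ^ suc (q ∸ 1)          ≈⟨ 0^ (q ∸ 1) ⟩
    0#                        ∎)

-- The congruence for G over an abstract polynomial ring.

-- ε plays the role of the substitution of X ^ h / B h for X.
module Assembly (K : DiscreteField) (q : ℕ) (p-prime : Prime (suc q))
  (⌜p⌝≈0 : suc q ≈0in DiscreteField.commutativeRing K)
  (P : CRing) {C : DiscreteField.Carrier K → CommutativeRing.Carrier P}
  (C-hom : IsHom (DiscreteField.commutativeRing K) P C) (X : CommutativeRing.Carrier P) where
  private
    Kʳ = DiscreteField.commutativeRing K
    p : ℕ
    p = suc q
    module K where
      open DiscreteField K public using (_⁻¹)
      open RingNotation Kʳ public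
      open FieldLemmas K public
      open PowerFormula K q p-prime ⌜p⌝≈0 public
  open RingNotation P
  open CongruenceModXᵖ K q p-prime ⌜p⌝≈0 P C-hom X
  open IsRingHomomorphism C-hom using (⟦⟧-cong)

  Gᴮ : (ℕ → K.Carrier) → Carrier
  Gᴮ B = - (∑[ 1 ≤ k < p ] (C (K.⌜ k ⌝ K.⁻¹) * (X ^ k * C (B k K.⁻¹))))

  module _ {α : K.Carrier} (℘α≉0 : α K.^ p K.- α K.≉0) (Eα≉0 : K.E α K.≉0)
           (h : ℕ) (0<h : 0 < h) (h<p : h < p) (Ehα≉0 : K.E (K.⌜ h ⌝ K.* α) K.≉0)
           {B B′ : ℕ → K.Carrier} {c : K.Carrier}
           (B≈ : ∀ k → k < p → B k K.≈ K.B k α) (B′≈ : ∀ k → k < p → B′ k K.≈ K.B k (K.⌜ h ⌝ K.* α))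
           (c≈Eα : c K.≈ K.E α)
           {ε : Carrier → Carrier} (ε-hom : IsHom P P ε) (ε-C : ∀ a → ε (C a) ≈ C a)
           (ε-X : ε X ≈ X ^ h * C (B h K.⁻¹)) where
    open Modular P (X ^ p - C c)

    congruence : ε (Gᴮ B′) ≡ ⌜ h ⌝ * Gᴮ B [mod X ^ p - C c ]
    congruence = mod-trans (mod-reflexive G-composed) (mod-trans
      -- Passes from the modulus with E(α) to the equal one with the given constant c.
      (SemiringDivisibility.∣-respˡ semiring (+-congˡ (-‿cong (⟦⟧-cong (K.sym c≈Eα))))
        (sum≡ ℘α≉0 Eα≉0 h 0<h h<p Ehα≉0))
      (mod-reflexive (*-congˡ (sym G-expanded))))
      where
      G-composed : ε (Gᴮ B′) ≈ - RingLemmas.∑ P q (lhs-term ℘α≉0 Eα≉0 h 0<h h<p Ehα≉0 ∘ suc)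
      G-composed = PowerSum.φ-power-sum Kʳ P P ε-hom C C-hom ε-C X
        (trans ε-X (*-congˡ (⟦⟧-cong (K.⁻¹-cong (B≈ h h<p)))))
        q (λ k → K.⌜ k ⌝ K.⁻¹) _ _ (λ k k<p → K.⁻¹-cong (B′≈ k k<p))

      G-expanded : Gᴮ B ≈ - RingLemmas.∑ P q (rhs-term ℘α≉0 Eα≉0 h 0<h h<p Ehα≉0 ∘ suc)
      G-expanded = PowerSum.φ-power-sum Kʳ P P (Identity.isRingHomomorphism (CommutativeRing.rawRing P) refl)
        C C-hom (λ _ → refl) X refl
        q (λ k → K.⌜ k ⌝ K.⁻¹) _ _ (λ k k<p → K.⁻¹-cong (B≈ k k<p))

-- Instantiation at F(α) and then at F_p.

module FractionEmbedding (D : DiscreteDomain) where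
  open DiscreteDomain D
  open Fractions D

  K-ring : CRing
  K-ring = DiscreteField.commutativeRing fractionField

  ι-hom : IsHom commutativeRing K-ring ι
  ι-hom = HomLemmas.mkHom commutativeRing K-ring ι (λ a≈b → cross (*-congʳ a≈b))
    (λ a b → cross (trans (*-congˡ (*-identityʳ 1#))
      (*-congʳ (+-cong (sym (*-identityʳ a)) (sym (*-identityʳ b))))))
    (λ a b → cross (*-congˡ (*-identityʳ 1#)))
    (cross refl)

  ι-injective : ∀ {a} → ι a ≈ꟳ 0ꟳ → a ≈ 0#
  ι-injective {a} ιa≈0 = trans (sym (*-identityʳ a)) (trans (cross≈ ιa≈0) (zeroˡ 1#))

module Instance (F : DiscreteField) (q : ℕ) (p-prime : Prime (suc q))
  (⌜p⌝≈0-F : suc q ≈0in DiscreteField.commutativeRing F) where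
  open Laguerre F (suc q)
  private
    p : ℕ
    p = suc q
    module FE = FractionEmbedding F[α]
    Fʳ Aʳ Kʳ : CRing
    Fʳ = DiscreteField.commutativeRing F
    Aʳ = DiscreteDomain.commutativeRing F[α]
    Kʳ = DiscreteField.commutativeRing K
    module KL = RingLemmas Kʳ
    module KF = FieldLemmas K
    module FC = FieldCharP F q p-prime ⌜p⌝≈0-F

  const : F.Carrier → K.Carrier
  const a = K.ι (F[α].C a)

  const-hom : IsHom Fʳ Kʳ const
  const-hom = Composition.isRingHomomorphism K.trans (C-hom Fʳ) FE.ι-hom

  ⌜p⌝≈0 : K.⌜ p ⌝ K.≈ K.0#
  ⌜p⌝≈0 = K.trans (K.sym (HomLemmas.hom-⌜⌝ Fʳ Kʳ const-hom p))
    (K.trans (IsRingHomomorphism.⟦⟧-cong const-hom ⌜p⌝≈0-F) (IsRingHomomorphism.0#-homo const-hom))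

  module PF = PowerFormula K q p-prime ⌜p⌝≈0

  -- The two inverses are computed in different fields, each by its own decision; uniqueness
  -- identifies them.
  const-inverse : ∀ n → ¬ (F.⌜ n ⌝ F.≈ F.0#) → const (F.⌜ n ⌝ F.⁻¹) K.≈ K.⌜ n ⌝ K.⁻¹
  const-inverse n n≉0 = K.sym (KF.⁻¹-unique {K.⌜ n ⌝} (K.trans
    (K.*-congʳ {const (F.⌜ n ⌝ F.⁻¹)} (K.sym (HomLemmas.hom-⌜⌝ Fʳ Kʳ const-hom n)))
    (K.trans (K.sym (IsRingHomomorphism.*-homo const-hom F.⌜ n ⌝ (F.⌜ n ⌝ F.⁻¹)))
      (K.trans (IsRingHomomorphism.⟦⟧-cong const-hom (DiscreteField.⁻¹-inverseʳ F _ n≉0))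
        (IsRingHomomorphism.1#-homo const-hom)))))

  module At (γ : K.Carrier) where
    private
      module Ev = Evaluation Fʳ Kʳ const-hom γ

    at-hom : IsHom Aʳ Kʳ (_at γ)
    at-hom = Ev.eval-hom

    module Sp = Specialisation.At K q p-prime ⌜p⌝≈0 Aʳ at-hom (λ n → F[α].C (F.⌜ n ! ⌝ F.⁻¹))
      (λ n n<p → K.trans (Ev.eval-C (F.⌜ n ! ⌝ F.⁻¹)) (const-inverse (n !) (FC.⌜!⌝-≉0 n n<p)))
      F[α].α Ev.eval-X

    b-at : ∀ s → 0 < s → s < p → b 1 s at γ K.≈ PF.b s γ
    b-at s 0<s s<p = Sp.ψ-b s (F[α].C t) (K.trans (Ev.eval-C t) (K.trans
      (IsRingHomomorphism.-‿homo const-hom (F.⌜ 1 ⌝ F.* F.⌜ s ⌝ F.⁻¹))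
      (K.-‿cong (K.trans (IsRingHomomorphism.⟦⟧-cong const-hom
        (F.trans (F.*-congʳ (F.+-identityʳ F.1#)) (F.*-identityˡ _)))
        (const-inverse s (FC.⌜⌝-≉0 s 0<s s<p))))))
      where
      t : F.Carrier
      t = F.- (F.⌜ 1 ⌝ F.* F.⌜ s ⌝ F.⁻¹)

    L≈ : ∀ x → L⟨ γ , x ⟩ K.≈ PF.w K.* LaguerreSums.Lag Kʳ q γ x
    L≈ x = Sp.ε-L (Aʳ [X]) EvX.eval-hom F[α,X].C EvX.eval-C F[α,X].X EvX.eval-X
      where module EvX = Evaluation Aʳ Kʳ at-hom x

    B≈ : ∀ k → k < p → K.∏ 1 k (λ s → b 1 s at γ) K.≈ PF.B k γ
    B≈ k k<p = K.trans (KL.∏-def (k ∸ 1) (λ i → b 1 (suc i) at γ))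
      (KL.∏-cong (k ∸ 1) λ i i<k-1 → b-at (suc i) (s≤s z≤n) (ℕₚ.<-trans (lemma i k i<k-1) k<p))
      where
      lemma : ∀ i k → i < k ∸ 1 → suc i < k
      lemma i (suc k) i<k = s≤s i<k

  -- The specialisation of α to 0.
  θ-hom : IsHom Aʳ Fʳ (eval Fʳ Fʳ id F.0#)
  θ-hom = Evaluation.eval-hom Fʳ Fʳ (Identity.isRingHomomorphism (CommutativeRing.rawRing Fʳ) F.refl) F.0#

  θ-α : eval Fʳ Fʳ id F.0# F[α].α F.≈ F.0#
  θ-α = Evaluation.eval-X Fʳ Fʳ (Identity.isRingHomomorphism (CommutativeRing.rawRing Fʳ) F.refl) F.0#

  α≉0 : ¬ (F[α].α F[α].≈ F[α].0#)
  α≉0 α≈0 = DiscreteField.1≉0 F (PolynomialBase.coeff≈ α≈0 1)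

  θ-hα : ∀ h → eval Fʳ Fʳ id F.0# (F[α].⌜ h ⌝ F[α].* F[α].α) F.≈ F.0#
  θ-hα h = F.trans (IsRingHomomorphism.*-homo θ-hom F[α].⌜ h ⌝ F[α].α)
    (F.trans (F.*-congˡ θ-α) (F.zeroʳ _))

  module NV {g : F[α].Carrier} (θ-g : eval Fʳ Fʳ id F.0# g F.≈ F.0#) =
    NonVanishing F F[α] K q p-prime ⌜p⌝≈0-F ⌜p⌝≈0 FE.ι-hom FE.ι-injective θ-hom {g} θ-g

  Eα≉0 : PF.E K.α KF.≉0
  Eα≉0 = NV.E[ιg]≉0 θ-α

  -- The polynomial h α also vanishes at α = 0, so it may take the place of g.
  Ehα≉0 : ∀ h → PF.E (K.⌜ h ⌝ K.* K.α) KF.≉0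
  Ehα≉0 h = KF.≉0-resp (PF.E-cong {K.ι (F[α].⌜ h ⌝ F[α].* F[α].α)} {K.⌜ h ⌝ K.* K.α}
    (K.trans (IsRingHomomorphism.*-homo FE.ι-hom F[α].⌜ h ⌝ F[α].α)
      (K.*-congʳ {K.α} (HomLemmas.hom-⌜⌝ Aʳ Kʳ FE.ι-hom h))))
    (NV.E[ιg]≉0 (θ-hα h))

  -- Kʳ [X] is the same ring, but the conversion check would then unfold the proofs of the ring laws.
  K[X]ʳ : CRing
  K[X]ʳ = record { isCommutativeRing = K[X].isCommutativeRing }

  C-hom′ : IsHom Kʳ K[X]ʳ K[X].C
  C-hom′ = C-hom Kʳ

  G-congruence : ∀ h (0<h : 0 < h) (h<p : h < p) → let open K[X] in
    G (K.⌜ h ⌝ K.* K.α) ∘ᴾ (X ^ h * C ((K.∏[ 1 ≤ s < h ] (b 1 s at K.α)) K.⁻¹))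
      ≡ ⌜ h ⌝ * G K.α [mod X ^ p - C L⟨ K.α K.^ p , K.α K.^ p K.- K.α ⟩ ]
  G-congruence h 0<h h<p = Assembly.congruence K q p-prime ⌜p⌝≈0 K[X]ʳ C-hom′ X
    (NV.℘[ιg]≉0 θ-α (ℕₚ.<-≤-trans 0<h (ℕₚ.≤-pred h<p)) α≉0) Eα≉0 h 0<h h<p (Ehα≉0 h)
    {Bα} (At.B≈ K.α) (At.B≈ (K.⌜ h ⌝ K.* K.α)) (At.L≈ (K.α K.^ p) (K.α K.^ p K.- K.α))
    {eval Kʳ K[X]ʳ C Y} Ev.eval-hom Ev.eval-C Ev.eval-X
    where
    open K[X]
    Bα : ℕ → K.Carrier
    Bα k = K.∏[ 1 ≤ s < k ] (b 1 s at K.α)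
    Y : Carrier
    Y = X ^ h * C (Bα h K.⁻¹)
    module Ev = Evaluation Kʳ K[X]ʳ {C} C-hom′ Y

⌜n⌝≡+n : ∀ p (p-prime : Prime p) n →
  let open RingNotation (DiscreteField.commutativeRing (𝔽 p p-prime)) in ⌜ n ⌝ ≡ ℤ.+ n
⌜n⌝≡+n p p-prime zero    = ≡.refl
⌜n⌝≡+n p p-prime (suc n) = ≡.cong ℤ.suc (⌜n⌝≡+n p p-prime n)

p≈0in𝔽 : ∀ p (p-prime : Prime p) → p ≈0in DiscreteField.commutativeRing (𝔽 p p-prime)
p≈0in𝔽 p p-prime rewrite ⌜n⌝≡+n p p-prime p =
  PrimeField.congruent (≡.subst (ℤ.+ p ℤ∣.∣_) (≡.sym (ℤₚ.+-identityʳ (ℤ.+ p))) ℤ∣.∣-refl)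

-- At F = 𝔽 p, the conversion check of two terms x ⁻¹ and y ⁻¹ unfolds the decision of x ≈ 0
-- and does not end in reasonable time, unless x and y agree literally.  In theorem8-over, all
-- such subterms are therefore left to unification; product-like keeps the product under ⁻¹
-- from being blocked by a metavariable.
product-like : ∀ {R : CRing} {f g} → PolynomialBase._≈ᴾ_ R f g → ∀ {n} →
  (Fin n → CommutativeRing.Carrier R) → CommutativeRing.Carrier R
product-like {R} _ g = MonoidSum.sum (CommutativeRing.*-commutativeMonoid R) g

theorem8-over : (F : DiscreteField) (p : ℕ) → Prime p →
  p ≈0in DiscreteField.commutativeRing F →
  (h : ℕ) → 0 < h → h < p →
  let open Laguerre F p
      open K[X]
  in ∀ {γ₁ γ₂ γ₃ γ₄} {g : Fin (h ∸ 1) → K.Carrier} →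
     γ₁ ≡ K.⌜ h ⌝ K.* K.α → γ₂ ≡ K.α → γ₃ ≡ K.α K.^ p → γ₄ ≡ K.α K.^ p K.- K.α →
     g ≡ (λ i → b 1 (1 ℕ.+ toℕ i) at K.α) →
     RawMagma._∣ʳ_ *-rawMagma (X ^ p - C L⟨ γ₃ , γ₄ ⟩)
       (G γ₁ ∘ᴾ (X ^ h * C (product-like (refl {0#}) g K.⁻¹)) - ⌜ h ⌝ * G γ₂)
theorem8-over F (suc q) p-prime ⌜p⌝≈0-F h 0<h h<p ≡.refl ≡.refl ≡.refl ≡.refl ≡.refl =
  Instance.G-congruence F q p-prime ⌜p⌝≈0-F h 0<h h<p

theorem8 : (p : ℕ) (p-prime : Prime p) → 2 ∤ p → (h : ℕ) → 0 < h → h < p →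
    let open Laguerre (𝔽 p p-prime) p
        open K[X]
    in G (K.⌜ h ⌝ K.* K.α) ∘ᴾ (X ^ h * C ((K.∏[ 1 ≤ s < h ] (b 1 s at K.α)) K.⁻¹))
         ≡ ⌜ h ⌝ * G K.α
         [mod X ^ p - C L⟨ K.α K.^ p , K.α K.^ p K.- K.α ⟩ ]
theorem8 p p-prime _ h 0<h h<p = theorem8-over (𝔽 p p-prime) p p-prime (p≈0in𝔽 p p-prime) h 0<h h<p
  ≡.refl ≡.refl ≡.refl ≡.refl ≡.refl
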